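{- Let $n,k\ge 4$ be integers with $n\ge 2k+1$. Then $gp(Kn_{n,k})\le \binom{n-1}{k-1}$. Moreover, if $n\ge 2.5k-0.5$, then $gp(Kn_{n,k})=\binom{n-1}{k-1}$, while if $2k+1\le n<2.5k-0.5$, then $gp(Kn_{n,k})<\binom{n-1}{k-1}$.
   Context: For a connected graph $G$, a geodesic between two vertices $x,y$ is a shortest path from $x$ to $y$. A set $S$ of vertices of $G$ is in general position if no vertex of $S$ lies on any geodesic between two other vertices of $S$. The general position number $gp(G)$ is the maximum size of a set of vertices of $G$ in general position. The Kneser graph $Kn_{n,k}$ has vertex set $\binom{[n]}{k}$, the family of all $k$-element subsets of $[n]=\{1,\dots,n\}$, with two $k$-sets adjacent if and only if they are disjoint. -}

module Defs where

open import Data.Nat using (ℕ; zero; suc; _≤_)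
open import Data.Product using (Σ; ∃; _×_; _,_; proj₁)
open import Relation.Nullary using (¬_)
open import Data.List using (List; length)
open import Data.List.Membership.Propositional using (_∈_)
open import Data.List.Relation.Unary.Unique.Propositional using (Unique)
open import Data.Fin.Subset using (Subset; ∣_∣; _∩_; Empty)
open import Relation.Binary.PropositionalEquality using (_≡_; _≢_)

record Graph : Set₁ where
  field
    V   : Set
    Adj : V → V → Set

module _ (G : Graph) where
  open Graph G

  data Walk : V → V → ℕ → Set where
    []  : ∀ {x} → Walk x x 0
    _∷_ : ∀ {x y z m} → Adj x y → Walk y z m → Walk x z (suc m)

  data OnWalk (z : V) : ∀ {x y m} → Walk x y m → Set where
    here  : ∀ {y m} {w : Walk z y m} → OnWalk z w
    there : ∀ {x y u m} {e : Adj x u} {w : Walk u y m} → OnWalk z w → OnWalk z (e ∷ w)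

  IsGeodesic : ∀ {x y m} → Walk x y m → Set
  IsGeodesic {x} {y} {m} _ = ∀ m' → Walk x y m' → m ≤ m'

  LiesOnGeodesic : V → V → V → Set
  LiesOnGeodesic z x y = ∃ λ m → Σ (Walk x y m) λ w → IsGeodesic w × OnWalk z w

  GeneralPosition : List V → Set
  GeneralPosition S = ∀ {x y z} → x ∈ S → y ∈ S → z ∈ S → z ≢ x → z ≢ y →
                      ¬ LiesOnGeodesic z x y

  GpAtMost : ℕ → Set
  GpAtMost N = ∀ (S : List V) → Unique S → GeneralPosition S → length S ≤ N

  GpIs : ℕ → Set
  GpIs N = (∃ λ (S : List V) → Unique S × GeneralPosition S × length S ≡ N) × GpAtMost N

Kneser : ℕ → ℕ → Graph
Kneser n k = record
  { V   = Σ (Subset n) (λ s → ∣ s ∣ ≡ k)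
  ; Adj = λ s t → Empty (proj₁ s ∩ proj₁ t)
  }

{-# OPTIONS --safe #-}
-- Disjointness is transitive on a family in general position: if B is disjoint from the distinct
-- sets A and D, which meet, then A, B, D is a geodesic.  So the family consists of a part F of sets
-- meeting all other members and of cliques; let M hold one pair (X , Y) from every clique.
--
-- Upper bound.  Put the n points on a cycle in random order.  If some member of F is an arc, then,
-- as in Katona's proof of the Erdős–Ko–Rado theorem, the arcs from F and the pairs whose two
-- members lie in complementary arcs have distinct cut points among the k ones at the first arc, so
-- there are at most k of them; otherwise each such pair has two cut points of its own, so there are
-- at most n / 2.  Averaging gives n |F| W + 4 k |M| B ≤ n B W with B = (n-1) C (k-1) and
-- W = (2k) C k, which is enough when n ≥ 2k + 2, except for k = 4 and n = 10.
--
-- Strictness for 2n + 1 < 5k.  Take one set from every clique.  If k of these are arcs, they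
-- start at consecutive points, and three of them lie on a geodesic of length 4; so at most k - 1 are
-- arcs.  Moreover two sets in cliques never share k - 1 points, so there are fewer than B / k pairs.
--
-- Equality for 2n + 1 ≥ 5k.  The graph has diameter at most 3, so stars are in general position.

module Submission where

open import Defs
open import Data.Nat using (ℕ; zero; suc; _+_; _*_; _∸_; _!; _≤_; _<_; _≟_; _≤?_; z≤n; s≤s; NonZero; >-nonZero; ≢-nonZero)
open import Data.Nat.Properties hiding (_≟_; _≤?_; _<?_)
open import Data.Nat.DivMod using (_%_; _/_; _mod_; m%n<n; m<n⇒m%n≡m; %-distribˡ-+; m%n%n≡m%n; [m+n]%n≡m%n; n%n≡0; m/n*n≤m; m/n*n≡m; m*n/n≡m; /-monoˡ-≤)
open import Data.Nat.Combinatorics using (_C_; nCk≡n!/k![n-k]!; k![n∸k]!∣n!; nCk+nC[k+1]≡[n+1]C[k+1])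
open import Data.Nat.ListAction using (sum)
open import Data.Nat.Solver using (module +-*-Solver)
open import Data.Fin using (Fin; zero; suc; toℕ; punchIn; punchOut)
import Data.Fin.Properties as Fin
open import Data.Fin.Subset using (Subset; ∣_∣; _∩_; _∪_; ∁; _∈_; _⊆_; Empty; Nonempty) renaming (⊥ to ∅)
import Data.Fin.Subset.Properties as Sub
open import Data.Bool using (Bool; true; false)
open import Data.Product using (∃; _×_; _,_; proj₁; proj₂)
open import Data.Product.Properties using (,-injectiveˡ; ,-injectiveʳ)
open import Data.Sum using (_⊎_; inj₁; inj₂)
open import Data.Unit using (⊤; tt)
open import Data.Empty using (⊥; ⊥-elim)
open import Data.Vec using ([]; _∷_)
import Data.Bool as Bool
import Data.Vec as Vec
import Data.Vec.Properties as Vec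
open import Data.List using (List; []; _∷_; _++_; map; length; filter; concatMap; allFin; upTo; tabulate; cartesianProduct)
import Data.List as List
import Data.List.Properties as List
open import Data.List.Membership.Propositional using (find; lose) renaming (_∈_ to _∈ₗ_)
import Data.List.Membership.Propositional.Properties as ∈ₗ
open import Data.List.Relation.Unary.All using (All; []; _∷_)
import Data.List.Relation.Unary.All as All
import Data.List.Relation.Unary.All.Properties as All
open import Data.List.Relation.Unary.Any using (Any; here; there; index; any?)
import Data.List.Relation.Unary.Any.Properties as Any
open import Data.List.Relation.Unary.AllPairs using (AllPairs; []; _∷_)
import Data.List.Relation.Unary.AllPairs as AllPairs
import Data.List.Relation.Unary.AllPairs.Properties as AllPairs
open import Data.List.Relation.Unary.Unique.Propositional using (Unique)
import Data.List.Relation.Unary.Unique.Propositional.Properties as Unique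
open import Function using (_∘_; id; case_of_)
open import Relation.Nullary using (¬_; Dec; yes; no; ¬?; contradiction; _×-dec_; _⊎-dec_)
open import Relation.Unary using (Decidable)
open import Relation.Binary.PropositionalEquality using (_≡_; _≢_; ≢-sym; refl; sym; trans; cong; cong₂; subst; subst₂; module ≡-Reasoning)

-- Finite sums

-- Arcs alone are bounded by Katona's argument and separated pairs alone by Bollobás' inequality.
-- The difficulty is that `F` and `M` occur together, so that both kinds of event have to be charged
-- to one supply of cut points. This works because a set outside a clique meets its members: two
-- pairs from different cliques have all four cross intersections nonempty, which keeps them from
-- sharing a cut. A clique enters through a single pair, whose weight must pay for all its members.
-- This becomes a numerical inequality between `B` and `W`, with `n / k` or 2 as the bound on
-- cliques. It fails for `n = 2 k + 1`; but there `4 k + 3 < 5 k`, since `k ≥ 4`, so the strict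
-- bound takes over. In the strict range cliques have at most two members, and what the intersecting
-- family of `F` and all first members lacks in Katona's bound exceeds the number of second members.

∑ : ∀ {A : Set} → List A → (A → ℕ) → ℕ
∑ xs f = sum (map f xs)

∑-cong : ∀ {A : Set} {f g : A → ℕ} (xs : List A) → (∀ x → f x ≡ g x) → ∑ xs f ≡ ∑ xs g
∑-cong []       f≗g = refl
∑-cong (x ∷ xs) f≗g = cong₂ _+_ (f≗g x) (∑-cong xs f≗g)

∑-cong-∈ : ∀ {A : Set} {f g : A → ℕ} (xs : List A) → (∀ {x} → x ∈ₗ xs → f x ≡ g x) → ∑ xs f ≡ ∑ xs g
∑-cong-∈ []       f≗g = refl
∑-cong-∈ (x ∷ xs) f≗g = cong₂ _+_ (f≗g (here refl)) (∑-cong-∈ xs (f≗g ∘ there))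

∑-mono : ∀ {A : Set} {f g : A → ℕ} (xs : List A) → (∀ x → f x ≤ g x) → ∑ xs f ≤ ∑ xs g
∑-mono []       f≤g = z≤n
∑-mono (x ∷ xs) f≤g = +-mono-≤ (f≤g x) (∑-mono xs f≤g)

∑-const : ∀ {A : Set} (xs : List A) m → ∑ xs (λ _ → m) ≡ length xs * m
∑-const []       m = refl
∑-const (x ∷ xs) m = cong (m +_) (∑-const xs m)

∑-+ : ∀ {A : Set} (xs : List A) (f g : A → ℕ) → ∑ xs (λ x → f x + g x) ≡ ∑ xs f + ∑ xs g
∑-+ []       f g = refl
∑-+ (x ∷ xs) f g = begin
  f x + g x + ∑ xs (λ x → f x + g x) ≡⟨ cong (f x + g x +_) (∑-+ xs f g) ⟩
  f x + g x + (∑ xs f + ∑ xs g)      ≡⟨ +-+-comm (f x) (g x) (∑ xs f) (∑ xs g) ⟩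
  f x + ∑ xs f + (g x + ∑ xs g)      ∎
  where
  open ≡-Reasoning
  open +-*-Solver
  +-+-comm : ∀ a b c d → a + b + (c + d) ≡ a + c + (b + d)
  +-+-comm = solve 4 (λ a b c d → a :+ b :+ (c :+ d) := a :+ c :+ (b :+ d)) refl

∑-*ˡ : ∀ {A : Set} (xs : List A) m (f : A → ℕ) → ∑ xs (λ x → m * f x) ≡ m * ∑ xs f
∑-*ˡ []       m f = sym (*-zeroʳ m)
∑-*ˡ (x ∷ xs) m f = trans (cong (m * f x +_) (∑-*ˡ xs m f)) (sym (*-distribˡ-+ m (f x) (∑ xs f)))

∑-*ʳ : ∀ {A : Set} (xs : List A) (f : A → ℕ) m → ∑ xs (λ x → f x * m) ≡ ∑ xs f * m
∑-*ʳ []       f m = refl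
∑-*ʳ (x ∷ xs) f m = trans (cong (f x * m +_) (∑-*ʳ xs f m)) (sym (*-distribʳ-+ m (f x) (∑ xs f)))

∑-++ : ∀ {A : Set} (xs ys : List A) (f : A → ℕ) → ∑ (xs ++ ys) f ≡ ∑ xs f + ∑ ys f
∑-++ []       ys f = refl
∑-++ (x ∷ xs) ys f = trans (cong (f x +_) (∑-++ xs ys f)) (sym (+-assoc (f x) _ _))

∑-map : ∀ {A B : Set} (g : A → B) (xs : List A) (f : B → ℕ) → ∑ (map g xs) f ≡ ∑ xs (f ∘ g)
∑-map g []       f = refl
∑-map g (x ∷ xs) f = cong (f (g x) +_) (∑-map g xs f)

∑-concatMap : ∀ {A B : Set} (g : A → List B) (xs : List A) (f : B → ℕ) →
              ∑ (concatMap g xs) f ≡ ∑ xs (λ x → ∑ (g x) f)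
∑-concatMap g []       f = refl
∑-concatMap g (x ∷ xs) f = trans (∑-++ (g x) _ f) (cong (∑ (g x) f +_) (∑-concatMap g xs f))

∑-cartesianProduct : ∀ {A B : Set} (xs : List A) (ys : List B) (f : A × B → ℕ) →
                     ∑ (cartesianProduct xs ys) f ≡ ∑ xs (λ x → ∑ ys (λ y → f (x , y)))
∑-cartesianProduct []       ys f = refl
∑-cartesianProduct (x ∷ xs) ys f =
  trans (∑-++ (map (x ,_) ys) _ f) (cong₂ _+_ (∑-map (x ,_) ys f) (∑-cartesianProduct xs ys f))

∑-swap : ∀ {A B : Set} (xs : List A) (ys : List B) (f : A → B → ℕ) →
         ∑ xs (λ x → ∑ ys (f x)) ≡ ∑ ys (λ y → ∑ xs (λ x → f x y))
∑-swap []       ys f = sym (trans (∑-const ys 0) (*-zeroʳ (length ys)))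
∑-swap (x ∷ xs) ys f = trans (cong (∑ ys (f x) +_) (∑-swap xs ys f))
                             (sym (∑-+ ys (f x) (λ y → ∑ xs (λ x → f x y))))

∑≢0⇒∃≢0 : ∀ {A : Set} (xs : List A) {f : A → ℕ} → ∑ xs f ≢ 0 → ∃ λ x → x ∈ₗ xs × f x ≢ 0
∑≢0⇒∃≢0 []       ∑≢0 = contradiction refl ∑≢0
∑≢0⇒∃≢0 (x ∷ xs) {f} ∑≢0 with f x ≟ 0
... | no  fx≢0 = x , here refl , fx≢0
... | yes fx≡0 with ∑≢0⇒∃≢0 xs {f} (λ ∑≡0 → ∑≢0 (cong₂ _+_ fx≡0 ∑≡0))
...   | z , z∈ , fz≢0 = z , there z∈ , fz≢0

∑≤1 : ∀ {A : Set} {xs : List A} {f : A → ℕ} → (∀ x → f x ≤ 1) →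
      AllPairs (λ x y → f x ≢ 0 → f y ≢ 0 → ⊥) xs → ∑ xs f ≤ 1
∑≤1 f≤1 [] = z≤n
∑≤1 {xs = x ∷ xs} {f} f≤1 (px ∷ pxs) with f x ≟ 0
... | yes fx≡0 rewrite fx≡0 = ∑≤1 f≤1 pxs
... | no  fx≢0 = subst (_≤ 1) (trans (sym (+-identityʳ (f x))) (cong (f x +_) (sym ∑≡0))) (f≤1 x)
  where
  ∑≡0 : ∑ xs f ≡ 0
  ∑≡0 with ∑ xs f ≟ 0
  ... | yes eq = eq
  ... | no  ne with ∑≢0⇒∃≢0 xs {f} ne
  ...   | y , y∈ , fy≢0 = ⊥-elim (All.lookup px y∈ fx≢0 fy≢0)

∑-tabulate-punchIn : ∀ {A : Set} {m} (g : Fin (suc m) → A) (f : A → ℕ) i →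
                     ∑ (tabulate g) f ≡ f (g i) + ∑ (tabulate (g ∘ punchIn i)) f
∑-tabulate-punchIn             g f zero    = refl
∑-tabulate-punchIn {m = suc m} g f (suc i) = begin
  f (g zero) + ∑ (tabulate (g ∘ suc)) f ≡⟨ cong (f (g zero) +_) (∑-tabulate-punchIn (g ∘ suc) f i) ⟩
  f (g zero) + (f (g (suc i)) + rest)   ≡⟨ +-assoc (f (g zero)) _ rest ⟨
  f (g zero) + f (g (suc i)) + rest     ≡⟨ cong (_+ rest) (+-comm (f (g zero)) _) ⟩
  f (g (suc i)) + f (g zero) + rest     ≡⟨ +-assoc (f (g (suc i))) _ rest ⟩
  f (g (suc i)) + (f (g zero) + rest)   ∎
  where
  open ≡-Reasoning
  rest : ℕ
  rest = ∑ (tabulate (g ∘ suc ∘ punchIn i)) f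

∑-tabulate : ∀ {A : Set} {m} (g : Fin m → A) (f : A → ℕ) → ∑ (tabulate g) f ≡ ∑ (allFin m) (f ∘ g)
∑-tabulate {m = zero}  g f = refl
∑-tabulate {m = suc m} g f = cong (f (g zero) +_)
  (trans (∑-tabulate (g ∘ suc) f) (sym (∑-tabulate suc (f ∘ g))))

∑-allFin-punchIn : ∀ {m} (f : Fin (suc m) → ℕ) i →
                   ∑ (allFin (suc m)) f ≡ f i + ∑ (allFin m) (f ∘ punchIn i)
∑-allFin-punchIn f i = trans (∑-tabulate-punchIn id f i) (cong (f i +_) (∑-tabulate (punchIn i) f))

-- Counting by injective keys

lookup-injective : ∀ {A : Set} {xs : List A} → Unique xs → ∀ {i j} → List.lookup xs i ≡ List.lookup xs j → i ≡ j
lookup-injective (px ∷ u) {zero}  {zero}  eq = refl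
lookup-injective {xs = x ∷ xs} (px ∷ u) {zero}  {suc j} eq = contradiction eq (All.lookup px (∈ₗ.∈-lookup {xs = xs} j))
lookup-injective {xs = x ∷ xs} (px ∷ u) {suc i} {zero}  eq = contradiction (sym eq) (All.lookup px (∈ₗ.∈-lookup {xs = xs} i))
lookup-injective (px ∷ u) {suc i} {suc j} eq = cong suc (lookup-injective u eq)

length≤length-keys : ∀ {A B : Set} {xs : List A} {ks : List B} → Unique xs → (R : A → B → Set) →
                     (∀ {x} → x ∈ₗ xs → ∃ λ b → b ∈ₗ ks × R x b) →
                     (∀ {x z b} → x ∈ₗ xs → z ∈ₗ xs → R x b → R z b → x ≡ z) →
                     length xs ≤ length ks
length≤length-keys {xs = xs} {ks} u R key inj = Fin.injective⇒≤ {f = λ i → index (proj₁ (proj₂ (k i)))} λ {i} {j} eq →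
  lookup-injective u (inj (∈ₗ.∈-lookup {xs = xs} i) (∈ₗ.∈-lookup {xs = xs} j) (proj₂ (proj₂ (k i)))
    (subst (R _) (sym (trans (Any.lookup-index (proj₁ (proj₂ (k i)))) (trans (cong (List.lookup ks) eq) (sym (Any.lookup-index (proj₁ (proj₂ (k j)))))))) (proj₂ (proj₂ (k j)))))
  where
  k : ∀ i → ∃ λ b → b ∈ₗ ks × R (List.lookup xs i) b
  k i = key (∈ₗ.∈-lookup {xs = xs} i)

∑≤length-filter : ∀ {A : Set} (xs : List A) (e : A → ℕ) → (∀ x → e x ≤ 1) →
                  ∑ xs e ≤ length (filter (λ x → ¬? (e x ≟ 0)) xs)
∑≤length-filter []       e e≤1 = z≤n
∑≤length-filter (x ∷ xs) e e≤1 with e x in eq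
... | zero  = ∑≤length-filter xs e e≤1
... | suc m = +-mono-≤ (subst (_≤ 1) eq (e≤1 x)) (∑≤length-filter xs e e≤1)

-- All bounds for a single permutation are instances: `e` is the indicator of an event, every
-- occurring event owns a key, and no key has two owners. Ownership is a relation because the key,
-- usually a cut point, comes out of an existence proof.
∑≤length-keys : ∀ {A B : Set} {xs : List A} {ks : List B} → Unique xs → (e : A → ℕ) → (∀ x → e x ≤ 1) →
                (R : A → B → Set) →
                (∀ {x} → x ∈ₗ xs → e x ≢ 0 → ∃ λ b → b ∈ₗ ks × R x b) →
                (∀ {x z b} → x ∈ₗ xs → z ∈ₗ xs → R x b → R z b → x ≡ z) →
                ∑ xs e ≤ length ks
∑≤length-keys {xs = xs} u e e≤1 R key inj = ≤-trans (∑≤length-filter xs e e≤1)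
  (length≤length-keys (Unique.filter⁺ e≢0? u) R
    (λ x∈ → let x∈xs , ex≢0 = ∈ₗ.∈-filter⁻ e≢0? x∈ in key x∈xs ex≢0)
    (λ x∈ z∈ → inj (proj₁ (∈ₗ.∈-filter⁻ e≢0? x∈)) (proj₁ (∈ₗ.∈-filter⁻ e≢0? z∈))))
  where
  e≢0? : ∀ x → Dec (e x ≢ 0)
  e≢0? x = ¬? (e x ≟ 0)

-- Permutations

-- One alphabet serves both kinds of event: a single set is written with `inX` alone, a pair of
-- disjoint sets with both marked letters, so one count of matching permutations covers arcs and
-- pairs.
data Letter : Set where
  out inX inY : Letter

δ : Letter → Letter → ℕ
δ out out = 1
δ inX inX = 1
δ inY inY = 1
δ _   _   = 0

δ≤1 : ∀ a b → δ a b ≤ 1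
δ≤1 out out = ≤-refl
δ≤1 inX inX = ≤-refl
δ≤1 inY inY = ≤-refl
δ≤1 out inX = z≤n
δ≤1 out inY = z≤n
δ≤1 inX out = z≤n
δ≤1 inX inY = z≤n
δ≤1 inY out = z≤n
δ≤1 inY inX = z≤n

δ≢0⇒≡ : ∀ {a b} → δ a b ≢ 0 → a ≡ b
δ≢0⇒≡ {out} {out} _ = refl
δ≢0⇒≡ {inX} {inX} _ = refl
δ≢0⇒≡ {inY} {inY} _ = refl
δ≢0⇒≡ {out} {inX} p = contradiction refl p
δ≢0⇒≡ {out} {inY} p = contradiction refl p
δ≢0⇒≡ {inX} {out} p = contradiction refl p
δ≢0⇒≡ {inX} {inY} p = contradiction refl p
δ≢0⇒≡ {inY} {out} p = contradiction refl p
δ≢0⇒≡ {inY} {inX} p = contradiction refl p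

-- A permutation of Fin n, listed as the successive choices among the elements still available.
data Code : ℕ → Set where
  []  : Code 0
  _∷_ : ∀ {n} → Fin (suc n) → Code n → Code (suc n)

codes : ∀ n → List (Code n)
codes zero    = [] ∷ []
codes (suc n) = concatMap (λ i → map (i ∷_) (codes n)) (allFin (suc n))

∑-codes : ∀ n (f : Code (suc n) → ℕ) → ∑ (codes (suc n)) f ≡ ∑ (allFin (suc n)) (λ i → ∑ (codes n) (f ∘ (i ∷_)))
∑-codes n f = trans (∑-concatMap (λ i → map (i ∷_) (codes n)) (allFin (suc n)) f)
                    (∑-cong (allFin (suc n)) (λ i → ∑-map (i ∷_) (codes n) f))

length-codes : ∀ n → length (codes n) ≡ n !
length-codes zero    = refl
length-codes (suc n) = begin
  length (codes (suc n))                               ≡⟨ sym (*-identityʳ _) ⟩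
  length (codes (suc n)) * 1                           ≡⟨ sym (∑-const (codes (suc n)) 1) ⟩
  ∑ (codes (suc n)) (λ _ → 1)                          ≡⟨ ∑-codes n (λ _ → 1) ⟩
  ∑ (allFin (suc n)) (λ i → ∑ (codes n) (λ _ → 1))     ≡⟨ ∑-const (allFin (suc n)) _ ⟩
  length (allFin (suc n)) * ∑ (codes n) (λ _ → 1)      ≡⟨ cong₂ _*_ (List.length-tabulate {n = suc n} id) (trans (∑-const (codes n) 1) (*-identityʳ _)) ⟩
  suc n * length (codes n)                             ≡⟨ cong (suc n *_) (length-codes n) ⟩
  suc n * n !                                          ∎
  where open ≡-Reasoning

perm : ∀ {n} → Code n → Fin n → Fin n
perm (i ∷ c) zero    = i
perm (i ∷ c) (suc j) = punchIn i (perm c j)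

perm-injective : ∀ {n} (c : Code n) {i j} → perm c i ≡ perm c j → i ≡ j
perm-injective (i ∷ c) {zero}  {zero}  eq = refl
perm-injective (i ∷ c) {zero}  {suc b} eq = contradiction (sym eq) (Fin.punchInᵢ≢i i _)
perm-injective (i ∷ c) {suc a} {zero}  eq = contradiction eq (Fin.punchInᵢ≢i i _)
perm-injective (i ∷ c) {suc a} {suc b} eq = cong suc (perm-injective c (Fin.punchIn-injective i _ _ eq))

perm-surjective : ∀ {n} (c : Code n) e → ∃ λ j → perm c j ≡ e
perm-surjective (i ∷ c) e with i Fin.≟ e
... | yes i≡e = zero , i≡e
... | no  i≢e with perm-surjective c (punchOut i≢e)
...   | j , eq = suc j , trans (cong (punchIn i) eq) (Fin.punchIn-punchOut i≢e)

-- The indicator that the permutation `c` arranges the letters `v` into the word `w`. In this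
-- product form it can be summed over all codes one choice at a time.
match : ∀ {n} → Code n → (Fin n → Letter) → (ℕ → Letter) → ℕ
match []      v w = 1
match (i ∷ c) v w = δ (v i) (w 0) * match c (v ∘ punchIn i) (w ∘ suc)

match≤1 : ∀ {n} (c : Code n) v w → match c v w ≤ 1
match≤1 []      v w = ≤-refl
match≤1 (i ∷ c) v w = *-mono-≤ (δ≤1 (v i) (w 0)) (match≤1 c (v ∘ punchIn i) (w ∘ suc))

match≢0⇒≡ : ∀ {n} (c : Code n) v w → match c v w ≢ 0 → ∀ j → v (perm c j) ≡ w (toℕ j)
match≢0⇒≡ (i ∷ c) v w m≢0 zero    = δ≢0⇒≡ (λ eq → m≢0 (cong (_* match c (v ∘ punchIn i) (w ∘ suc)) eq))
match≢0⇒≡ (i ∷ c) v w m≢0 (suc j) = match≢0⇒≡ c _ _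
  (λ eq → m≢0 (trans (cong (δ (v i) (w 0) *_) eq) (*-zeroʳ (δ (v i) (w 0))))) j

∑< : ℕ → (ℕ → ℕ) → ℕ
∑< zero    f = 0
∑< (suc n) f = f 0 + ∑< n (f ∘ suc)

countᵥ : ∀ {n} → Letter → (Fin n → Letter) → ℕ
countᵥ {n} a v = ∑ (allFin n) (λ i → δ (v i) a)

count : ℕ → Letter → (ℕ → Letter) → ℕ
count n a w = ∑< n (λ i → δ (w i) a)

weight : ℕ → (ℕ → Letter) → ℕ
weight n w = count n out w ! * (count n inX w ! * count n inY w !)

weight-step : ∀ n w → count (suc n) (w 0) w * weight n (w ∘ suc) ≡ weight (suc n) w
weight-step n w with w 0
... | out = sym (*-assoc (suc (count n out (w ∘ suc))) (count n out (w ∘ suc) !) (count n inX (w ∘ suc) ! * count n inY (w ∘ suc) !))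
... | inX = solve 4 (λ p a f b → p :* (a :* (f :* b)) := a :* (p :* f :* b)) refl
              (suc (count n inX (w ∘ suc))) (count n out (w ∘ suc) !) (count n inX (w ∘ suc) !) (count n inY (w ∘ suc) !)
  where open +-*-Solver
... | inY = solve 4 (λ p a f b → p :* (a :* (b :* f)) := a :* (b :* (p :* f))) refl
              (suc (count n inY (w ∘ suc))) (count n out (w ∘ suc) !) (count n inY (w ∘ suc) !) (count n inX (w ∘ suc) !)
  where open +-*-Solver

-- The first choice has to be one of the elements with letter `w 0`, and each of them leaves the
-- same problem with one such letter fewer; the number of these elements is the factor that
-- `weight-step` puts back into the factorial.
∑-match : ∀ n (v : Fin n → Letter) w → (∀ a → countᵥ a v ≡ count n a w) →
          ∑ (codes n) (λ c → match c v w) ≡ weight n w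
∑-match zero    v w eq = refl
∑-match (suc n) v w eq = begin
  ∑ (codes (suc n)) (λ c → match c v w)                        ≡⟨ ∑-codes n _ ⟩
  ∑ (allFin (suc n)) (λ i → ∑ (codes n) (λ c → δ (v i) (w 0) * match c (v ∘ punchIn i) (w ∘ suc)))
                                                               ≡⟨ ∑-cong (allFin (suc n)) step ⟩
  ∑ (allFin (suc n)) (λ i → δ (v i) (w 0) * weight n (w ∘ suc)) ≡⟨ ∑-*ʳ (allFin (suc n)) (λ i → δ (v i) (w 0)) (weight n (w ∘ suc)) ⟩
  countᵥ (w 0) v * weight n (w ∘ suc)                          ≡⟨ cong (_* weight n (w ∘ suc)) (eq (w 0)) ⟩
  count (suc n) (w 0) w * weight n (w ∘ suc)                   ≡⟨ weight-step n w ⟩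
  weight (suc n) w                                             ∎
  where
  open ≡-Reasoning
  step : ∀ i → ∑ (codes n) (λ c → δ (v i) (w 0) * match c (v ∘ punchIn i) (w ∘ suc)) ≡ δ (v i) (w 0) * weight n (w ∘ suc)
  step i with δ (v i) (w 0) ≟ 0
  ... | yes δ≡0 = trans (∑-*ˡ (codes n) (δ (v i) (w 0)) _) (trans (cong (λ z → z * ∑ (codes n) (λ c → match c (v ∘ punchIn i) (w ∘ suc))) δ≡0)
    (sym (cong (_* weight n (w ∘ suc)) δ≡0)))
  ... | no  δ≢0 = trans (∑-*ˡ (codes n) (δ (v i) (w 0)) _) (cong (δ (v i) (w 0) *_)
    (∑-match n (v ∘ punchIn i) (w ∘ suc) λ a → +-cancelˡ-≡ (δ (w 0) a) _ _
      (trans (cong (λ z → δ z a + _) (sym (δ≢0⇒≡ δ≢0))) (trans (sym (∑-allFin-punchIn (λ i → δ (v i) a) i)) (eq a)))))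

-- Words

∑<-cong : ∀ n {f g : ℕ → ℕ} → (∀ i → i < n → f i ≡ g i) → ∑< n f ≡ ∑< n g
∑<-cong zero    eq = refl
∑<-cong (suc n) eq = cong₂ _+_ (eq 0 (s≤s z≤n)) (∑<-cong n (λ i i<n → eq (suc i) (s≤s i<n)))

∑<-snoc : ∀ n (f : ℕ → ℕ) → ∑< (suc n) f ≡ ∑< n f + f n
∑<-snoc zero    f = +-comm (f 0) 0
∑<-snoc (suc n) f = trans (cong (f 0 +_) (∑<-snoc n (f ∘ suc))) (sym (+-assoc (f 0) _ _))

[m%n+o]%n≡[m+o]%n : ∀ m o n .{{_ : NonZero n}} → (m % n + o) % n ≡ (m + o) % n
[m%n+o]%n≡[m+o]%n m o n = begin
  (m % n + o) % n         ≡⟨ %-distribˡ-+ (m % n) o n ⟩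
  (m % n % n + o % n) % n ≡⟨ cong (λ z → (z + o % n) % n) (m%n%n≡m%n m n) ⟩
  (m % n + o % n) % n     ≡⟨ %-distribˡ-+ m o n ⟨
  (m + o) % n             ∎
  where open ≡-Reasoning

-- A shift by one moves the first summand to the end. Adding that summand on both sides and
-- cancelling it avoids subtraction.
∑<-rotate : ∀ n .{{_ : NonZero n}} c (g : ℕ → ℕ) → ∑< n (λ i → g ((i + c) % n)) ≡ ∑< n g
∑<-rotate n zero    g = ∑<-cong n (λ i i<n → cong g (trans (cong (_% n) (+-identityʳ i)) (m<n⇒m%n≡m i<n)))
∑<-rotate n (suc c) g = trans (+-cancelˡ-≡ (h 0) _ _ shift) (∑<-rotate n c g)
  where
  open ≡-Reasoning
  h : ℕ → ℕ
  h i = g ((i + c) % n)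
  shift : h 0 + ∑< n (λ i → g ((i + suc c) % n)) ≡ h 0 + ∑< n h
  shift = begin
    h 0 + ∑< n (λ i → g ((i + suc c) % n)) ≡⟨ cong (h 0 +_) (∑<-cong n (λ i _ → cong (λ z → g (z % n)) (+-suc i c))) ⟩
    ∑< (suc n) h                           ≡⟨ ∑<-snoc n h ⟩
    ∑< n h + h n                           ≡⟨ cong (λ z → ∑< n h + g z) (trans (cong (_% n) (+-comm n c)) ([m+n]%n≡m%n c n)) ⟩
    ∑< n h + h 0                           ≡⟨ +-comm _ (h 0) ⟩
    h 0 + ∑< n h                           ∎

rotate : ∀ n .{{_ : NonZero n}} → ℕ → (ℕ → Letter) → ℕ → Letter
rotate n c w i = w ((i + c) % n)

count-rotate : ∀ n .{{_ : NonZero n}} c a w → count n a (rotate n c w) ≡ count n a w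
count-rotate n c a w = ∑<-rotate n c (λ i → δ (w i) a)

δ-total : ∀ b → δ b out + (δ b inX + δ b inY) ≡ 1
δ-total out = refl
δ-total inX = refl
δ-total inY = refl

interchange : ∀ a b c d e f → (a + (b + c)) + (d + (e + f)) ≡ (a + d) + ((b + e) + (c + f))
interchange = solve 6 (λ a b c d e f → (a :+ (b :+ c)) :+ (d :+ (e :+ f)) := (a :+ d) :+ ((b :+ e) :+ (c :+ f))) refl
  where open +-*-Solver

count-total : ∀ n w → count n out w + (count n inX w + count n inY w) ≡ n
count-total zero    w = refl
count-total (suc n) w = trans
  (sym (interchange (δ (w 0) out) (δ (w 0) inX) (δ (w 0) inY) (count n out (w ∘ suc)) (count n inX (w ∘ suc)) _))
  (cong₂ _+_ (δ-total (w 0)) (count-total n (w ∘ suc)))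

∑-allFin-suc : ∀ {n} (f : Fin (suc n) → ℕ) → ∑ (allFin (suc n)) f ≡ f zero + ∑ (allFin n) (f ∘ suc)
∑-allFin-suc f = ∑-allFin-punchIn f zero

countᵥ≡count : ∀ n a (w : ℕ → Letter) → countᵥ {n} a (w ∘ toℕ) ≡ count n a w
countᵥ≡count zero    a w = refl
countᵥ≡count (suc n) a w = trans (∑-allFin-suc {n} (λ i → δ (w (toℕ i)) a)) (cong (δ (w 0) a +_) (countᵥ≡count n a (w ∘ suc)))

countᵥ-perm : ∀ {n} (c : Code n) a (v : Fin n → Letter) → countᵥ a (v ∘ perm c) ≡ countᵥ a v
countᵥ-perm []      a v = refl
countᵥ-perm (i ∷ c) a v = begin
  countᵥ a (v ∘ perm (i ∷ c))                   ≡⟨ ∑-allFin-suc (λ j → δ (v (perm (i ∷ c) j)) a) ⟩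
  δ (v i) a + countᵥ a (v ∘ punchIn i ∘ perm c) ≡⟨ cong (δ (v i) a +_) (countᵥ-perm c a (v ∘ punchIn i)) ⟩
  δ (v i) a + countᵥ a (v ∘ punchIn i)          ≡⟨ ∑-allFin-punchIn (λ i → δ (v i) a) i ⟨
  countᵥ a v                                    ∎
  where open ≡-Reasoning

countᵥ-total : ∀ {n} (v : Fin n → Letter) → countᵥ out v + (countᵥ inX v + countᵥ inY v) ≡ n
countᵥ-total {n} v = begin
  countᵥ out v + (countᵥ inX v + countᵥ inY v)                          ≡⟨ cong (countᵥ out v +_) (∑-+ (allFin n) _ (λ i → δ (v i) inY)) ⟨
  countᵥ out v + ∑ (allFin n) (λ i → δ (v i) inX + δ (v i) inY)         ≡⟨ ∑-+ (allFin n) (λ i → δ (v i) out) _ ⟨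
  ∑ (allFin n) (λ i → δ (v i) out + (δ (v i) inX + δ (v i) inY))        ≡⟨ ∑-cong (allFin n) (λ i → δ-total (v i)) ⟩
  ∑ (allFin n) (λ _ → 1)                                                ≡⟨ ∑-const (allFin n) 1 ⟩
  length (allFin n) * 1                                                 ≡⟨ *-identityʳ _ ⟩
  length (allFin n)                                                     ≡⟨ List.length-tabulate {n = n} id ⟩
  n                                                                     ∎
  where open ≡-Reasoning

countᵥ≡count-out : ∀ n (v : Fin n → Letter) w → countᵥ inX v ≡ count n inX w → countᵥ inY v ≡ count n inY w →
                   ∀ a → countᵥ a v ≡ count n a w
countᵥ≡count-out n v w eqX eqY inX = eqX
countᵥ≡count-out n v w eqX eqY inY = eqY
countᵥ≡count-out n v w eqX eqY out = +-cancelʳ-≡ (countᵥ inX v + countᵥ inY v) _ _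
  (trans (countᵥ-total v) (trans (sym (count-total n w)) (cong (count n out w +_) (cong₂ _+_ (sym eqX) (sym eqY)))))

-- A point of both sets would be read as `inX`, so counting the letters of `Y` requires
-- disjointness.
letter : Bool → Bool → Letter
letter true  _     = inX
letter false true  = inY
letter false false = out

word₁ : ∀ {n} → Subset n → Fin n → Letter
word₁ P i = letter (Vec.lookup P i) false

word₂ : ∀ {n} → Subset n × Subset n → Fin n → Letter
word₂ (X , Y) i = letter (Vec.lookup X i) (Vec.lookup Y i)

countᵥ-word₁ : ∀ {n} (P : Subset n) → countᵥ inX (word₁ P) ≡ ∣ P ∣ × countᵥ inY (word₁ P) ≡ 0
countᵥ-word₁ []          = refl , refl
countᵥ-word₁ (true ∷ P)  =
  trans (∑-allFin-suc (λ i → δ (word₁ (true ∷ P) i) inX)) (cong suc (proj₁ (countᵥ-word₁ P))) ,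
  trans (∑-allFin-suc (λ i → δ (word₁ (true ∷ P) i) inY)) (proj₂ (countᵥ-word₁ P))
countᵥ-word₁ (false ∷ P) =
  trans (∑-allFin-suc (λ i → δ (word₁ (false ∷ P) i) inX)) (proj₁ (countᵥ-word₁ P)) ,
  trans (∑-allFin-suc (λ i → δ (word₁ (false ∷ P) i) inY)) (proj₂ (countᵥ-word₁ P))


countᵥ-word₂ : ∀ {n} (X Y : Subset n) → Empty (X ∩ Y) →
               countᵥ inX (word₂ (X , Y)) ≡ ∣ X ∣ × countᵥ inY (word₂ (X , Y)) ≡ ∣ Y ∣
countᵥ-word₂ []          []          e = refl , refl
countᵥ-word₂ (true ∷ X)  (true ∷ Y)  e = contradiction (zero , Vec.here) e
countᵥ-word₂ (true ∷ X)  (false ∷ Y) e =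
  trans (∑-allFin-suc (λ i → δ (word₂ (true ∷ X , false ∷ Y) i) inX)) (cong suc (proj₁ (countᵥ-word₂ X Y (Sub.drop-∷-Empty e)))) ,
  trans (∑-allFin-suc (λ i → δ (word₂ (true ∷ X , false ∷ Y) i) inY)) (proj₂ (countᵥ-word₂ X Y (Sub.drop-∷-Empty e)))
countᵥ-word₂ (false ∷ X) (true ∷ Y)  e =
  trans (∑-allFin-suc (λ i → δ (word₂ (false ∷ X , true ∷ Y) i) inX)) (proj₁ (countᵥ-word₂ X Y (Sub.drop-∷-Empty e))) ,
  trans (∑-allFin-suc (λ i → δ (word₂ (false ∷ X , true ∷ Y) i) inY)) (cong suc (proj₂ (countᵥ-word₂ X Y (Sub.drop-∷-Empty e))))
countᵥ-word₂ (false ∷ X) (false ∷ Y) e =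
  trans (∑-allFin-suc (λ i → δ (word₂ (false ∷ X , false ∷ Y) i) inX)) (proj₁ (countᵥ-word₂ X Y (Sub.drop-∷-Empty e))) ,
  trans (∑-allFin-suc (λ i → δ (word₂ (false ∷ X , false ∷ Y) i) inY)) (proj₂ (countᵥ-word₂ X Y (Sub.drop-∷-Empty e)))

word₁-∈ : ∀ {n} (P : Subset n) {i} → word₁ P i ≡ inX → i ∈ P
word₁-∈ P {i} eq with Vec.lookup P i in e
... | true = Vec.lookup⇒[]= i P e
word₁-∈ P {i} () | false

∈-word₁ : ∀ {n} {P : Subset n} {i} → i ∈ P → word₁ P i ≡ inX
∈-word₁ {P = P} i∈ = cong (λ b → letter b false) (Vec.[]=⇒lookup i∈)

word₂-∈X : ∀ {n} (X Y : Subset n) {i} → word₂ (X , Y) i ≡ inX → i ∈ X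
word₂-∈X X Y {i} eq with Vec.lookup X i in e | Vec.lookup Y i
... | true  | _ = Vec.lookup⇒[]= i X e
word₂-∈X X Y {i} () | false | true
word₂-∈X X Y {i} () | false | false

word₂-∈Y : ∀ {n} (X Y : Subset n) {i} → word₂ (X , Y) i ≡ inY → i ∈ Y
word₂-∈Y X Y {i} eq with Vec.lookup X i | Vec.lookup Y i in e
... | false | true = Vec.lookup⇒[]= i Y e
word₂-∈Y X Y {i} () | true  | _
word₂-∈Y X Y {i} () | false | false

∈X-word₂ : ∀ {n} {X Y : Subset n} {i} → i ∈ X → word₂ (X , Y) i ≡ inX
∈X-word₂ {Y = Y} {i} i∈ = cong (λ b → letter b (Vec.lookup Y i)) (Vec.[]=⇒lookup i∈)

∈Y-word₂ : ∀ {n} {X Y : Subset n} {i} → Empty (X ∩ Y) → i ∈ Y → word₂ (X , Y) i ≡ inY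
∈Y-word₂ {X = X} {Y} {i} e i∈ with Vec.lookup X i in eq
... | true  = contradiction (i , Sub.x∈p∩q⁺ (Vec.lookup⇒[]= i X eq , i∈)) e
... | false = cong (letter false) (Vec.[]=⇒lookup i∈)

arcWord : ℕ → ℕ → Letter
arcWord zero    i       = out
arcWord (suc k) zero    = inX
arcWord (suc k) (suc i) = arcWord k i

arcWord-inX⇒< : ∀ k i → arcWord k i ≡ inX → i < k
arcWord-inX⇒< (suc k) zero    eq = s≤s z≤n
arcWord-inX⇒< (suc k) (suc i) eq = s≤s (arcWord-inX⇒< k i eq)

<⇒arcWord-inX : ∀ {k i} → i < k → arcWord k i ≡ inX
<⇒arcWord-inX {suc k} {zero}  _         = refl
<⇒arcWord-inX {suc k} {suc i} (s≤s i<k) = <⇒arcWord-inX i<k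

count-arcWord : ∀ n k → k ≤ n → count n inX (arcWord k) ≡ k × count n inY (arcWord k) ≡ 0
count-arcWord zero    zero    _         = refl , refl
count-arcWord (suc n) zero    _         = count-arcWord n zero z≤n
count-arcWord (suc n) (suc k) (s≤s k≤n) = cong suc (proj₁ (count-arcWord n k k≤n)) , proj₂ (count-arcWord n k k≤n)

-- The first k letters are inX, and so is one more letter, at index k + j.
packWord : ℕ → ℕ → ℕ → Letter
packWord zero    zero    zero    = inX
packWord zero    zero    (suc i) = out
packWord zero    (suc j) zero    = out
packWord zero    (suc j) (suc i) = packWord zero j i
packWord (suc k) j       zero    = inX
packWord (suc k) j       (suc i) = packWord k j i

count-packWord : ∀ n k j → k + j < n → count n inX (packWord k j) ≡ suc k × count n inY (packWord k j) ≡ 0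
count-packWord (suc n) zero    zero    _       = cong suc (blank n) , blank′ n
  where
  blank : ∀ n → ∑< n (λ i → δ out inX) ≡ 0
  blank zero    = refl
  blank (suc n) = blank n
  blank′ : ∀ n → ∑< n (λ i → δ out inY) ≡ 0
  blank′ zero    = refl
  blank′ (suc n) = blank′ n
count-packWord (suc n) zero    (suc j) (s≤s p) = count-packWord n zero j p
count-packWord (suc n) (suc k) j       (s≤s p) = cong suc (proj₁ (count-packWord n k j p)) , proj₂ (count-packWord n k j p)

packWord-< : ∀ k j i → i < k → packWord k j i ≡ inX
packWord-< (suc k) j zero    _       = refl
packWord-< (suc k) j (suc i) (s≤s p) = packWord-< k j i p

packWord-refl : ∀ k j → packWord k j (k + j) ≡ inX
packWord-refl zero    zero    = refl
packWord-refl zero    (suc j) = packWord-refl zero j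
packWord-refl (suc k) j       = packWord-refl k j

packWord-injective : ∀ k j j′ → packWord k j (k + j′) ≡ inX → j ≡ j′
packWord-injective zero    zero    zero     _  = refl
packWord-injective zero    (suc j) (suc j′) eq = cong suc (packWord-injective zero j j′ eq)
packWord-injective (suc k) j       j′       eq = packWord-injective k j j′ eq

weight-of : ∀ n w {a b} → count n inX w ≡ a → count n inY w ≡ b → weight n w ≡ (n ∸ (a + b)) ! * (a ! * b !)
weight-of n w refl refl = cong (λ z → z ! * (count n inX w ! * count n inY w !))
  (sym (trans (cong (_∸ (count n inX w + count n inY w)) (sym (count-total n w))) (m+n∸n≡m (count n out w) (count n inX w + count n inY w))))

cons : Letter → (ℕ → Letter) → ℕ → Letter
cons a w zero    = a
cons a w (suc i) = w i

-- The words of length n with b letters inY followed, up to blanks, by a letters inX.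
mutual
  splitWords : (n b a : ℕ) → List (ℕ → Letter)
  splitWords zero    zero    zero    = (λ _ → out) ∷ []
  splitWords zero    zero    (suc a) = []
  splitWords zero    (suc b) a       = []
  splitWords (suc n) b       a       = map (cons out) (splitWords n b a) ++ splitWords⁺ n b a

  splitWords⁺ : (n b a : ℕ) → List (ℕ → Letter)
  splitWords⁺ n (suc b) a       = map (cons inY) (splitWords n b a)
  splitWords⁺ n zero    (suc a) = map (cons inX) (splitWords n zero a)
  splitWords⁺ n zero    zero    = []

-- The order of the marked letters is forced, so a word amounts to the choice of its `b + a`
-- nonblank places; splitting by the first letter is Pascal's rule.
length-splitWords : ∀ n b a → length (splitWords n b a) ≡ n C (b + a)
length-splitWords zero    zero    zero    = refl
length-splitWords zero    zero    (suc a) = refl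
length-splitWords zero    (suc b) a       = refl
length-splitWords (suc n) (suc b) a       = begin
  length (map (cons out) (splitWords n (suc b) a) ++ map (cons inY) (splitWords n b a))
    ≡⟨ List.length-++ (map (cons out) (splitWords n (suc b) a)) ⟩
  length (map (cons out) (splitWords n (suc b) a)) + length (map (cons inY) (splitWords n b a))
    ≡⟨ cong₂ _+_ (List.length-map (cons out) (splitWords n (suc b) a)) (List.length-map (cons inY) (splitWords n b a)) ⟩
  length (splitWords n (suc b) a) + length (splitWords n b a)
    ≡⟨ cong₂ _+_ (length-splitWords n (suc b) a) (length-splitWords n b a) ⟩
  n C (suc b + a) + n C (b + a)   ≡⟨ +-comm (n C (suc b + a)) _ ⟩
  n C (b + a) + n C (suc b + a)   ≡⟨ nCk+nC[k+1]≡[n+1]C[k+1] n (b + a) ⟩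
  suc n C (suc b + a)             ∎
  where open ≡-Reasoning
length-splitWords (suc n) zero    (suc a) = begin
  length (map (cons out) (splitWords n 0 (suc a)) ++ map (cons inX) (splitWords n 0 a))
    ≡⟨ List.length-++ (map (cons out) (splitWords n 0 (suc a))) ⟩
  length (map (cons out) (splitWords n 0 (suc a))) + length (map (cons inX) (splitWords n 0 a))
    ≡⟨ cong₂ _+_ (List.length-map (cons out) (splitWords n 0 (suc a))) (List.length-map (cons inX) (splitWords n 0 a)) ⟩
  length (splitWords n 0 (suc a)) + length (splitWords n 0 a)
    ≡⟨ cong₂ _+_ (length-splitWords n 0 (suc a)) (length-splitWords n 0 a) ⟩
  n C suc a + n C a               ≡⟨ +-comm (n C suc a) _ ⟩
  n C a + n C suc a               ≡⟨ nCk+nC[k+1]≡[n+1]C[k+1] n a ⟩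
  suc n C suc a                   ∎
  where open ≡-Reasoning
length-splitWords (suc n) zero    zero    = begin
  length (map (cons out) (splitWords n 0 0) ++ []) ≡⟨ cong length (List.++-identityʳ (map (cons out) (splitWords n 0 0))) ⟩
  length (map (cons out) (splitWords n 0 0))       ≡⟨ List.length-map (cons out) (splitWords n 0 0) ⟩
  length (splitWords n 0 0)                        ≡⟨ length-splitWords n 0 0 ⟩
  n C 0                                            ≡⟨⟩
  1                                                ∎
  where open ≡-Reasoning

data SplitWord : (n b a : ℕ) → (ℕ → Letter) → Set where
  nil   : ∀ {w} → SplitWord 0 0 0 w
  blank : ∀ {n b a u} → SplitWord n b a u → SplitWord (suc n) b a (cons out u)
  left  : ∀ {n b a u} → SplitWord n b a u → SplitWord (suc n) (suc b) a (cons inY u)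
  right : ∀ {n a u} → SplitWord n 0 a u → SplitWord (suc n) 0 (suc a) (cons inX u)

splitWords⇒SplitWord : ∀ n b a {u} → u ∈ₗ splitWords n b a → SplitWord n b a u
splitWords⇒SplitWord zero    zero    zero    (here refl) = nil
splitWords⇒SplitWord (suc n) b       a       u∈ with ∈ₗ.∈-++⁻ (map (cons out) (splitWords n b a)) u∈
... | inj₁ u∈ₗ with ∈ₗ.∈-map⁻ (cons out) u∈ₗ
...   | _ , u′∈ , refl = blank (splitWords⇒SplitWord n b a u′∈)
splitWords⇒SplitWord (suc n) (suc b) a       u∈ | inj₂ u∈ᵣ with ∈ₗ.∈-map⁻ (cons inY) u∈ᵣ
... | _ , u′∈ , refl = left (splitWords⇒SplitWord n b a u′∈)
splitWords⇒SplitWord (suc n) zero    (suc a) u∈ | inj₂ u∈ᵣ with ∈ₗ.∈-map⁻ (cons inX) u∈ᵣ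
... | _ , u′∈ , refl = right (splitWords⇒SplitWord n 0 a u′∈)

count-splitWord : ∀ {n b a u} → SplitWord n b a u → count n inX u ≡ a × count n inY u ≡ b
count-splitWord nil       = refl , refl
count-splitWord (blank s) = count-splitWord s
count-splitWord (left s)  = proj₁ (count-splitWord s) , cong suc (proj₂ (count-splitWord s))
count-splitWord (right s) = cong suc (proj₁ (count-splitWord s)) , proj₂ (count-splitWord s)

splitWord-≤ : ∀ {n b a u} → SplitWord n b a u → b + a ≤ n
splitWord-≤ nil       = z≤n
splitWord-≤ (blank s) = m≤n⇒m≤1+n (splitWord-≤ s)
splitWord-≤ (left s)  = s≤s (splitWord-≤ s)
splitWord-≤ (right s) = s≤s (splitWord-≤ s)

-- `θ` is the place of the first `inX`. The two inequalities say that the part before it has room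
-- for the `b` letters `inY` and the part from it on for the `a` letters `inX`.
record Threshold (n b a : ℕ) (u : ℕ → Letter) : Set where
  field
    θ    : ℕ
    b≤θ  : b ≤ θ
    θ+a≤ : θ + a ≤ n
    uθ   : u θ ≡ inX
    inY< : ∀ i → i < n → u i ≡ inY → i < θ
    inX≥ : ∀ i → i < n → u i ≡ inX → θ ≤ i

splitWord-noY : ∀ {n a u} → SplitWord n 0 a u → ∀ i → i < n → u i ≢ inY
splitWord-noY (blank s) (suc i) (s≤s i<n) eq = splitWord-noY s i i<n eq
splitWord-noY (right s) (suc i) (s≤s i<n) eq = splitWord-noY s i i<n eq

threshold : ∀ {n b a u} → SplitWord n b (suc a) u → Threshold n b (suc a) u
threshold (blank s) = let open Threshold (threshold s) in record
  { θ = suc θ ; b≤θ = m≤n⇒m≤1+n b≤θ ; θ+a≤ = s≤s θ+a≤ ; uθ = uθ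
  ; inY< = λ { (suc i) (s≤s i<n) eq → s≤s (inY< i i<n eq) }
  ; inX≥ = λ { (suc i) (s≤s i<n) eq → s≤s (inX≥ i i<n eq) } }
threshold (left s) = let open Threshold (threshold s) in record
  { θ = suc θ ; b≤θ = s≤s b≤θ ; θ+a≤ = s≤s θ+a≤ ; uθ = uθ
  ; inY< = λ { zero _ _ → s≤s z≤n ; (suc i) (s≤s i<n) eq → s≤s (inY< i i<n eq) }
  ; inX≥ = λ { (suc i) (s≤s i<n) eq → s≤s (inX≥ i i<n eq) } }
threshold (right s) = record
  { θ = 0 ; b≤θ = z≤n ; θ+a≤ = s≤s (splitWord-≤ s) ; uθ = refl
  ; inY< = λ { (suc i) (s≤s i<n) eq → contradiction eq (splitWord-noY s i i<n) }
  ; inX≥ = λ _ _ _ → z≤n }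

-- Words are functions on all of `ℕ`, but only their first `n` letters are ever compared with a
-- permutation, so a difference must be witnessed there.
Distinct : ℕ → (ℕ → Letter) → (ℕ → Letter) → Set
Distinct n u w = ∃ λ i → i < n × u i ≢ w i

splitWords-distinct : ∀ n b a → AllPairs (Distinct n) (splitWords n b a)
splitWords-distinct zero    zero    zero    = [] ∷ []
splitWords-distinct zero    zero    (suc a) = []
splitWords-distinct zero    (suc b) a       = []
splitWords-distinct (suc n) b       a       =
  AllPairs.++⁺ (lift (splitWords-distinct n b a)) (rest b a) (All.tabulate λ u∈ → All.tabulate λ w∈ → apart b a u∈ w∈)
  where
  lift : ∀ {c us} → AllPairs (Distinct n) us → AllPairs (Distinct (suc n)) (map (cons c) us)
  lift = AllPairs.map⁺ ∘ AllPairs.map (λ { (i , i<n , ne) → suc i , s≤s i<n , ne })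
  rest : ∀ b a → AllPairs (Distinct (suc n)) (splitWords⁺ n b a)
  rest (suc b) a       = lift (splitWords-distinct n b a)
  rest zero    (suc a) = lift (splitWords-distinct n 0 a)
  rest zero    zero    = []
  apart : ∀ b a {u w} → u ∈ₗ map (cons out) (splitWords n b a) → w ∈ₗ splitWords⁺ n b a → Distinct (suc n) u w
  apart (suc b) a u∈ w∈ with ∈ₗ.∈-map⁻ (cons out) u∈ | ∈ₗ.∈-map⁻ (cons inY) w∈
  ... | _ , _ , refl | _ , _ , refl = 0 , s≤s z≤n , λ ()
  apart zero (suc a) u∈ w∈ with ∈ₗ.∈-map⁻ (cons out) u∈ | ∈ₗ.∈-map⁻ (cons inX) w∈
  ... | _ , _ , refl | _ , _ , refl = 0 , s≤s z≤n , λ ()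

-- Arcs and separated pairs on a cycle

Meet : ∀ {n} → Subset n → Subset n → Set
Meet A B = Nonempty (A ∩ B)

Meet-sym : ∀ {n} {A B : Subset n} → Meet A B → Meet B A
Meet-sym {A = A} {B} (i , i∈) = i , subst (i ∈_) (Sub.∩-comm A B) i∈

count≤ : ∀ n α β (w : ℕ → Letter) → (∀ i → i < n → w i ≡ inX → α ≤ i × i < β) → count n inX w ≤ β ∸ α
count≤ zero    α β w h = z≤n
count≤ (suc n) zero zero w h with w 0 in eq
... | inX with () ← proj₂ (h 0 (s≤s z≤n) eq)
... | out = count≤ n 0 0 (w ∘ suc) (λ i i<n e → z≤n , <⇒≤ (proj₂ (h (suc i) (s≤s i<n) e)))
... | inY = count≤ n 0 0 (w ∘ suc) (λ i i<n e → z≤n , <⇒≤ (proj₂ (h (suc i) (s≤s i<n) e)))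
count≤ (suc n) zero (suc β) w h = +-mono-≤ (δ≤1 (w 0) inX)
  (count≤ n 0 β (w ∘ suc) (λ i i<n e → z≤n , ≤-pred (proj₂ (h (suc i) (s≤s i<n) e))))
count≤ (suc n) (suc α) β w h with w 0 in eq
... | inX with () ← proj₁ (h 0 (s≤s z≤n) eq)
... | out = subst (count n inX (w ∘ suc) ≤_) (∸-+-assoc β 1 α)
  (count≤ n α (β ∸ 1) (w ∘ suc) (λ i i<n e → ≤-pred (proj₁ (h (suc i) (s≤s i<n) e)) , ∸-monoˡ-≤ 1 (proj₂ (h (suc i) (s≤s i<n) e))))
... | inY = subst (count n inX (w ∘ suc) ≤_) (∸-+-assoc β 1 α)
  (count≤ n α (β ∸ 1) (w ∘ suc) (λ i i<n e → ≤-pred (proj₁ (h (suc i) (s≤s i<n) e)) , ∸-monoˡ-≤ 1 (proj₂ (h (suc i) (s≤s i<n) e))))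

count≥ : ∀ n α β (w : ℕ → Letter) → β ≤ n → (∀ i → α ≤ i → i < β → w i ≡ inX) → β ∸ α ≤ count n inX w
count≥ n       zero    zero    w β≤n       h = z≤n
count≥ n       (suc α) zero    w β≤n       h = z≤n
count≥ (suc n) zero    (suc β) w (s≤s β≤n) h rewrite h 0 z≤n (s≤s z≤n) =
  s≤s (count≥ n 0 β (w ∘ suc) β≤n (λ i _ i<β → h (suc i) z≤n (s≤s i<β)))
count≥ (suc n) (suc α) (suc β) w (s≤s β≤n) h = ≤-trans
  (count≥ n α β (w ∘ suc) β≤n (λ i α≤i i<β → h (suc i) (s≤s α≤i) (s≤s i<β))) (m≤n+m _ (δ (w 0) inX))

m+n≤o⇒n≤o∸m : ∀ {m n o} → m + n ≤ o → n ≤ o ∸ m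
m+n≤o⇒n≤o∸m {m} {n} le = ≤-trans (≤-reflexive (sym (m+n∸m≡n m n))) (∸-monoˡ-≤ m le)

m+n<o⇒n<o∸m : ∀ {m n o} → m + n < o → n < o ∸ m
m+n<o⇒n<o∸m {m} {n} le = m+n≤o⇒n≤o∸m {m} (≤-trans (≤-reflexive (+-suc m n)) le)

n≤m+o⇒n∸m≤o : ∀ {n} m {o} → n ≤ m + o → n ∸ m ≤ o
n≤m+o⇒n∸m≤o m {o} le = ≤-trans (∸-monoˡ-≤ m le) (≤-reflexive (m+n∸m≡n m o))

[q+i+c]%n : ∀ q i c n .{{_ : NonZero n}} → (q + i + c) % n ≡ ((q + c) % n + i) % n
[q+i+c]%n q i c n = trans (cong (_% n) (solve 3 (λ q i c → q :+ i :+ c := q :+ c :+ i) refl q i c))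
                          (sym ([m%n+o]%n≡[m+o]%n (q + c) i n))
  where open +-*-Solver

%-solve : ∀ n .{{_ : NonZero n}} q r → r < n → ∃ λ i → i < n × (q + i) % n ≡ r
%-solve n q r r<n = i , m%n<n _ n , (begin
  (q + i) % n                         ≡⟨ cong (_% n) (+-comm q i) ⟩
  (i + q) % n                         ≡⟨ [m%n+o]%n≡[m+o]%n (r + (n ∸ q % n)) q n ⟩
  (r + (n ∸ q % n) + q) % n           ≡⟨ cong (_% n) (+-comm _ q) ⟩
  (q + (r + (n ∸ q % n))) % n         ≡⟨ [m%n+o]%n≡[m+o]%n q _ n ⟨
  (q % n + (r + (n ∸ q % n))) % n     ≡⟨ cong (_% n) (solve 3 (λ a b c → a :+ (b :+ c) := b :+ (a :+ c)) refl (q % n) r (n ∸ q % n)) ⟩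
  (r + (q % n + (n ∸ q % n))) % n     ≡⟨ cong (λ z → (r + z) % n) (m+[n∸m]≡n (<⇒≤ (m%n<n q n))) ⟩
  (r + n) % n                         ≡⟨ [m+n]%n≡m%n r n ⟩
  r % n                               ≡⟨ m<n⇒m%n≡m r<n ⟩
  r                                   ∎)
  where
  open ≡-Reasoning
  open +-*-Solver
  i : ℕ
  -- This is `r - q` modulo `n`, with `n ∸ q % n` standing for `- q`.
  i = (r + (n ∸ q % n)) % n

%-cancelˡ : ∀ n .{{_ : NonZero n}} q {c d} → c < n → d < n → (q + c) % n ≡ (q + d) % n → c ≡ d
%-cancelˡ n q {c} {d} c<n d<n eq with %-solve n q 0 (≤-trans (s≤s z≤n) c<n)
... | i , _ , q+i≡0 = trans (sym (back c<n)) (trans (cong (λ z → (z + i) % n) eq) (back d<n))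
  where
  back : ∀ {c} → c < n → ((q + c) % n + i) % n ≡ c
  back {c} c<n = trans (sym ([q+i+c]%n q i c n)) (trans (sym ([m%n+o]%n≡[m+o]%n (q + i) c n))
                   (trans (cong (λ z → (z + c) % n) q+i≡0) (m<n⇒m%n≡m c<n)))

%-wrap : ∀ {n a} .{{_ : NonZero n}} → n ≤ a → a < n + n → a % n ≡ a ∸ n
%-wrap {n} {a} n≤a a<2n = trans (cong (_% n) (sym (m∸n+n≡m n≤a)))
  (trans ([m+n]%n≡m%n (a ∸ n) n) (m<n⇒m%n≡m (+-cancelʳ-< n (a ∸ n) n (subst (_< n + n) (sym (m∸n+n≡m n≤a)) a<2n))))

-- An object is a set P, to be recognised as an arc, or a pair (X , Y), to be recognised as
-- Y and X lying in complementary arcs.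
Object : ℕ → Set
Object n = Subset n ⊎ (Subset n × Subset n)

-- These are the intersections that prevent two objects from sharing a cut. The disjunction makes a
-- pair compatible with itself: its two sets are disjoint, so cross intersections can be asked of
-- different pairs only.
Compatible : ∀ {n} → Object n → Object n → Set
Compatible (inj₁ P)       (inj₁ Q)         = Meet P Q
Compatible (inj₁ P)       (inj₂ (X , Y))   = Meet P X × Meet P Y
Compatible (inj₂ (X , Y)) (inj₁ P)         = Meet P X × Meet P Y
Compatible (inj₂ (X , Y)) (inj₂ (X′ , Y′)) =
  Meet X X′ × Meet Y Y′ × ((X , Y) ≡ (X′ , Y′) ⊎ Meet X Y′ × Meet Y X′)

module Cycle (n : ℕ) .{{_ : NonZero n}} (k : ℕ) (0<k : 0 < k) (2k≤n : k + k ≤ n) (k<n : k < n) (σ : Code n) where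

  el : ℕ → Fin n
  el i = perm σ (i mod n)

  toℕ-mod : ∀ i → toℕ (i mod n) ≡ i % n
  toℕ-mod i = Fin.toℕ-fromℕ< (m%n<n i n)

  el-cong : ∀ {i j} → i % n ≡ j % n → el i ≡ el j
  el-cong {i} {j} eq = cong (perm σ) (Fin.toℕ-injective (trans (toℕ-mod i) (trans eq (sym (toℕ-mod j)))))

  el-injective : ∀ {i j} → el i ≡ el j → i % n ≡ j % n
  el-injective {i} {j} eq = trans (sym (toℕ-mod i)) (trans (cong toℕ (perm-injective σ eq)) (toℕ-mod j))

  el-surjective : ∀ q e → ∃ λ i → i < n × el (q + i) ≡ e
  el-surjective q e with perm-surjective σ e
  ... | j , refl with %-solve n q (toℕ j) (Fin.toℕ<n j)
  ...   | i , i<n , eq = i , i<n , cong (perm σ) (Fin.toℕ-injective (trans (toℕ-mod (q + i)) eq))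

  match⇒letters : ∀ v w c → match σ v (rotate n c w) ≢ 0 → ∀ i → v (el i) ≡ w ((i + c) % n)
  match⇒letters v w c m≢0 i = trans (match≢0⇒≡ σ v _ m≢0 (i mod n))
    (cong w (trans (cong (λ z → (z + c) % n) (toℕ-mod i)) ([m%n+o]%n≡[m+o]%n i c n)))

  -- The shift `c` is the negative of the starting place: the arc begins where `(i + c) % n`
  -- vanishes.
  record Arc (P : Subset n) (c : ℕ) : Set where
    field
      ∈⇒< : ∀ i → el i ∈ P → (i + c) % n < k
      <⇒∈ : ∀ i → (i + c) % n < k → el i ∈ P

  -- The last two fields normalise the cuts: one comes right before an element of `Y`, the other
  -- right before an element of `X`. Thus a pair is counted for one shift only, and its cuts can be
  -- charged to its own elements.
  record Separated (X Y : Subset n) (c θ : ℕ) : Set where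
    field
      k≤θ   : k ≤ θ
      θ+k≤n : θ + k ≤ n
      ∈X⇒≥  : ∀ i → el i ∈ X → θ ≤ (i + c) % n
      ∈Y⇒<  : ∀ i → el i ∈ Y → (i + c) % n < θ
      0⇒∈Y  : ∀ i → (i + c) % n ≡ 0 → el i ∈ Y
      θ⇒∈X  : ∀ i → (i + c) % n ≡ θ → el i ∈ X

  arcCount : Subset n → ℕ → ℕ
  arcCount P c = match σ (word₁ P) (rotate n c (arcWord k))

  arcCount⇒Arc : ∀ P c → arcCount P c ≢ 0 → Arc P c
  arcCount⇒Arc P c m≢0 = record
    { ∈⇒< = λ i i∈ → arcWord-inX⇒< k _ (trans (sym (eq i)) (∈-word₁ i∈))
    ; <⇒∈ = λ i <k → word₁-∈ P (trans (eq i) (<⇒arcWord-inX <k)) }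
    where
    eq : ∀ i → word₁ P (el i) ≡ arcWord k ((i + c) % n)
    eq = match⇒letters (word₁ P) (arcWord k) c m≢0

  pairWords : List (ℕ → Letter)
  pairWords = splitWords (n ∸ 1) (k ∸ 1) k

  pairCount : Subset n × Subset n → ℕ → ℕ
  pairCount p c = ∑ pairWords (λ u → match σ (word₂ p) (rotate n c (cons inY u)))

  pairCount⇒Separated : ∀ X Y c → Empty (X ∩ Y) → pairCount (X , Y) c ≢ 0 → ∃ (Separated X Y c)
  pairCount⇒Separated X Y c disj m≢0 with ∑≢0⇒∃≢0 pairWords m≢0
  ... | u , u∈ , mu≢0 = θ , record
    { k≤θ   = b≤θ
    ; θ+k≤n = θ+a≤
    ; ∈X⇒≥  = λ i i∈ → inX≥ _ (m%n<n _ n) (trans (sym (eq i)) (∈X-word₂ {Y = Y} i∈))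
    ; ∈Y⇒<  = λ i i∈ → inY< _ (m%n<n _ n) (trans (sym (eq i)) (∈Y-word₂ disj i∈))
    ; 0⇒∈Y  = λ i e → word₂-∈Y X Y (trans (eq i) (cong (cons inY u) e))
    ; θ⇒∈X  = λ i e → word₂-∈X X Y (trans (eq i) (trans (cong (cons inY u) e) uθ)) }
    where
    eq : ∀ i → word₂ (X , Y) (el i) ≡ cons inY u ((i + c) % n)
    eq = match⇒letters (word₂ (X , Y)) (cons inY u) c mu≢0
    split : ∀ m j → SplitWord m j k u → 0 < k → Threshold (suc m) (suc j) k (cons inY u)
    split m j s (s≤s _) = threshold (left s)
    thr : Threshold n k k (cons inY u)
    thr = subst₂ (λ m j → Threshold m j k (cons inY u)) (m+[n∸m]≡n {1} (≤-trans (s≤s z≤n) k<n)) (m+[n∸m]≡n 0<k)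
      (split (n ∸ 1) (k ∸ 1) (splitWords⇒SplitWord _ _ _ u∈) 0<k)
    open Threshold thr

  pairCount≤1 : ∀ p c → pairCount p c ≤ 1
  pairCount≤1 p c = ∑≤1 (λ u → match≤1 σ _ _) (AllPairs.map apart (splitWords-distinct (n ∸ 1) (k ∸ 1) k))
    where
    apart : ∀ {u w} → Distinct (n ∸ 1) u w → match σ (word₂ p) (rotate n c (cons inY u)) ≢ 0 →
            match σ (word₂ p) (rotate n c (cons inY w)) ≢ 0 → ⊥
    apart {u} {w} (i , i<n-1 , ne) mu mw with %-solve n c (suc i) (subst (suc (suc i) ≤_) (m+[n∸m]≡n {1} (≤-trans (s≤s z≤n) k<n)) (s≤s i<n-1))
    ... | j , _ , c+j≡ = ne (trans (sym (eqn u mu)) (eqn w mw))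
      where
      eqn : ∀ u → match σ (word₂ p) (rotate n c (cons inY u)) ≢ 0 → word₂ p (el j) ≡ u i
      eqn u mu = trans (match⇒letters (word₂ p) (cons inY u) c mu j) (cong (cons inY u) (trans (cong (_% n) (+-comm j c)) c+j≡))

  Event : Object n → ℕ → Set
  Event (inj₁ P)       c = Arc P c
  Event (inj₂ (X , Y)) c = ∃ (Separated X Y c)

  Cut : Object n → ℕ → ℕ → Set
  Cut (inj₁ P)       c q = Arc P c × ((q + c) % n ≡ 0 ⊎ (q + c) % n ≡ k)
  Cut (inj₂ (X , Y)) c q = ∃ λ θ → Separated X Y c θ × ((q + c) % n ≡ 0 ⊎ (q + c) % n ≡ θ)

  -- `Low` and `High` refer to the linear order that arises when the cycle is read from `q`. At a
  -- cut of a separated pair, one of its sets is low and the other high for the same threshold.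
  Low : Subset n → ℕ → ℕ → Set
  Low A q m = ∀ i → i < n → el (q + i) ∈ A → i < m

  High : Subset n → ℕ → ℕ → Set
  High A q m = ∀ i → i < n → el (q + i) ∈ A → m ≤ i

  clash : ∀ {A B q m m′} → Meet A B → Low A q m → High B q m′ → m ≤ m′ → ⊥
  clash {A} {B} {q} (e , e∈) low high m≤m′ with el-surjective q e
  ... | i , i<n , refl = <⇒≱ (low i i<n (proj₁ (Sub.x∈p∩q⁻ A B e∈)))
                              (≤-trans m≤m′ (high i i<n (proj₂ (Sub.x∈p∩q⁻ A B e∈))))

  at-cut : ∀ q c {r} i → (q + c) % n ≡ r → (q + i + c) % n ≡ (r + i) % n
  at-cut q c i eq = trans ([q+i+c]%n q i c n) (cong (λ z → (z + i) % n) eq)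

  at-cut₀ : ∀ q c i → i < n → (q + c) % n ≡ 0 → (q + i + c) % n ≡ i
  at-cut₀ q c i i<n eq = trans (at-cut q c i eq) (m<n⇒m%n≡m i<n)

  arc-low : ∀ {P c q} → Arc P c → (q + c) % n ≡ 0 → Low P q k
  arc-low {c = c} {q} arc eq i i<n i∈ = subst (_< k) (at-cut₀ q c i i<n eq) (Arc.∈⇒< arc _ i∈)

  arc-high : ∀ {P c q} → Arc P c → (q + c) % n ≡ k → High P q (n ∸ k)
  arc-high {c = c} {q} arc eq i i<n i∈ with n ≤? k + i
  ... | yes n≤k+i = n≤m+o⇒n∸m≤o k n≤k+i
  ... | no  n≰k+i = contradiction (m≤m+n k i)
    (<⇒≱ (subst (_< k) (trans (at-cut q c i eq) (m<n⇒m%n≡m (≰⇒> n≰k+i))) (Arc.∈⇒< arc _ i∈)))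

  module _ {X Y c θ} (sep : Separated X Y c θ) where
    open Separated sep

    θ<n : θ < n
    θ<n = ≤-trans (m<m+n θ 0<k) θ+k≤n

    sep-low₀ : ∀ {q} → (q + c) % n ≡ 0 → Low Y q θ
    sep-low₀ {q} eq i i<n i∈ = subst (_< θ) (at-cut₀ q c i i<n eq) (∈Y⇒< _ i∈)

    sep-high₀ : ∀ {q} → (q + c) % n ≡ 0 → High X q θ
    sep-high₀ {q} eq i i<n i∈ = subst (θ ≤_) (at-cut₀ q c i i<n eq) (∈X⇒≥ _ i∈)

    sep-lowθ : ∀ {q} → (q + c) % n ≡ θ → Low X q (n ∸ θ)
    sep-lowθ {q} eq i i<n i∈ with n ≤? θ + i
    ... | no  n≰θ+i = m+n<o⇒n<o∸m {θ} (≰⇒> n≰θ+i)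
    ... | yes n≤θ+i = contradiction (subst (θ ≤_) (trans (at-cut q c i eq) (%-wrap n≤θ+i (+-mono-< θ<n i<n))) (∈X⇒≥ _ i∈))
      (<⇒≱ (+-cancelʳ-< n (θ + i ∸ n) θ (subst (_< θ + n) (sym (m∸n+n≡m n≤θ+i)) (+-monoʳ-< θ i<n))))

    sep-highθ : ∀ {q} → (q + c) % n ≡ θ → High Y q (n ∸ θ)
    sep-highθ {q} eq i i<n i∈ with n ≤? θ + i
    ... | yes n≤θ+i = n≤m+o⇒n∸m≤o θ n≤θ+i
    ... | no  n≰θ+i = contradiction (m≤m+n θ i)
      (<⇒≱ (subst (_< θ) (trans (at-cut q c i eq) (m<n⇒m%n≡m (≰⇒> n≰θ+i))) (∈Y⇒< _ i∈)))

    k≤n∸θ : k ≤ n ∸ θ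
    k≤n∸θ = m+n≤o⇒n≤o∸m {θ} θ+k≤n

    θ≤n∸k : θ ≤ n ∸ k
    θ≤n∸k = m+n≤o⇒n≤o∸m {k} (subst (_≤ n) (+-comm θ k) θ+k≤n)

    n∸θ≤n∸k : n ∸ θ ≤ n ∸ k
    n∸θ≤n∸k = ∸-monoʳ-≤ n k≤θ

    n∸θ<n : n ∸ θ < n
    n∸θ<n = ∸-monoʳ-< (≤-trans 0<k k≤θ) (<⇒≤ θ<n)

    first-Y : ∀ {q} → (q + c) % n ≡ θ → el (q + (n ∸ θ)) ∈ Y
    first-Y {q} eq = 0⇒∈Y _ (trans (at-cut q c (n ∸ θ) eq) (trans (cong (_% n) (m+[n∸m]≡n (<⇒≤ θ<n))) (n%n≡0 n)))

  shift-unique : ∀ {q c d r} → c < n → d < n → (q + c) % n ≡ r → (q + d) % n ≡ r → c ≡ d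
  shift-unique {q} c<n d<n eq eq′ = %-cancelˡ n q c<n d<n (trans eq (sym eq′))

  arc-unique : ∀ {P Q c} → Arc P c → Arc Q c → P ≡ Q
  arc-unique {P} {Q} {c} a b = Sub.⊆-antisym (incl a b) (incl b a)
    where
    incl : ∀ {P Q} → Arc P c → Arc Q c → P ⊆ Q
    incl a b {e} e∈ with el-surjective 0 e
    ... | i , _ , refl = Arc.<⇒∈ b i (Arc.∈⇒< a i e∈)

  -- The low set of the pair with the smaller threshold lies entirely before the high set of the
  -- other pair, so these two cannot meet.
  cross : ∀ {A A′ B B′ q m m′} → Low A q m → High B q m → Low A′ q m′ → High B′ q m′ →
          Meet A B′ → Meet A′ B → ⊥
  cross {m = m} {m′} lowA highB lowA′ highB′ AB′ A′B with ≤-total m m′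
  ... | inj₁ m≤m′ = clash AB′ lowA highB′ m≤m′
  ... | inj₂ m′≤m = clash A′B lowA′ highB m′≤m

  -- The arc fills the `k` places next to the cut on one side. Both blocks of the pair have at least
  -- `k` places, so the block on the other side of the pair's second cut lies wholly beyond the arc.
  arc-separated-⊥ : ∀ {P X Y c c′ q} → Meet P X → Meet P Y → Cut (inj₁ P) c q → Cut (inj₂ (X , Y)) c′ q → ⊥
  arc-separated-⊥ PX PY (a , inj₁ e) (θ , s , inj₁ e′) =
    clash PX (arc-low a e) (sep-high₀ s e′) (Separated.k≤θ s)
  arc-separated-⊥ PX PY (a , inj₁ e) (θ , s , inj₂ e′) =
    clash PY (arc-low a e) (sep-highθ s e′) (k≤n∸θ s)
  arc-separated-⊥ PX PY (a , inj₂ e) (θ , s , inj₁ e′) =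
    clash (Meet-sym PY) (sep-low₀ s e′) (arc-high a e) (θ≤n∸k s)
  arc-separated-⊥ PX PY (a , inj₂ e) (θ , s , inj₂ e′) =
    clash (Meet-sym PX) (sep-lowθ s e′) (arc-high a e) (n∸θ≤n∸k s)

  -- Two compatible objects sharing a cut coincide: reading the cycle from the cut, this is the
  -- linear-order argument in the permutation proof of Bollobás' inequality.
  cut-unique : ∀ o o′ {c c′ q} → c < n → c′ < n → Compatible o o′ → Cut o c q → Cut o′ c′ q → (o , c) ≡ (o′ , c′)
  cut-unique (inj₁ P) (inj₁ Q) c<n c′<n meet (a , inj₁ e) (b , inj₁ e′)
    with refl ← shift-unique c<n c′<n e e′ = cong (λ z → inj₁ z , _) (arc-unique a b)
  cut-unique (inj₁ P) (inj₁ Q) c<n c′<n meet (a , inj₂ e) (b , inj₂ e′)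
    with refl ← shift-unique c<n c′<n e e′ = cong (λ z → inj₁ z , _) (arc-unique a b)
  cut-unique (inj₁ P) (inj₁ Q) c<n c′<n meet (a , inj₁ e) (b , inj₂ e′) =
    ⊥-elim (clash meet (arc-low a e) (arc-high b e′) (m+n≤o⇒n≤o∸m {k} 2k≤n))
  cut-unique (inj₁ P) (inj₁ Q) c<n c′<n meet (a , inj₂ e) (b , inj₁ e′) =
    ⊥-elim (clash (Meet-sym meet) (arc-low b e′) (arc-high a e) (m+n≤o⇒n≤o∸m {k} 2k≤n))
  cut-unique (inj₁ P) (inj₂ p) c<n c′<n (PX , PY) cut cut′ = ⊥-elim (arc-separated-⊥ PX PY cut cut′)
  cut-unique (inj₂ p) (inj₁ P) c<n c′<n (PX , PY) cut cut′ = ⊥-elim (arc-separated-⊥ PX PY cut′ cut)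
  cut-unique (inj₂ (X , Y)) (inj₂ (X′ , Y′)) c<n c′<n (XX , YY , _) (θ , s , inj₁ e) (θ′ , s′ , inj₂ e′) =
    ⊥-elim (cross (sep-low₀ s e) (sep-high₀ s e) (sep-lowθ s′ e′) (sep-highθ s′ e′) YY (Meet-sym XX))
  cut-unique (inj₂ (X , Y)) (inj₂ (X′ , Y′)) c<n c′<n (XX , YY , _) (θ , s , inj₂ e) (θ′ , s′ , inj₁ e′) =
    ⊥-elim (cross (sep-lowθ s e) (sep-highθ s e) (sep-low₀ s′ e′) (sep-high₀ s′ e′) XX (Meet-sym YY))
  cut-unique (inj₂ (X , Y)) (inj₂ (X′ , Y′)) c<n c′<n (_ , _ , inj₂ (XY , YX)) (θ , s , inj₁ e) (θ′ , s′ , inj₁ e′) =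
    ⊥-elim (cross (sep-low₀ s e) (sep-high₀ s e) (sep-low₀ s′ e′) (sep-high₀ s′ e′) YX (Meet-sym XY))
  cut-unique (inj₂ (X , Y)) (inj₂ (X′ , Y′)) c<n c′<n (_ , _ , inj₂ (XY , YX)) (θ , s , inj₂ e) (θ′ , s′ , inj₂ e′) =
    ⊥-elim (cross (sep-lowθ s e) (sep-highθ s e) (sep-lowθ s′ e′) (sep-highθ s′ e′) XY (Meet-sym YX))
  cut-unique (inj₂ (X , Y)) (inj₂ (X′ , Y′)) c<n c′<n (_ , _ , inj₁ refl) (θ , s , inj₁ e) (θ′ , s′ , inj₁ e′) =
    cong (_ ,_) (shift-unique c<n c′<n e e′)
  cut-unique (inj₂ (X , Y)) (inj₂ (X′ , Y′)) {q = q} c<n c′<n (_ , _ , inj₁ refl) (θ , s , inj₂ e) (θ′ , s′ , inj₂ e′) =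
    -- Both `n ∸ θ` and `n ∸ θ′` are the distance from `q` to the first element of `Y`, so the
    -- thresholds agree, and then so do the shifts.
    cong (_ ,_) (shift-unique c<n c′<n e (trans e′ (∸-cancelˡ-≡ (<⇒≤ (θ<n s′)) (<⇒≤ (θ<n s))
      (≤-antisym (sep-highθ s′ e′ (n ∸ θ) (n∸θ<n s) (first-Y s e))
                 (sep-highθ s e (n ∸ θ′) (n∸θ<n s′) (first-Y s′ e′))))))

  module _ {P c₀ s} (base : Arc P c₀) (start : (s + c₀) % n ≡ 0) where

    meet-base : ∀ {A} → Meet P A → ∃ λ i → i < k × el (s + i) ∈ A
    meet-base {A} (e , e∈) with el-surjective s e
    ... | i , i<n , refl = i , arc-low base start i i<n (proj₁ (Sub.x∈p∩q⁻ P A e∈)) , proj₂ (Sub.x∈p∩q⁻ P A e∈)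

    -- Counting from 0, a common point has index `i` in the base arc and index `j` in `Q`. If
    -- `j ≤ i`, then `Q` begins inside the base arc; otherwise it ends there, and the cut after its
    -- last point has key `i + (k ∸ j) < k`.
    cut-exists₁ : ∀ {Q c} → Meet P Q → Arc Q c → ∃ λ d → d < k × Cut (inj₁ Q) c (s + d)
    cut-exists₁ {Q} {c} meet arc with meet-base meet
    ... | i , i<k , i∈Q with (s + i + c) % n in eq | Arc.∈⇒< arc (s + i) i∈Q
    ... | j | j<k with j ≤? i
    ...   | no j≰i = i + (k ∸ j) , subst (i + (k ∸ j) <_) (m+[n∸m]≡n (<⇒≤ j<k)) (+-monoˡ-< (k ∸ j) (≰⇒> j≰i)) ,
      arc , inj₂ (trans (cong (λ z → (z + c) % n) (sym (+-assoc s i (k ∸ j))))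
        (trans (at-cut (s + i) c (k ∸ j) eq) (trans (cong (_% n) (m+[n∸m]≡n (<⇒≤ j<k))) (m<n⇒m%n≡m k<n))))
    ...   | yes j≤i = i ∸ j , ≤-<-trans (m∸n≤m i j) i<k , arc , inj₁ (%-cancelˡ n j (m%n<n _ n) (≤-trans (s≤s z≤n) k<n) (begin
      (j + (s + (i ∸ j) + c) % n) % n ≡⟨ cong (_% n) (+-comm j _) ⟩
      ((s + (i ∸ j) + c) % n + j) % n ≡⟨ [q+i+c]%n (s + (i ∸ j)) j c n ⟨
      (s + (i ∸ j) + j + c) % n       ≡⟨ cong (λ z → (z + c) % n) (trans (+-assoc s _ j) (cong (s +_) (m∸n+n≡m j≤i))) ⟩
      (s + i + c) % n                 ≡⟨ eq ⟩
      j                               ≡⟨ m<n⇒m%n≡m (<-trans j<k k<n) ⟨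
      j % n                           ≡⟨ cong (_% n) (+-identityʳ j) ⟨
      (j + 0) % n                     ∎))
      where open ≡-Reasoning

    -- The base arc contains a point of `X` and a point of `Y`, and a cut lies between them: the one
    -- before `Y` if the point of `X` comes first, otherwise the one before `X`.
    cut-exists₂ : ∀ {X Y c θ} → Meet P X → Meet P Y → Separated X Y c θ → ∃ λ d → d < k × Cut (inj₂ (X , Y)) c (s + d)
    cut-exists₂ {X} {Y} {c} {θ} PX PY sep with meet-base PX | meet-base PY
    ... | x , x<k , x∈ | y , y<k , y∈ with ≤-total x y
    ...   | inj₁ x≤y = x + (n ∸ j) , ≤-<-trans (≮⇒≥ y≮) y<k , θ , sep ,
      inj₁ (trans (cong (λ z → (z + c) % n) (sym (+-assoc s x (n ∸ j))))
        (trans (at-cut (s + x) c (n ∸ j) refl) (trans (cong (_% n) (m+[n∸m]≡n (<⇒≤ (m%n<n _ n)))) (n%n≡0 n))))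
      where
      open Separated sep
      j : ℕ
      j = (s + x + c) % n
      y≮ : ¬ (y < x + (n ∸ j))
      y≮ y< = <⇒≱ (subst (_< θ) (trans (trans (cong (λ z → (z + c) % n) (trans (cong (s +_) (sym (m+[n∸m]≡n x≤y))) (sym (+-assoc s x _))))
                 (at-cut (s + x) c (y ∸ x) refl)) (m<n⇒m%n≡m j+<n)) (∈Y⇒< _ y∈)) (≤-trans (∈X⇒≥ _ x∈) (m≤m+n j _))
        where
        j+<n : j + (y ∸ x) < n
        j+<n = subst (j + (y ∸ x) <_) (m+[n∸m]≡n (<⇒≤ (m%n<n (s + x + c) n)))
          (+-monoʳ-< j (+-cancelˡ-< x (y ∸ x) _ (subst (_< x + (n ∸ j)) (sym (m+[n∸m]≡n x≤y)) y<)))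
    ...   | inj₂ y≤x = y + (θ ∸ j) , ≤-<-trans (≮⇒≥ x≮) x<k , θ , sep ,
      inj₂ (trans (cong (λ z → (z + c) % n) (sym (+-assoc s y (θ ∸ j))))
        (trans (at-cut (s + y) c (θ ∸ j) refl) (trans (cong (_% n) (m+[n∸m]≡n (<⇒≤ (∈Y⇒< _ y∈)))) (m<n⇒m%n≡m (θ<n sep)))))
      where
      open Separated sep
      j : ℕ
      j = (s + y + c) % n
      x≮ : ¬ (x < y + (θ ∸ j))
      x≮ x< = <⇒≱ j+<θ (subst (θ ≤_) (trans (trans (cong (λ z → (z + c) % n) (trans (cong (s +_) (sym (m+[n∸m]≡n y≤x))) (sym (+-assoc s y _))))
                 (at-cut (s + y) c (x ∸ y) refl)) (m<n⇒m%n≡m (<-trans j+<θ (θ<n sep)))) (∈X⇒≥ _ x∈))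
        where
        j+<θ : j + (x ∸ y) < θ
        j+<θ = subst (j + (x ∸ y) <_) (m+[n∸m]≡n (<⇒≤ (∈Y⇒< _ y∈)))
          (+-monoʳ-< j (+-cancelˡ-< y (x ∸ y) _ (subst (_< y + (θ ∸ j)) (sym (m+[n∸m]≡n y≤x)) x<)))

    cut-exists : ∀ o {c} → Compatible (inj₁ P) o → Event o c → ∃ λ d → d < k × Cut o c (s + d)
    cut-exists (inj₁ Q)       meet      arc       = cut-exists₁ meet arc
    cut-exists (inj₂ (X , Y)) (PX , PY) (θ , sep) = cut-exists₂ PX PY sep

  objectCount : Object n → Fin n → ℕ
  objectCount (inj₁ P) c = arcCount P (toℕ c)
  objectCount (inj₂ p) c = pairCount p (toℕ c)

  objectCount≤1 : ∀ o c → objectCount o c ≤ 1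
  objectCount≤1 (inj₁ P) c = match≤1 σ _ _
  objectCount≤1 (inj₂ p) c = pairCount≤1 p (toℕ c)

  DisjointPair : Object n → Set
  DisjointPair (inj₁ P)       = ⊤
  DisjointPair (inj₂ (X , Y)) = Empty (X ∩ Y)

  objectCount⇒Event : ∀ o c → DisjointPair o → objectCount o c ≢ 0 → Event o (toℕ c)
  objectCount⇒Event (inj₁ P)       c _    = arcCount⇒Arc P (toℕ c)
  objectCount⇒Event (inj₂ (X , Y)) c disj = pairCount⇒Separated X Y (toℕ c) disj

  arc-start : ∀ c → ∃ λ s → (s + c) % n ≡ 0
  arc-start c with %-solve n c 0 (≤-trans (s≤s z≤n) k<n)
  ... | s , _ , eq = s , trans (cong (_% n) (+-comm s c)) eq

  objects≤k : ∀ {os} → Unique os → (∀ {o o′} → o ∈ₗ os → o′ ∈ₗ os → Compatible o o′) → (∀ {o} → o ∈ₗ os → DisjointPair o) →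
              ∀ {P c} → inj₁ P ∈ₗ os → Arc P c → ∑ os (λ o → ∑ (allFin n) (objectCount o)) ≤ k
  objects≤k {os} u comp disj {P} {c} P∈ arc with arc-start c
  ... | s , eq = subst₂ _≤_ (∑-cartesianProduct os (allFin n) _) (List.length-upTo k)
    (∑≤length-keys {ks = upTo k} (Unique.cartesianProduct⁺ u (Unique.allFin⁺ n)) (λ oc → objectCount (proj₁ oc) (proj₂ oc))
      (λ oc → objectCount≤1 (proj₁ oc) (proj₂ oc))
      (λ oc d → Cut (proj₁ oc) (toℕ (proj₂ oc)) (s + d))
      (λ {oc} oc∈ ne → let o∈ , _ = ∈ₗ.∈-cartesianProduct⁻ os (allFin n) oc∈
                           d , d<k , cut = cut-exists arc eq (proj₁ oc) (comp P∈ o∈) (objectCount⇒Event (proj₁ oc) (proj₂ oc) (disj o∈) ne)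
                       in d , ∈ₗ.∈-upTo⁺ d<k , cut)
      (λ {oc} {oc′} oc∈ oc′∈ cut cut′ →
        let eq = cut-unique (proj₁ oc) (proj₁ oc′) (Fin.toℕ<n (proj₂ oc)) (Fin.toℕ<n (proj₂ oc′))
                   (comp (proj₁ (∈ₗ.∈-cartesianProduct⁻ os (allFin n) oc∈)) (proj₁ (∈ₗ.∈-cartesianProduct⁻ os (allFin n) oc′∈))) cut cut′
        in cong₂ _,_ (,-injectiveˡ eq) (Fin.toℕ-injective (,-injectiveʳ eq))))

  cutAt : Bool → ℕ → ℕ
  cutAt true  θ = 0
  cutAt false θ = θ

  cutAt-⊎ : ∀ b {r θ} → r ≡ cutAt b θ → r ≡ 0 ⊎ r ≡ θ
  cutAt-⊎ true  = inj₁
  cutAt-⊎ false = inj₂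

  -- Each separated pair has two cuts, which come right before an element of U.
  pairs≤half : ∀ {ps} → Unique ps → (∀ {p p′} → p ∈ₗ ps → p′ ∈ₗ ps → Compatible (inj₂ p) (inj₂ p′)) →
               (∀ {p} → p ∈ₗ ps → Empty (proj₁ p ∩ proj₂ p)) →
               (U : List (Fin n)) → (∀ {p e} → p ∈ₗ ps → e ∈ proj₁ p ⊎ e ∈ proj₂ p → e ∈ₗ U) →
               ∑ ps (λ p → ∑ (allFin n) (λ c → pairCount p (toℕ c))) * 2 ≤ length U
  pairs≤half {ps} u comp disj U ⊆U = subst (_≤ length U) total
    (∑≤length-keys (Unique.cartesianProduct⁺ (Unique.cartesianProduct⁺ u (Unique.allFin⁺ n)) bools)
      (λ x → pairCount (proj₁ (proj₁ x)) (toℕ (proj₂ (proj₁ x)))) (λ x → pairCount≤1 (proj₁ (proj₁ x)) _) R key inj)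
    where
    bs : List Bool
    bs = true ∷ false ∷ []
    bools : Unique bs
    bools = ((λ ()) ∷ []) ∷ [] ∷ []
    xs : List ((Subset n × Subset n) × Fin n)
    xs = cartesianProduct ps (allFin n)
    count₂ : (Subset n × Subset n) × Fin n → ℕ
    count₂ (p , c) = pairCount p (toℕ c)
    total : ∑ (cartesianProduct xs bs) (λ x → count₂ (proj₁ x)) ≡ ∑ ps (λ p → ∑ (allFin n) (λ c → pairCount p (toℕ c))) * 2
    total = trans (∑-cartesianProduct xs bs _) (trans (∑-cong xs (λ x → double (count₂ x)))
      (trans (∑-*ʳ xs count₂ 2) (cong (_* 2) (∑-cartesianProduct ps (allFin n) count₂))))
      where
      double : ∀ m → m + (m + 0) ≡ m * 2
      double m = trans (cong (m +_) (+-identityʳ m)) (trans (cong (m +_) (sym (+-identityʳ m))) (*-comm 2 m))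
    R : ((Subset n × Subset n) × Fin n) × Bool → Fin n → Set
    R (((X , Y) , c) , b) e = ∃ λ q → el q ≡ e × ∃ λ θ → Separated X Y (toℕ c) θ × (q + toℕ c) % n ≡ cutAt b θ
    member : ∀ {x} → x ∈ₗ cartesianProduct xs bs → proj₁ (proj₁ x) ∈ₗ ps
    member x∈ = proj₁ (∈ₗ.∈-cartesianProduct⁻ ps (allFin n) (proj₁ (∈ₗ.∈-cartesianProduct⁻ xs bs x∈)))
    key : ∀ {x} → x ∈ₗ cartesianProduct xs bs → count₂ (proj₁ x) ≢ 0 → ∃ λ e → e ∈ₗ U × R x e
    key {((X , Y) , c) , b} x∈ ne with pairCount⇒Separated X Y (toℕ c) (disj (member x∈)) ne
    ... | θ , sep with %-solve n (toℕ c) (cutAt b θ) (bound b)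
      where
      bound : ∀ b → cutAt b θ < n
      bound true  = ≤-trans (s≤s z≤n) k<n
      bound false = θ<n sep
    ...   | q , _ , eq = el q , ⊆U (member x∈) (inUnion b eq′) , q , refl , θ , sep , eq′
      where
      eq′ : (q + toℕ c) % n ≡ cutAt b θ
      eq′ = trans (cong (_% n) (+-comm q (toℕ c))) eq
      inUnion : ∀ b → (q + toℕ c) % n ≡ cutAt b θ → el q ∈ X ⊎ el q ∈ Y
      inUnion true  e = inj₂ (Separated.0⇒∈Y sep q e)
      inUnion false e = inj₁ (Separated.θ⇒∈X sep q e)
    inj : ∀ {x z e} → x ∈ₗ cartesianProduct xs bs → z ∈ₗ cartesianProduct xs bs → R x e → R z e → x ≡ z
    inj {(p , c) , b} {(p′ , c′) , b′} x∈ z∈ (q , refl , θ , sep , e) (q′ , el≡ , θ′ , sep′ , e′) =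
      finish b b′ (cut-unique (inj₂ p) (inj₂ p′) (Fin.toℕ<n c) (Fin.toℕ<n c′) (comp (member x∈) (member z∈))
        (θ , sep , cutAt-⊎ b e) (θ′ , sep′ , cutAt-⊎ b′ e″)) e e″
      where
      e″ : (q + toℕ c′) % n ≡ cutAt b′ θ′
      e″ = trans (sym ([m%n+o]%n≡[m+o]%n q (toℕ c′) n)) (trans (cong (λ z → (z + toℕ c′) % n) (sym (el-injective {q′} {q} el≡)))
             (trans ([m%n+o]%n≡[m+o]%n q′ (toℕ c′) n) e′))
      0≢ : ∀ {X Y c θ} → Separated X Y c θ → 0 ≢ θ
      0≢ sep 0≡θ = <⇒≢ (≤-trans 0<k (Separated.k≤θ sep)) 0≡θ
      finish : ∀ b b′ → (inj₂ p , toℕ c) ≡ (inj₂ p′ , toℕ c′) → (q + toℕ c) % n ≡ cutAt b θ → (q + toℕ c′) % n ≡ cutAt b′ θ′ →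
               ((p , c) , b) ≡ ((p′ , c′) , b′)
      finish b b′ eq e e′ with refl ← ,-injectiveˡ eq | refl ← Fin.toℕ-injective {i = c} {j = c′} (,-injectiveʳ eq) with b | b′
      ... | true  | true  = refl
      ... | false | false = refl
      ... | true  | false = contradiction (trans (sym e) e′) (0≢ sep′)
      ... | false | true  = contradiction (trans (sym e′) e) (0≢ sep)

  arcs : List (Subset n) → ℕ
  arcs F = ∑ F (λ P → ∑ (allFin n) (λ c → arcCount P (toℕ c)))

  pairs : List (Subset n × Subset n) → ℕ
  pairs M = ∑ M (λ p → ∑ (allFin n) (λ c → pairCount p (toℕ c)))

  arcs⇒Arc : ∀ F → arcs F ≢ 0 → ∃ λ P → ∃ λ c → P ∈ₗ F × Arc P c
  arcs⇒Arc F ne with ∑≢0⇒∃≢0 F ne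
  ... | P , P∈ , ne′ with ∑≢0⇒∃≢0 (allFin n) ne′
  ...   | c , _ , ne″ = P , toℕ c , P∈ , arcCount⇒Arc P (toℕ c) ne″

  Compatibles : List (Subset n) → List (Subset n × Subset n) → Set
  Compatibles F M = ∀ {o o′} → o ∈ₗ map inj₁ F ++ map inj₂ M → o′ ∈ₗ map inj₁ F ++ map inj₂ M → Compatible o o′

  -- The weights are chosen so that both cases end at `k * length U`: with an arc there are at most
  -- `k` events, each of weight at most `length U`; without one there are at most `length U / 2`
  -- pairs, each of weight `2 * k`.
  weighted-bound : ∀ {F M} → Unique F → Unique M → Compatibles F M → (∀ {p} → p ∈ₗ M → Empty (proj₁ p ∩ proj₂ p)) →
                   (U : List (Fin n)) → (∀ {p e} → p ∈ₗ M → e ∈ proj₁ p ⊎ e ∈ proj₂ p → e ∈ₗ U) → 2 * k ≤ length U →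
                   length U * arcs F + 2 * k * pairs M ≤ k * length U
  weighted-bound {F} {M} uF uM comp disj U ⊆U 2k≤U with arcs F ≟ 0
  ... | yes a≡0 = begin
    length U * arcs F + 2 * k * pairs M ≡⟨ cong (λ z → length U * z + 2 * k * pairs M) a≡0 ⟩
    length U * 0 + 2 * k * pairs M      ≡⟨ solve 3 (λ l k p → l :* con 0 :+ con 2 :* k :* p := k :* (p :* con 2)) refl (length U) k (pairs M) ⟩
    k * (pairs M * 2)                   ≤⟨ *-monoʳ-≤ k (pairs≤half uM
        (λ p∈ p′∈ → comp (∈ₗ.∈-++⁺ʳ (map inj₁ F) (∈ₗ.∈-map⁺ inj₂ p∈)) (∈ₗ.∈-++⁺ʳ (map inj₁ F) (∈ₗ.∈-map⁺ inj₂ p′∈))) disj U ⊆U) ⟩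
    k * length U                        ∎
    where
    open ≤-Reasoning
    open +-*-Solver
  ... | no a≢0 with arcs⇒Arc F a≢0
  ...   | P , c , P∈ , arc = begin
    length U * arcs F + 2 * k * pairs M    ≤⟨ +-monoʳ-≤ (length U * arcs F) (*-monoˡ-≤ (pairs M) 2k≤U) ⟩
    length U * arcs F + length U * pairs M ≡⟨ *-distribˡ-+ (length U) (arcs F) (pairs M) ⟨
    length U * (arcs F + pairs M)          ≤⟨ *-monoʳ-≤ (length U) sum≤k ⟩
    length U * k                           ≡⟨ *-comm (length U) k ⟩
    k * length U                           ∎
    where
    open ≤-Reasoning
    os : List (Object n)
    os = map inj₁ F ++ map inj₂ M
    uos : Unique os
    uos = Unique.++⁺ (Unique.map⁺ (λ { refl → refl }) uF) (Unique.map⁺ (λ { refl → refl }) uM) disjoint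
      where
      disjoint : ∀ {o} → ¬ (o ∈ₗ map inj₁ F × o ∈ₗ map inj₂ M)
      disjoint (o∈ , o∈′) with ∈ₗ.∈-map⁻ inj₁ o∈ | ∈ₗ.∈-map⁻ inj₂ o∈′
      ... | _ , _ , refl | _ , _ , ()
    disjO : ∀ {o} → o ∈ₗ os → DisjointPair o
    disjO {inj₁ P} _ = tt
    disjO {inj₂ p} o∈ with ∈ₗ.∈-++⁻ (map inj₁ F) o∈
    ... | inj₁ o∈F with ∈ₗ.∈-map⁻ inj₁ o∈F
    ...   | _ , _ , ()
    disjO {inj₂ p} o∈ | inj₂ o∈M with ∈ₗ.∈-map⁻ inj₂ o∈M
    ... | _ , p∈ , refl = disj p∈
    sum≤k : arcs F + pairs M ≤ k
    sum≤k = subst (_≤ k) (trans (∑-++ (map inj₁ F) (map inj₂ M) _) (cong₂ _+_ (∑-map inj₁ F _) (∑-map inj₂ M _)))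
      (objects≤k uos comp disjO (∈ₗ.∈-++⁺ˡ (∈ₗ.∈-map⁺ inj₁ P∈)) arc)

  -- Arcs compared by their starting places

  ArcAt : Subset n → ℕ → Set
  ArcAt P q = Low P q k × (∀ i → i < k → el (q + i) ∈ P)

  Arc⇒ArcAt : ∀ {P c q} → Arc P c → (q + c) % n ≡ 0 → ArcAt P q
  Arc⇒ArcAt {c = c} {q} arc eq = arc-low arc eq ,
    λ i i<k → Arc.<⇒∈ arc _ (subst (_< k) (sym (at-cut₀ q c i (<-trans i<k k<n) eq)) i<k)

  Arc⇒ArcAt-end : ∀ {P c q} → Arc P c → (q + c) % n ≡ k → ArcAt P (q + (n ∸ k))
  Arc⇒ArcAt-end {c = c} {q} arc eq = Arc⇒ArcAt arc
    (trans (at-cut q c (n ∸ k) eq) (trans (cong (_% n) (m+[n∸m]≡n (<⇒≤ k<n))) (n%n≡0 n)))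

  el-+n : ∀ q → el (q + n) ≡ el q
  el-+n q = el-cong ([m+n]%n≡m%n q n)

  ArcAt-+n : ∀ {P q} → ArcAt P q → ArcAt P (q + n)
  ArcAt-+n {P} {q} (low , mem) = (λ i i<n i∈ → low i i<n (subst (_∈ P) (eq i) i∈)) , (λ i i<k → subst (_∈ P) (sym (eq i)) (mem i i<k))
    where
    eq : ∀ i → el (q + n + i) ≡ el (q + i)
    eq i = trans (cong el (trans (+-assoc q n i) (trans (cong (q +_) (+-comm n i)) (sym (+-assoc q i n))))) (el-+n (q + i))

  -- By `m + k ≤ n` the arc does not reach `q` again. A point before place `m` would have index at
  -- least `n ∸ m ≥ k` when read from the start `q + m` of the arc.
  ArcAt-shift-≥ : ∀ {P q} m → ArcAt P (q + m) → m + k ≤ n → High P q m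
  ArcAt-shift-≥ {P} {q} m (low , _) m+k≤n i i<n i∈ = ≮⇒≥ λ i<m →
    <⇒≱ (low (i + (n ∸ m)) (subst (i + (n ∸ m) <_) (m+[n∸m]≡n m≤n) (+-monoˡ-< (n ∸ m) i<m))
          (subst (_∈ P) (trans (sym (el-+n (q + i))) (cong el (eq m≤n))) i∈))
        (≤-trans (m+n≤o⇒n≤o∸m {m} m+k≤n) (m≤n+m _ i))
    where
    m≤n : m ≤ n
    m≤n = ≤-trans (m≤m+n m k) m+k≤n
    open +-*-Solver
    eq : m ≤ n → q + i + n ≡ q + m + (i + (n ∸ m))
    eq m≤n = trans (cong (q + i +_) (sym (m+[n∸m]≡n m≤n)))
      (solve 4 (λ q i m d → q :+ i :+ (m :+ d) := q :+ m :+ (i :+ d)) refl q i m (n ∸ m))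

  ArcAt-disjoint : ∀ {P Q q} m → ArcAt P q → ArcAt Q (q + m) → k ≤ m → m + k ≤ n → ¬ Meet P Q
  ArcAt-disjoint m arcP arcQ k≤m m+k≤n meet = clash meet (proj₁ arcP) (ArcAt-shift-≥ m arcQ m+k≤n) k≤m

  size≡count : ∀ q (P : Subset n) → ∣ P ∣ ≡ count n inX (λ i → word₁ P (el (q + i)))
  size≡count q P = begin
    ∣ P ∣                                                   ≡⟨ proj₁ (countᵥ-word₁ P) ⟨
    countᵥ inX (word₁ P)                                    ≡⟨ countᵥ-perm σ inX (word₁ P) ⟨
    countᵥ inX (word₁ P ∘ perm σ)                           ≡⟨ ∑-cong (allFin n) (λ j → cong (λ z → δ (word₁ P (perm σ z)) inX)
                                                               (Fin.toℕ-injective (trans (sym (m<n⇒m%n≡m (Fin.toℕ<n j))) (sym (toℕ-mod (toℕ j)))))) ⟩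
    countᵥ {n} inX (word₁ P ∘ el ∘ toℕ)                     ≡⟨ countᵥ≡count n inX (word₁ P ∘ el) ⟩
    count n inX (word₁ P ∘ el)                              ≡⟨ count-rotate n q inX (word₁ P ∘ el) ⟨
    count n inX (λ i → word₁ P (el ((i + q) % n)))          ≡⟨ ∑<-cong n (λ i _ → cong (λ z → δ (word₁ P z) inX)
                                                               (el-cong (trans (m%n%n≡m%n (i + q) n) (cong (_% n) (+-comm i q))))) ⟩
    count n inX (λ i → word₁ P (el (q + i)))                ∎
    where open ≡-Reasoning

  -- Read from `q`, the arcs fill the intervals `[0, k)` and `[m, m + k)` without wrapping around,
  -- so they share `[m, k)`.
  ArcAt-∩ : ∀ {P Q q} m → ArcAt P q → ArcAt Q (q + m) → m ≤ k → m + k ≤ n → ∣ P ∩ Q ∣ ≡ k ∸ m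
  ArcAt-∩ {P} {Q} {q} m arcP arcQ m≤k m+k≤n = trans (size≡count q (P ∩ Q)) (≤-antisym
    (count≤ n m k _ λ i i<n eq → let i∈P , i∈Q = Sub.x∈p∩q⁻ P Q (word₁-∈ (P ∩ Q) eq) in
      ArcAt-shift-≥ m arcQ m+k≤n i i<n i∈Q , proj₁ arcP i i<n i∈P)
    (count≥ n m k _ (<⇒≤ k<n) λ i m≤i i<k → ∈-word₁ (Sub.x∈p∩q⁺ (proj₂ arcP i i<k ,
      subst (λ z → el z ∈ Q) (trans (+-assoc q m _) (cong (q +_) (m+[n∸m]≡n m≤i)))
        (proj₂ arcQ (i ∸ m) (≤-<-trans (m∸n≤m i m) i<k))))))

  -- With k arcs every key d < k is used; the arcs then start at k consecutive places, among them
  -- b, b + 1 and b + t + 1 for some b, where n = 2 k + t.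
  module _ (t : ℕ) (n≡ : n ≡ k + k + t) (0<t : 0 < t) (2t+2≤k : t + t + 2 ≤ k) {F : List (Subset n)} (uF : Unique F)
           (meets : ∀ {P Q} → P ∈ₗ F → Q ∈ₗ F → Meet P Q)
           (no-triple : ∀ {A B D} → A ∈ₗ F → B ∈ₗ F → D ∈ₗ F → ∣ A ∩ B ∣ ≡ k ∸ 1 → ∣ B ∩ D ∣ ≡ k ∸ t → ∣ A ∩ D ∣ ≡ k ∸ (t + 1) → ⊥) where

    t+2≤k : t + 2 ≤ k
    t+2≤k = ≤-trans (≤-trans (m≤n+m (t + 2) t) (≤-reflexive (sym (+-assoc t t 2)))) 2t+2≤k

    t+1≤k : t + 1 ≤ k
    t+1≤k = ≤-trans (+-monoʳ-≤ t (s≤s z≤n)) t+2≤k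

    t<k : t < k
    t<k = ≤-trans (≤-reflexive (+-comm 1 t)) t+1≤k

    -- The overlaps of these arcs are the sizes for which the second set is the midpoint of a
    -- geodesic of length 4.
    start-triple : ∀ {A B D} b → A ∈ₗ F → B ∈ₗ F → D ∈ₗ F → ArcAt A b → ArcAt B (b + 1) → ArcAt D (b + 1 + t) → ⊥
    start-triple b A∈ B∈ D∈ arcA arcB arcD = no-triple A∈ B∈ D∈
      (ArcAt-∩ 1 arcA arcB 0<k k<n)
      (ArcAt-∩ t arcB arcD (<⇒≤ t<k) (subst (t + k ≤_) (sym (trans n≡ (+-comm (k + k) t))) (+-monoʳ-≤ t (m≤m+n k k))))
      (ArcAt-∩ (t + 1) arcA (subst (ArcAt _) (trans (+-assoc b 1 t) (cong (b +_) (+-comm 1 t))) arcD) t+1≤k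
        (≤-trans (+-monoˡ-≤ k t+1≤k) 2k≤n))

    -- A key `d` is used either by an arc that begins at `s + d` or by one that ends right before
    -- it. The latter begins `k` places earlier, which is `n ∸ k` places later on the cycle.
    Upper Lower : ℕ → ℕ → Set
    Upper s d = ∃ λ P → P ∈ₗ F × ArcAt P (s + d)
    Lower s d = ∃ λ P → P ∈ₗ F × ArcAt P (s + d + (n ∸ k))

    n∸k≡ : n ∸ k ≡ k + t
    n∸k≡ = trans (cong (_∸ k) (trans n≡ (+-assoc k k t))) (m+n∸m≡n k (k + t))

    -- Only the place `s + d` separates the end of the first arc from the beginning of the second.
    -- Both arcs and this place fit into `2 k + 1 ≤ n` places, so the arcs are disjoint.
    lower-suc : ∀ {s d} → Lower s d → Upper s (suc d) → ⊥
    lower-suc {s} {d} (P , P∈ , arcP) (Q , Q∈ , arcQ) = ArcAt-disjoint (k + (t ∸ 1)) arcQ (subst (ArcAt P) eq arcP)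
      (m≤m+n k _) (≤-trans (≤-trans (≤-reflexive (solve 2 (λ k t → k :+ t :+ k := k :+ k :+ t) refl k (t ∸ 1))) (+-monoʳ-≤ (k + k) (m∸n≤m t 1))) (≤-reflexive (sym n≡))) (meets Q∈ P∈)
      where
      open +-*-Solver
      eq : s + d + (n ∸ k) ≡ s + suc d + (k + (t ∸ 1))
      eq = trans (cong (s + d +_) (trans n∸k≡ (cong (k +_) (sym (m+[n∸m]≡n 0<t)))))
        (solve 4 (λ s d k t → s :+ d :+ (k :+ (con 1 :+ t)) := s :+ (con 1 :+ d) :+ (k :+ t)) refl s d k (t ∸ 1))

    all-keys-⊥ : ∀ s → (∃ λ P → P ∈ₗ F × ArcAt P s) → (∀ d → d < k → Upper s d ⊎ Lower s d) → ⊥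
    all-keys-⊥ s (P₀ , P₀∈ , arc₀) keys with keys (t + 1) (≤-trans (≤-reflexive (trans (+-comm 1 (t + 1)) (+-assoc t 1 1))) t+2≤k)
    -- An arc begins at `s + t + 1`. Then key 1 belongs to an arc beginning at `s + 1`, since one
    -- ending at `s` would be disjoint from `D`. So the triple begins at `s`.
    ... | inj₁ (D , D∈ , arcD) with keys 1 (≤-trans (m≤n+m 2 t) t+2≤k)
    ...   | inj₁ (B , B∈ , arcB) = start-triple s P₀∈ B∈ D∈ arc₀ arcB (subst (ArcAt D) (trans (cong (s +_) (+-comm t 1)) (sym (+-assoc s 1 t))) arcD)
    ...   | inj₂ (B , B∈ , arcB) = ArcAt-disjoint k arcD (subst (ArcAt B) eq arcB) ≤-refl 2k≤n (meets D∈ B∈)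
      where
      open +-*-Solver
      eq : s + 1 + (n ∸ k) ≡ s + (t + 1) + k
      eq = trans (cong (s + 1 +_) n∸k≡) (solve 3 (λ s k t → s :+ con 1 :+ (k :+ t) := s :+ (t :+ con 1) :+ k) refl s k t)
    -- Now an arc ends right before `s + t + 1`, and by `lower-suc` all larger keys are used in the
    -- same way. By `2 t + 2 ≤ k` these include `k ∸ (t + 1)` and `k ∸ t`, whose arcs begin `t + 1`
    -- and `t` places before `s`; the base arc completes the triple.
    all-keys-⊥ s (P₀ , P₀∈ , arc₀) keys | inj₂ low₀ = finish (lower (k ∸ (t + 1)) t+1≤ bound₁) (lower (k ∸ t) (≤-trans t+1≤ (∸-monoʳ-≤ k (m≤m+n t 1))) bound₂)
      where
      open +-*-Solver
      t+1≤ : t + 1 ≤ k ∸ (t + 1)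
      t+1≤ = m+n≤o⇒n≤o∸m {t + 1} (≤-trans (≤-reflexive (solve 1 (λ t → t :+ con 1 :+ (t :+ con 1) := t :+ t :+ con 2) refl t)) 2t+2≤k)
      bound₁ : k ∸ (t + 1) < k
      bound₁ = ∸-monoʳ-< (m≤n+m 1 t) t+1≤k
      bound₂ : k ∸ t < k
      bound₂ = ∸-monoʳ-< 0<t (<⇒≤ t<k)
      lower′ : ∀ j → t + 1 + j < k → Lower s (t + 1 + j)
      lower′ zero    _  = subst (Lower s) (sym (+-identityʳ (t + 1))) low₀
      lower′ (suc j) j< with keys (t + 1 + suc j) j<
      ... | inj₂ low = low
      ... | inj₁ up  = ⊥-elim (lower-suc {s} {t + 1 + j} (lower′ j (<-trans (+-monoʳ-< (t + 1) (n<1+n j)) j<)) (subst (Upper s) (+-suc (t + 1) j) up))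
      lower : ∀ d → t + 1 ≤ d → d < k → Lower s d
      lower d t+1≤d d<k = subst (Lower s) (m+[n∸m]≡n t+1≤d) (lower′ (d ∸ (t + 1)) (subst (_< k) (sym (m+[n∸m]≡n t+1≤d)) d<k))
      finish : Lower s (k ∸ (t + 1)) → Lower s (k ∸ t) → ⊥
      finish (A , A∈ , arcA) (B , B∈ , arcB) = start-triple (s + (k ∸ (t + 1)) + (n ∸ k)) A∈ B∈ P₀∈ arcA
        (subst (ArcAt B) eqB arcB) (subst (ArcAt P₀) eqD (ArcAt-+n arc₀))
        where
        e : ℕ
        e = k ∸ (t + 1)
        k≡ : k ≡ t + 1 + e
        k≡ = sym (m+[n∸m]≡n t+1≤k)
        k∸t≡ : k ∸ t ≡ 1 + e
        k∸t≡ = trans (cong (_∸ t) (trans k≡ (+-assoc t 1 e))) (m+n∸m≡n t (1 + e))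
        eqB : s + (k ∸ t) + (n ∸ k) ≡ s + e + (n ∸ k) + 1
        eqB = trans (cong (λ z → s + z + (n ∸ k)) k∸t≡) (solve 3 (λ s e m → s :+ (con 1 :+ e) :+ m := s :+ e :+ m :+ con 1) refl s e (n ∸ k))
        eqD : s + n ≡ s + e + (n ∸ k) + 1 + t
        eqD = trans (cong (s +_) (trans (sym (m+[n∸m]≡n (<⇒≤ k<n))) (cong (_+ (n ∸ k)) k≡)))
          (solve 4 (λ s e m t → s :+ (t :+ con 1 :+ e :+ m) := s :+ e :+ m :+ con 1 :+ t) refl s e (n ∸ k) t)

    module _ {P c s} (P∈ : P ∈ₗ F) (base : Arc P c) (start : (s + c) % n ≡ 0) where

      placed : List (Subset n × Fin n)
      placed = cartesianProduct F (allFin n)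

      Hit : ℕ → Subset n × Fin n → Set
      Hit d (Q , c′) = arcCount Q (toℕ c′) ≢ 0 × ((s + d + toℕ c′) % n ≡ 0 ⊎ (s + d + toℕ c′) % n ≡ k)

      hit? : ∀ d → Decidable (Hit d)
      hit? d (Q , c′) = ¬? (arcCount Q (toℕ c′) ≟ 0) ×-dec (((s + d + toℕ c′) % n ≟ 0) ⊎-dec ((s + d + toℕ c′) % n ≟ k))

      gap? : ∀ m → (∃ λ d → d < m × ¬ Any (Hit d) placed) ⊎ (∀ d → d < m → Any (Hit d) placed)
      gap? zero = inj₂ (λ _ ())
      gap? (suc m) with any? (hit? m) placed | gap? m
      ... | no ¬hit | _ = inj₁ (m , ≤-refl , ¬hit)
      ... | yes _   | inj₁ (d , d<m , ¬hit) = inj₁ (d , m≤n⇒m≤1+n d<m , ¬hit)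
      ... | yes hit | inj₂ all = inj₂ λ d d<1+m → case m≤n⇒m<n∨m≡n (≤-pred d<1+m) of λ
        { (inj₁ d<m) → all d d<m ; (inj₂ refl) → hit }

      hit⇒upper-or-lower : ∀ d → Any (Hit d) placed → Upper s d ⊎ Lower s d
      hit⇒upper-or-lower d hit with find hit
      ... | (Q , c′) , x∈ , ne , inj₁ e =
        inj₁ (Q , proj₁ (∈ₗ.∈-cartesianProduct⁻ F (allFin n) x∈) , Arc⇒ArcAt (arcCount⇒Arc Q _ ne) e)
      ... | (Q , c′) , x∈ , ne , inj₂ e =
        inj₂ (Q , proj₁ (∈ₗ.∈-cartesianProduct⁻ F (allFin n) x∈) , Arc⇒ArcAt-end (arcCount⇒Arc Q _ ne) e)

      -- Either every key below `k` occurs, which is impossible, or a missing key can be struck from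
      -- the list of keys, and the list is then shorter than `k`.
      arcs<k-from : arcs F < k
      arcs<k-from with gap? k
      ... | inj₂ all = ⊥-elim (all-keys-⊥ s (P , P∈ , Arc⇒ArcAt base start) λ d d<k → hit⇒upper-or-lower d (all d d<k))
      ... | inj₁ (d₀ , d₀<k , ¬hit) = ≤-<-trans
        (subst (_≤ length keys) (∑-cartesianProduct F (allFin n) _)
          (∑≤length-keys {ks = keys} (Unique.cartesianProduct⁺ uF (Unique.allFin⁺ n)) (λ x → arcCount (proj₁ x) (toℕ (proj₂ x)))
            (λ x → match≤1 σ _ _) (λ x d → Cut (inj₁ (proj₁ x)) (toℕ (proj₂ x)) (s + d)) key inj))
        (subst (length keys <_) (List.length-upTo k)
          (List.filter-notAll ≢d₀? (upTo k) (lose (∈ₗ.∈-upTo⁺ d₀<k) (λ ne → ne refl))))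
        where
        ≢d₀? : ∀ d → Dec (d ≢ d₀)
        ≢d₀? d = ¬? (d ≟ d₀)
        keys : List ℕ
        keys = filter ≢d₀? (upTo k)
        member : ∀ {x} → x ∈ₗ placed → proj₁ x ∈ₗ F
        member x∈ = proj₁ (∈ₗ.∈-cartesianProduct⁻ F (allFin n) x∈)
        key : ∀ {x} → x ∈ₗ placed → arcCount (proj₁ x) (toℕ (proj₂ x)) ≢ 0 →
              ∃ λ d → d ∈ₗ keys × Cut (inj₁ (proj₁ x)) (toℕ (proj₂ x)) (s + d)
        key {Q , c′} x∈ ne with cut-exists base start (inj₁ Q) (meets P∈ (member x∈)) (arcCount⇒Arc Q _ ne)
        ... | d , d<k , arc , r = d , ∈ₗ.∈-filter⁺ ≢d₀? (∈ₗ.∈-upTo⁺ d<k) (λ { refl → ¬hit (lose x∈ (ne , r)) }) , arc , r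
        inj : ∀ {x z d} → x ∈ₗ placed → z ∈ₗ placed → Cut (inj₁ (proj₁ x)) (toℕ (proj₂ x)) (s + d) →
              Cut (inj₁ (proj₁ z)) (toℕ (proj₂ z)) (s + d) → x ≡ z
        inj {Q , a} {R , b} x∈ z∈ cut cut′ with cut-unique (inj₁ Q) (inj₁ R) (Fin.toℕ<n a) (Fin.toℕ<n b) (meets (member x∈) (member z∈)) cut cut′
        ... | eq with refl ← ,-injectiveˡ eq = cong (Q ,_) (Fin.toℕ-injective (,-injectiveʳ eq))

    arcs<k : arcs F < k
    arcs<k with arcs F ≟ 0
    ... | yes a≡0 = subst (_< k) (sym a≡0) 0<k
    ... | no  a≢0 with arcs⇒Arc F a≢0
    ...   | P , c , P∈ , arc with arc-start c
    ...     | s , eq = arcs<k-from P∈ arc eq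

-- Averages over all permutations

nCk*k!*[n∸k]!≡n! : ∀ {n k} → k ≤ n → (n C k) * (k ! * (n ∸ k) !) ≡ n !
nCk*k!*[n∸k]!≡n! {n} {k} k≤n = trans (cong (_* (k ! * (n ∸ k) !)) (nCk≡n!/k![n-k]! k≤n)) (m/n*n≡m (k![n∸k]!∣n! k≤n))
  where instance _ = k !* (n ∸ k) !≢0

length-allFin : ∀ n → length (allFin n) ≡ n
length-allFin n = List.length-tabulate {n = n} id

module Average (n : ℕ) .{{_ : NonZero n}} (k : ℕ) (0<k : 0 < k) (2k≤n : k + k ≤ n) (k<n : k < n) where

  private module Cyc (σ : Code n) = Cycle n k 0<k 2k≤n k<n σ

  open Cyc public using (Compatibles)

  k≤n : k ≤ n
  k≤n = <⇒≤ k<n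

  arcWeight : ∀ P → ∣ P ∣ ≡ k → ∀ c → ∑ (codes n) (λ σ → match σ (word₁ P) (rotate n c (arcWord k))) ≡ k ! * (n ∸ k) !
  arcWeight P ∣P∣≡k c = begin
    ∑ (codes n) (λ σ → match σ (word₁ P) (rotate n c (arcWord k)))
      ≡⟨ ∑-match n (word₁ P) (rotate n c (arcWord k)) (countᵥ≡count-out n _ _
           (trans (proj₁ (countᵥ-word₁ P)) (trans ∣P∣≡k (sym cX))) (trans (proj₂ (countᵥ-word₁ P)) (sym cY))) ⟩
    weight n (rotate n c (arcWord k))  ≡⟨ weight-of n (rotate n c (arcWord k)) cX cY ⟩
    (n ∸ (k + 0)) ! * (k ! * 1)        ≡⟨ cong₂ (λ a b → (n ∸ a) ! * b) (+-identityʳ k) (*-identityʳ (k !)) ⟩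
    (n ∸ k) ! * k !                    ≡⟨ *-comm ((n ∸ k) !) (k !) ⟩
    k ! * (n ∸ k) !                    ∎
    where
    open ≡-Reasoning
    cX : count n inX (rotate n c (arcWord k)) ≡ k
    cX = trans (count-rotate n c inX (arcWord k)) (proj₁ (count-arcWord n k k≤n))
    cY : count n inY (rotate n c (arcWord k)) ≡ 0
    cY = trans (count-rotate n c inY (arcWord k)) (proj₂ (count-arcWord n k k≤n))

  ∑-arcs : ∀ F → (∀ {P} → P ∈ₗ F → ∣ P ∣ ≡ k) → ∑ (codes n) (λ σ → Cyc.arcs σ F) ≡ length F * (n * (k ! * (n ∸ k) !))
  ∑-arcs F sizes = begin
    ∑ (codes n) (λ σ → Cyc.arcs σ F)
      ≡⟨ ∑-swap (codes n) F _ ⟩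
    ∑ F (λ P → ∑ (codes n) (λ σ → ∑ (allFin n) (λ c → Cyc.arcCount σ P (toℕ c))))
      ≡⟨ ∑-cong-∈ F (λ {P} P∈ → trans (∑-swap (codes n) (allFin n) _) (∑-cong (allFin n) (λ c → arcWeight P (sizes P∈) (toℕ c)))) ⟩
    ∑ F (λ P → ∑ (allFin n) (λ c → k ! * (n ∸ k) !))
      ≡⟨ ∑-const F _ ⟩
    length F * ∑ (allFin n) (λ c → k ! * (n ∸ k) !)
      ≡⟨ cong (length F *_) (trans (∑-const (allFin n) _) (cong (_* (k ! * (n ∸ k) !)) (length-allFin n))) ⟩
    length F * (n * (k ! * (n ∸ k) !)) ∎
    where open ≡-Reasoning

  pairWord : ∀ m j {u} → 1 + m ≡ n → 1 + j ≡ k → SplitWord m j k u → SplitWord n k k (cons inY u)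
  pairWord m j refl refl s = left s

  1+[n∸1] : 1 + (n ∸ 1) ≡ n
  1+[n∸1] = m+[n∸m]≡n (≤-trans (s≤s z≤n) k<n)

  1+[k∸1] : 1 + (k ∸ 1) ≡ k
  1+[k∸1] = m+[n∸m]≡n 0<k

  pairWeight : ∀ X Y → ∣ X ∣ ≡ k → ∣ Y ∣ ≡ k → Empty (X ∩ Y) → ∀ c {u} → u ∈ₗ splitWords (n ∸ 1) (k ∸ 1) k →
               ∑ (codes n) (λ σ → match σ (word₂ (X , Y)) (rotate n c (cons inY u))) ≡ (n ∸ (k + k)) ! * (k ! * k !)
  pairWeight X Y ∣X∣≡k ∣Y∣≡k disj c {u} u∈ = trans
    (∑-match n (word₂ (X , Y)) (rotate n c (cons inY u)) (countᵥ≡count-out n _ _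
      (trans (proj₁ (countᵥ-word₂ X Y disj)) (trans ∣X∣≡k (sym cX))) (trans (proj₂ (countᵥ-word₂ X Y disj)) (trans ∣Y∣≡k (sym cY)))))
    (weight-of n (rotate n c (cons inY u)) cX cY)
    where
    counts : count n inX (cons inY u) ≡ k × count n inY (cons inY u) ≡ k
    counts = count-splitWord (pairWord _ _ 1+[n∸1] 1+[k∸1] (splitWords⇒SplitWord _ _ _ u∈))
    cX : count n inX (rotate n c (cons inY u)) ≡ k
    cX = trans (count-rotate n c inX (cons inY u)) (proj₁ counts)
    cY : count n inY (rotate n c (cons inY u)) ≡ k
    cY = trans (count-rotate n c inY (cons inY u)) (proj₂ counts)

  pairTotal : ℕ
  pairTotal = n * (((n ∸ 1) C (k ∸ 1 + k)) * ((n ∸ (k + k)) ! * (k ! * k !)))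

  ∑-pairs : ∀ M → (∀ {p} → p ∈ₗ M → (∣ proj₁ p ∣ ≡ k × ∣ proj₂ p ∣ ≡ k) × Empty (proj₁ p ∩ proj₂ p)) →
            ∑ (codes n) (λ σ → Cyc.pairs σ M) ≡ length M * pairTotal
  ∑-pairs M ok = begin
    ∑ (codes n) (λ σ → Cyc.pairs σ M)
      ≡⟨ ∑-swap (codes n) M _ ⟩
    ∑ M (λ p → ∑ (codes n) (λ σ → ∑ (allFin n) (λ c → Cyc.pairCount σ p (toℕ c))))
      ≡⟨ ∑-cong-∈ M (λ {p} p∈ → trans (∑-swap (codes n) (allFin n) (λ σ c → Cyc.pairCount σ p (toℕ c))) (∑-cong (allFin n) (λ c → one p (ok p∈) (toℕ c)))) ⟩
    ∑ M (λ p → ∑ (allFin n) (λ c → ((n ∸ 1) C (k ∸ 1 + k)) * w))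
      ≡⟨ ∑-const M _ ⟩
    length M * ∑ (allFin n) (λ c → ((n ∸ 1) C (k ∸ 1 + k)) * w)
      ≡⟨ cong (length M *_) (trans (∑-const (allFin n) _) (cong (_* (((n ∸ 1) C (k ∸ 1 + k)) * w)) (length-allFin n))) ⟩
    length M * pairTotal ∎
    where
    open ≡-Reasoning
    words : List (ℕ → Letter)
    words = splitWords (n ∸ 1) (k ∸ 1) k
    w : ℕ
    w = (n ∸ (k + k)) ! * (k ! * k !)
    one : ∀ p → (∣ proj₁ p ∣ ≡ k × ∣ proj₂ p ∣ ≡ k) × Empty (proj₁ p ∩ proj₂ p) → ∀ c →
          ∑ (codes n) (λ σ → Cyc.pairCount σ p c) ≡ ((n ∸ 1) C (k ∸ 1 + k)) * w
    one (X , Y) ((sX , sY) , disj) c = begin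
      ∑ (codes n) (λ σ → ∑ words (λ u → match σ (word₂ (X , Y)) (rotate n c (cons inY u))))
        ≡⟨ ∑-swap (codes n) words _ ⟩
      ∑ words (λ u → ∑ (codes n) (λ σ → match σ (word₂ (X , Y)) (rotate n c (cons inY u))))
        ≡⟨ ∑-cong-∈ words (pairWeight X Y sX sY disj c) ⟩
      ∑ words (λ u → w)       ≡⟨ ∑-const words w ⟩
      length words * w        ≡⟨ cong (_* w) (length-splitWords (n ∸ 1) (k ∸ 1) k) ⟩
      ((n ∸ 1) C (k ∸ 1 + k)) * w ∎

  ∑-codes-const : ∀ m → ∑ (codes n) (λ _ → m) ≡ n ! * m
  ∑-codes-const m = trans (∑-const (codes n) m) (cong (_* m) (length-codes n))

  B W : ℕ
  B = (n ∸ 1) C (k ∸ 1)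
  W = (k + k) C k

  -- The common factor of all averages: n * (k - 1)! * (n - k)! = n! / B.
  Q : ℕ
  Q = n * ((k ∸ 1) ! * (n ∸ k) !)

  n!≡ : n ! ≡ B * Q
  n!≡ = begin
    n !                                              ≡⟨ cong _! 1+[n∸1] ⟨
    (1 + (n ∸ 1)) * (n ∸ 1) !                        ≡⟨ cong (_* (n ∸ 1) !) 1+[n∸1] ⟩
    n * (n ∸ 1) !                                    ≡⟨ cong (n *_) (nCk*k!*[n∸k]!≡n! (∸-monoˡ-≤ 1 k≤n)) ⟨
    n * (B * ((k ∸ 1) ! * (n ∸ 1 ∸ (k ∸ 1)) !))      ≡⟨ cong (λ z → n * (B * ((k ∸ 1) ! * z !))) (trans (∸-+-assoc n 1 (k ∸ 1)) (cong (n ∸_) 1+[k∸1])) ⟩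
    n * (B * ((k ∸ 1) ! * (n ∸ k) !))                ≡⟨ solve 3 (λ n b q → n :* (b :* q) := b :* (n :* q)) refl n B ((k ∸ 1) ! * (n ∸ k) !) ⟩
    B * Q                                            ∎
    where
    open ≡-Reasoning
    open +-*-Solver

  k!≡ : k ! ≡ k * (k ∸ 1) !
  k!≡ = trans (cong _! (sym 1+[k∸1])) (cong (_* (k ∸ 1) !) 1+[k∸1])

  -- As `n !` equals `B * Q`, a given `k`-set is an arc of a random cycle with probability `k / B`.
  arcTotal≡ : n * (k ! * (n ∸ k) !) ≡ k * Q
  arcTotal≡ = trans (cong (λ z → n * (z * (n ∸ k) !)) k!≡)
    (solve 4 (λ n k a b → n :* (k :* a :* b) := k :* (n :* (a :* b))) refl n k ((k ∸ 1) !) ((n ∸ k) !))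
    where open +-*-Solver

  -- In terms of `n ! = B * Q`, a given pair is separated with probability `2 k / W`: in the cyclic
  -- order of the `2 k` points of both sets, `X` occupies one of `W` equally likely sets of `k`
  -- places, and `2 k` of these are contiguous.
  pairTotal≡ : W * pairTotal ≡ 2 * k * (B * Q)
  pairTotal≡ = begin
    W * (n * (D * ((n ∸ (k + k)) ! * (k ! * k !)))) ≡⟨ solve 6 (λ w n d r x y → w :* (n :* (d :* (r :* (x :* y)))) := n :* (d :* (r :* (w :* (x :* y))))) refl W n D ((n ∸ (k + k)) !) (k !) (k !) ⟩
    n * (D * ((n ∸ (k + k)) ! * (W * (k ! * k !))))
      ≡⟨ cong (λ z → n * (D * ((n ∸ (k + k)) ! * z))) (trans (cong (λ z → W * (k ! * z !)) (sym (m+n∸m≡n k k))) (nCk*k!*[n∸k]!≡n! (m≤m+n k k))) ⟩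
    n * (D * ((n ∸ (k + k)) ! * (k + k) !))
      ≡⟨ cong (λ z → n * (D * ((n ∸ (k + k)) ! * z))) (trans (cong _! (sym 2k≡)) (cong (_* (k ∸ 1 + k) !) 2k≡)) ⟩
    n * (D * ((n ∸ (k + k)) ! * ((k + k) * (k ∸ 1 + k) !)))
      ≡⟨ solve 5 (λ n d r t f → n :* (d :* (r :* (t :* f))) := t :* (n :* (d :* (f :* r)))) refl n D ((n ∸ (k + k)) !) (k + k) ((k ∸ 1 + k) !) ⟩
    (k + k) * (n * (D * ((k ∸ 1 + k) ! * (n ∸ (k + k)) !)))
      ≡⟨ cong (λ z → (k + k) * (n * (D * ((k ∸ 1 + k) ! * z !)))) (trans (cong (n ∸_) (sym 2k≡)) (sym (∸-+-assoc n 1 (k ∸ 1 + k)))) ⟩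
    (k + k) * (n * (D * ((k ∸ 1 + k) ! * (n ∸ 1 ∸ (k ∸ 1 + k)) !)))
      ≡⟨ cong (λ z → (k + k) * (n * z)) (nCk*k!*[n∸k]!≡n! {n ∸ 1} {k ∸ 1 + k} (≤-pred (subst₂ _≤_ (sym 2k≡) (sym 1+[n∸1]) 2k≤n))) ⟩
    (k + k) * (n * (n ∸ 1) !)
      ≡⟨ cong₂ _*_ (cong (k +_) (sym (+-identityʳ k))) (trans (cong (_* (n ∸ 1) !) (sym 1+[n∸1])) (trans (cong _! 1+[n∸1]) n!≡)) ⟩
    2 * k * (B * Q) ∎
    where
    open ≡-Reasoning
    open +-*-Solver
    D : ℕ
    D = (n ∸ 1) C (k ∸ 1 + k)
    2k≡ : 1 + (k ∸ 1 + k) ≡ k + k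
    2k≡ = cong (_+ k) 1+[k∸1]

  instance
    k≢0 : NonZero k
    k≢0 = >-nonZero 0<k

    Q≢0 : NonZero Q
    Q≢0 = m*n≢0 n ((k ∸ 1) ! * (n ∸ k) !) {{>-nonZero (≤-trans (s≤s z≤n) k<n)}} {{(k ∸ 1) !* (n ∸ k) !≢0}}

  -- The average of `weighted-bound`, in which a set contributes `k / B` and a pair `2 k / W`,
  -- cleared of denominators and divided by `k`.
  weighted-average : ∀ {F M} → Unique F → Unique M → (∀ σ → Compatibles σ F M) →
    (∀ {P} → P ∈ₗ F → ∣ P ∣ ≡ k) →
    (∀ {p} → p ∈ₗ M → (∣ proj₁ p ∣ ≡ k × ∣ proj₂ p ∣ ≡ k) × Empty (proj₁ p ∩ proj₂ p)) →
    (U : List (Fin n)) → (∀ {p e} → p ∈ₗ M → e ∈ proj₁ p ⊎ e ∈ proj₂ p → e ∈ₗ U) → 2 * k ≤ length U →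
    length U * (length F * W) + 4 * k * (length M * B) ≤ length U * (B * W)
  weighted-average {F} {M} uF uM comp sizeF okM U ⊆U 2k≤U = *-cancelʳ-≤ _ _ (k * Q) {{m*n≢0 k Q}} (begin
    (length U * (length F * W) + 4 * k * (length M * B)) * (k * Q)
      ≡⟨ solve 7 (λ u f w k m b q → (u :* (f :* w) :+ con 4 :* k :* (m :* b)) :* (k :* q) := w :* (u :* (f :* (k :* q))) :+ con 2 :* k :* (m :* (con 2 :* k :* (b :* q)))) refl (length U) (length F) W k (length M) B Q ⟩
    W * (length U * (length F * (k * Q))) + 2 * k * (length M * (2 * k * (B * Q)))
      ≡⟨ cong₂ (λ a b → W * (length U * (length F * a)) + 2 * k * (length M * b)) (sym arcTotal≡) (sym pairTotal≡) ⟩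
    W * (length U * (length F * (n * (k ! * (n ∸ k) !)))) + 2 * k * (length M * (W * pairTotal))
      ≡⟨ solve 6 (λ w u f k m p → w :* (u :* f) :+ con 2 :* k :* (m :* (w :* p)) := w :* (u :* f :+ con 2 :* k :* (m :* p))) refl W (length U) (length F * (n * (k ! * (n ∸ k) !))) k (length M) pairTotal ⟩
    W * (length U * (length F * (n * (k ! * (n ∸ k) !))) + 2 * k * (length M * pairTotal))
      ≡⟨ cong₂ (λ a b → W * (length U * a + 2 * k * b)) (∑-arcs F sizeF) (∑-pairs M okM) ⟨
    W * (length U * ∑ (codes n) (λ σ → Cyc.arcs σ F) + 2 * k * ∑ (codes n) (λ σ → Cyc.pairs σ M))
      ≡⟨ cong (W *_) (trans (∑-+ (codes n) _ _) (cong₂ _+_ (∑-*ˡ (codes n) (length U) _) (∑-*ˡ (codes n) (2 * k) _))) ⟨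
    W * ∑ (codes n) (λ σ → length U * Cyc.arcs σ F + 2 * k * Cyc.pairs σ M)
      ≤⟨ *-monoʳ-≤ W (∑-mono (codes n) (λ σ → Cyc.weighted-bound σ uF uM (comp σ) (λ p∈ → proj₂ (okM p∈)) U ⊆U 2k≤U)) ⟩
    W * ∑ (codes n) (λ σ → k * length U)
      ≡⟨ cong (W *_) (trans (∑-codes-const (k * length U)) (cong (_* (k * length U)) n!≡)) ⟩
    W * (B * Q * (k * length U))
      ≡⟨ solve 5 (λ w b q k u → w :* (b :* q :* (k :* u)) := u :* (b :* w) :* (k :* q)) refl W B Q k (length U) ⟩
    length U * (B * W) * (k * Q) ∎)
    where
    open ≤-Reasoning
    open +-*-Solver

  -- Every cycle has at most `k - 1` arcs, and a set is an arc with probability `k / B`; so the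
  -- family has at most `(1 - 1 / k) B` members.
  strict-average : ∀ t → n ≡ k + k + t → 0 < t → t + t + 2 ≤ k → ∀ {F} → Unique F → (∀ {P} → P ∈ₗ F → ∣ P ∣ ≡ k) →
    (∀ {P P′} → P ∈ₗ F → P′ ∈ₗ F → Meet P P′) →
    (∀ {A A′ D} → A ∈ₗ F → A′ ∈ₗ F → D ∈ₗ F → ∣ A ∩ A′ ∣ ≡ k ∸ 1 → ∣ A′ ∩ D ∣ ≡ k ∸ t → ∣ A ∩ D ∣ ≡ k ∸ (t + 1) → ⊥) →
    k * length F + B ≤ k * B
  strict-average t n≡ 0<t 2t+2≤k {F} uF sizeF meets no-triple = *-cancelʳ-≤ _ _ Q (begin
    (k * length F + B) * Q            ≡⟨ solve 4 (λ k f b q → (k :* f :+ b) :* q := f :* (k :* q) :+ b :* q) refl k (length F) B Q ⟩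
    length F * (k * Q) + B * Q        ≡⟨ cong₂ (λ a b → length F * a + b) arcTotal≡ n!≡ ⟨
    length F * (n * (k ! * (n ∸ k) !)) + n ! ≡⟨ cong₂ _+_ (∑-arcs F sizeF) (trans (∑-codes-const 1) (*-identityʳ (n !))) ⟨
    ∑ (codes n) (λ σ → Cyc.arcs σ F) + ∑ (codes n) (λ _ → 1) ≡⟨ ∑-+ (codes n) _ _ ⟨
    ∑ (codes n) (λ σ → Cyc.arcs σ F + 1) ≤⟨ ∑-mono (codes n) (λ σ → subst (_≤ k) (+-comm 1 (Cyc.arcs σ F)) (Cyc.arcs<k σ t n≡ 0<t 2t+2≤k uF meets no-triple)) ⟩
    ∑ (codes n) (λ _ → k)             ≡⟨ trans (∑-codes-const k) (cong (_* k) n!≡) ⟩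
    B * Q * k                         ≡⟨ solve 3 (λ b q k → b :* q :* k := k :* b :* q) refl B Q k ⟩
    k * B * Q                         ∎)
    where
    open ≤-Reasoning
    open +-*-Solver

  -- At most one member of F contains the first k - 1 elements of a given permutation.
  packing : ∀ {F} → Unique F → (∀ {P} → P ∈ₗ F → ∣ P ∣ ≡ k) →
            (∀ {P P′} → P ∈ₗ F → P′ ∈ₗ F → k ∸ 1 ≤ ∣ P ∩ P′ ∣ → P ≡ P′) →
            length F * (1 + (n ∸ k)) * k ≤ n * B
  packing {F} uF sizeF apart = *-cancelʳ-≤ _ _ Q (begin
    length F * (1 + (n ∸ k)) * k * Q                   ≡⟨ trans (*-assoc (length F * (1 + (n ∸ k))) k Q) (cong (length F * (1 + (n ∸ k)) *_) (sym arcTotal≡)) ⟩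
    length F * (1 + (n ∸ k)) * (n * (k ! * (n ∸ k) !)) ≡⟨ solve 4 (λ f d n x → f :* d :* (n :* x) := n :* (f :* (d :* x))) refl (length F) (1 + (n ∸ k)) n (k ! * (n ∸ k) !) ⟩
    n * (length F * ((1 + (n ∸ k)) * (k ! * (n ∸ k) !))) ≡⟨ cong (n *_) total ⟨
    n * ∑ (codes n) (λ σ → ∑ placed (packCount σ))     ≤⟨ *-monoʳ-≤ n (∑-mono (codes n) atMostOne) ⟩
    n * ∑ (codes n) (λ _ → 1)                          ≡⟨ cong (n *_) (trans (∑-codes-const 1) (trans (*-identityʳ (n !)) n!≡)) ⟩
    n * (B * Q)                                        ≡⟨ *-assoc n B Q ⟨
    n * B * Q                                          ∎)
    where
    open ≤-Reasoning
    open +-*-Solver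
    ends : List ℕ
    ends = upTo (1 + (n ∸ k))
    placed : List (Subset n × ℕ)
    placed = cartesianProduct F ends
    packCount : Code n → Subset n × ℕ → ℕ
    packCount σ (P , j) = match σ (word₁ P) (packWord (k ∸ 1) j)
    index<n : ∀ {j} → j ∈ₗ ends → k ∸ 1 + j < n
    index<n j∈ = ≤-trans (+-monoʳ-< (k ∸ 1) (∈ₗ.∈-upTo⁻ j∈))
      (≤-reflexive (trans (trans (+-suc (k ∸ 1) (n ∸ k)) (cong (_+ (n ∸ k)) 1+[k∸1])) (m+[n∸m]≡n k≤n)))
    packWeight : ∀ {P j} → P ∈ₗ F → j ∈ₗ ends → ∑ (codes n) (λ σ → packCount σ (P , j)) ≡ k ! * (n ∸ k) !
    packWeight {P} {j} P∈ j∈ = trans (∑-match n (word₁ P) (packWord (k ∸ 1) j) (countᵥ≡count-out n _ _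
        (trans (proj₁ (countᵥ-word₁ P)) (trans (sizeF P∈) (sym cX))) (trans (proj₂ (countᵥ-word₁ P)) (sym cY))))
      (trans (weight-of n (packWord (k ∸ 1) j) cX cY)
        (trans (cong₂ (λ a b → (n ∸ a) ! * b) (+-identityʳ k) (*-identityʳ (k !))) (*-comm ((n ∸ k) !) (k !))))
      where
      cX : count n inX (packWord (k ∸ 1) j) ≡ k
      cX = trans (proj₁ (count-packWord n (k ∸ 1) j (index<n j∈))) 1+[k∸1]
      cY : count n inY (packWord (k ∸ 1) j) ≡ 0
      cY = proj₂ (count-packWord n (k ∸ 1) j (index<n j∈))
    total : ∑ (codes n) (λ σ → ∑ placed (packCount σ)) ≡ length F * ((1 + (n ∸ k)) * (k ! * (n ∸ k) !))
    total = trans (∑-swap (codes n) placed packCount)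
      (trans (∑-cong-∈ placed (λ {x} x∈ → packWeight {proj₁ x} {proj₂ x} (proj₁ (∈ₗ.∈-cartesianProduct⁻ F ends x∈)) (proj₂ (∈ₗ.∈-cartesianProduct⁻ F ends x∈))))
      (trans (∑-cartesianProduct F ends _) (trans (∑-const F _) (cong (length F *_)
        (trans (∑-const ends _) (cong (_* (k ! * (n ∸ k) !)) (List.length-upTo (1 + (n ∸ k)))))))))
    atMostOne : ∀ σ → ∑ placed (packCount σ) ≤ 1
    -- With a single key, injectivity says that any two hits of `σ` coincide.
    atMostOne σ = ∑≤length-keys {ks = 0 ∷ []} (Unique.cartesianProduct⁺ uF (Unique.upTo⁺ (1 + (n ∸ k)))) (packCount σ)
      (λ { (P , j) → match≤1 σ _ _ }) (λ x _ → x ∈ₗ placed × packCount σ x ≢ 0) (λ x∈ ne → 0 , here refl , x∈ , ne)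
      (λ { {P , j} {P′ , j′} _ _ (x∈ , ne) (z∈ , ne′) → same (∈ₗ.∈-cartesianProduct⁻ F ends x∈) (∈ₗ.∈-cartesianProduct⁻ F ends z∈) ne ne′ })
      where
      open Cyc σ using (el; size≡count; toℕ-mod)
      letters : ∀ {P j} → packCount σ (P , j) ≢ 0 → ∀ i → i < n → word₁ P (el i) ≡ packWord (k ∸ 1) j i
      letters ne i i<n = trans (match≢0⇒≡ σ _ _ ne (i mod n)) (cong (packWord (k ∸ 1) _) (trans (toℕ-mod i) (m<n⇒m%n≡m i<n)))
      same : ∀ {P j P′ j′} → P ∈ₗ F × j ∈ₗ ends → P′ ∈ₗ F × j′ ∈ₗ ends → packCount σ (P , j) ≢ 0 → packCount σ (P′ , j′) ≢ 0 → (P , j) ≡ (P′ , j′)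
      same {P} {j} {P′} {j′} (P∈ , j∈) (P′∈ , j′∈) ne ne′ with apart P∈ P′∈ shared
        where
        k∸1≤n : k ∸ 1 ≤ n
        k∸1≤n = ≤-trans (m∸n≤m k 1) k≤n
        shared : k ∸ 1 ≤ ∣ P ∩ P′ ∣
        shared = subst (k ∸ 1 ≤_) (sym (size≡count 0 (P ∩ P′))) (count≥ n 0 (k ∸ 1) _ k∸1≤n λ i _ i<k →
          ∈-word₁ (Sub.x∈p∩q⁺ (word₁-∈ P (trans (letters {P} {j} ne i (≤-trans i<k k∸1≤n)) (packWord-< (k ∸ 1) j i i<k)) ,
                               word₁-∈ P′ (trans (letters {P′} {j′} ne′ i (≤-trans i<k k∸1≤n)) (packWord-< (k ∸ 1) j′ i i<k)))))
      ... | refl = cong (P ,_) (packWord-injective (k ∸ 1) j j′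
        (trans (sym (letters {P} {j} ne _ (index<n j′∈))) (trans (letters {P} {j′} ne′ _ (index<n j′∈)) (packWord-refl (k ∸ 1) j′))))

-- General position in Kneser graphs

∣p∪q∣+∣p∩q∣ : ∀ {n} (p q : Subset n) → ∣ p ∪ q ∣ + ∣ p ∩ q ∣ ≡ ∣ p ∣ + ∣ q ∣
∣p∪q∣+∣p∩q∣ []          []          = refl
∣p∪q∣+∣p∩q∣ (true ∷ p)  (true ∷ q)  = cong suc (trans (+-suc _ _) (trans (cong suc (∣p∪q∣+∣p∩q∣ p q)) (sym (+-suc _ _))))
∣p∪q∣+∣p∩q∣ (true ∷ p)  (false ∷ q) = cong suc (∣p∪q∣+∣p∩q∣ p q)
∣p∪q∣+∣p∩q∣ (false ∷ p) (true ∷ q)  = trans (cong suc (∣p∪q∣+∣p∩q∣ p q)) (sym (+-suc _ _))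
∣p∪q∣+∣p∩q∣ (false ∷ p) (false ∷ q) = ∣p∪q∣+∣p∩q∣ p q

Empty⇒∣∣≡0 : ∀ {n} {p : Subset n} → Empty p → ∣ p ∣ ≡ 0
Empty⇒∣∣≡0 {n} e = trans (cong ∣_∣ (Sub.Empty-unique e)) (Sub.∣⊥∣≡0 n)

∣∣>0⇒Nonempty : ∀ {n} {p : Subset n} → 0 < ∣ p ∣ → Nonempty p
∣∣>0⇒Nonempty {p = p} 0< with Sub.nonempty? p
... | yes ne = ne
... | no  e  = contradiction (Empty⇒∣∣≡0 e) (≢-sym (<⇒≢ 0<))

disjoint-∪ : ∀ {n} {p q : Subset n} → Empty (p ∩ q) → ∣ p ∪ q ∣ ≡ ∣ p ∣ + ∣ q ∣
disjoint-∪ {p = p} {q} e = trans (sym (+-identityʳ _)) (trans (cong (∣ p ∪ q ∣ +_) (sym (Empty⇒∣∣≡0 e))) (∣p∪q∣+∣p∩q∣ p q))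

disjoint-≤ : ∀ {n} {p q r : Subset n} → Empty (p ∩ q) → p ⊆ r → q ⊆ r → ∣ p ∣ + ∣ q ∣ ≤ ∣ r ∣
disjoint-≤ {p = p} {q} e p⊆ q⊆ = ≤-trans (≤-reflexive (sym (disjoint-∪ e)))
  (Sub.p⊆q⇒∣p∣≤∣q∣ (λ x∈ → case Sub.x∈p∪q⁻ p q x∈ of λ { (inj₁ x∈p) → p⊆ x∈p ; (inj₂ x∈q) → q⊆ x∈q }))

disjoint-≤n : ∀ {n} {p q : Subset n} → Empty (p ∩ q) → ∣ p ∣ + ∣ q ∣ ≤ n
disjoint-≤n {n} {p} {q} e = ≤-trans (≤-reflexive (sym (disjoint-∪ e))) (Sub.∣p∣≤n (p ∪ q))

Empty-sym : ∀ {n} {p q : Subset n} → Empty (p ∩ q) → Empty (q ∩ p)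
Empty-sym e m = e (Meet-sym m)

Empty-∪ : ∀ {n} {p q r : Subset n} → Empty (p ∩ r) → Empty (q ∩ r) → Empty ((p ∪ q) ∩ r)
Empty-∪ {p = p} {q} {r} e e′ (x , x∈) with Sub.x∈p∩q⁻ (p ∪ q) r x∈
... | x∈∪ , x∈r with Sub.x∈p∪q⁻ p q x∈∪
...   | inj₁ x∈p = e (x , Sub.x∈p∩q⁺ (x∈p , x∈r))
...   | inj₂ x∈q = e′ (x , Sub.x∈p∩q⁺ (x∈q , x∈r))

Empty-⊆ : ∀ {n} {p q p′ q′ : Subset n} → p′ ⊆ p → q′ ⊆ q → Empty (p ∩ q) → Empty (p′ ∩ q′)
Empty-⊆ {p′ = p′} {q′} p⊆ q⊆ e (x , x∈) = e (x , Sub.x∈p∩q⁺ (p⊆ (proj₁ (Sub.x∈p∩q⁻ p′ q′ x∈)) , q⊆ (proj₂ (Sub.x∈p∩q⁻ p′ q′ x∈))))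

∣a∩f∣+∣a∩d∣≤∣a∣ : ∀ {n} {a f d : Subset n} → Empty (f ∩ d) → ∣ a ∩ f ∣ + ∣ a ∩ d ∣ ≤ ∣ a ∣
∣a∩f∣+∣a∩d∣≤∣a∣ {a = a} {f} {d} e = disjoint-≤ (Empty-⊆ (Sub.p∩q⊆q a f) (Sub.p∩q⊆q a d) e) (Sub.p∩q⊆p a f) (Sub.p∩q⊆p a d)

interpolate : ∀ {n} (p q : Subset n) m → p ⊆ q → ∣ p ∣ ≤ m → m ≤ ∣ q ∣ → ∃ λ r → p ⊆ r × r ⊆ q × ∣ r ∣ ≡ m
interpolate []          []          zero    _   _         _         = [] , (λ ()) , (λ ()) , refl
interpolate (true ∷ p)  (false ∷ q) m       p⊆q _         _         with () ← p⊆q Vec.here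
interpolate (true ∷ p)  (true ∷ q)  (suc m) p⊆q (s≤s p≤m) (s≤s m≤q) with interpolate p q m (Sub.drop-∷-⊆ p⊆q) p≤m m≤q
... | r , p⊆r , r⊆q , eq = true ∷ r , Sub.s⊆s p⊆r , Sub.s⊆s r⊆q , cong suc eq
interpolate (false ∷ p) (false ∷ q) m       p⊆q p≤m       m≤q       with interpolate p q m (Sub.drop-∷-⊆ p⊆q) p≤m m≤q
... | r , p⊆r , r⊆q , eq = false ∷ r , Sub.s⊆s p⊆r , Sub.s⊆s r⊆q , eq
interpolate (false ∷ p) (true ∷ q)  m       p⊆q p≤m       m≤q       with m ≤? ∣ q ∣
... | yes m≤q′ with interpolate p q m (Sub.drop-∷-⊆ p⊆q) p≤m m≤q′
...   | r , p⊆r , r⊆q , eq = false ∷ r , Sub.s⊆s p⊆r , Sub.out⊆ r⊆q , eq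
interpolate (false ∷ p) (true ∷ q)  m       p⊆q p≤m       m≤q       | no m≰q = true ∷ q , Sub.out⊆ (Sub.drop-∷-⊆ p⊆q) , Sub.⊆-refl , ≤-antisym (≰⇒> m≰q) m≤q

avoiding : ∀ {n} (a : Subset n) k → ∣ a ∣ + k ≤ n → ∃ λ r → ∣ r ∣ ≡ k × Empty (a ∩ r)
avoiding {n} a k le with interpolate ∅ (∁ a) k (Sub.⊆-min _) (≤-trans (≤-reflexive (Sub.∣⊥∣≡0 n)) z≤n)
                          (≤-trans (m+n≤o⇒n≤o∸m {∣ a ∣} le) (≤-reflexive (sym (Sub.∣∁p∣≡n∸∣p∣ a))))
... | r , _ , r⊆ , eq = r , eq , λ { (x , x∈) → Sub.x∈∁p⇒x∉p (r⊆ (proj₂ (Sub.x∈p∩q⁻ a r x∈))) (proj₁ (Sub.x∈p∩q⁻ a r x∈)) }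

commonNeighbour : ∀ {n} (a d : Subset n) k → ∣ a ∪ d ∣ + k ≤ n → ∃ λ r → ∣ r ∣ ≡ k × Empty (a ∩ r) × Empty (r ∩ d)
commonNeighbour a d k le with avoiding (a ∪ d) k le
... | r , eq , e = r , eq , Empty-⊆ (Sub.p⊆p∪q d) Sub.⊆-refl e , Empty-sym (Empty-⊆ (Sub.q⊆p∪q a d) Sub.⊆-refl e)

-- The shape that general position takes for families of k-sets, according to the
-- length 2, 3 or 4 of the geodesics involved.
record GeneralPositionFamily (n k : ℕ) (G : List (Subset n)) : Set where
  field
    size      : ∀ {A} → A ∈ₗ G → ∣ A ∣ ≡ k
    geodesic₂ : ∀ {A B D} → A ∈ₗ G → B ∈ₗ G → D ∈ₗ G → A ≢ D → Empty (A ∩ B) → Empty (B ∩ D) → Meet A D → ⊥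
    geodesic₃ : ∀ {A B D} → A ∈ₗ G → B ∈ₗ G → D ∈ₗ G → A ≢ B → ∣ A ∪ B ∣ + k ≤ n → Empty (B ∩ D) →
                Meet A D → n < ∣ A ∪ D ∣ + k → ⊥
    geodesic₄ : ∀ {A B D} → A ∈ₗ G → B ∈ₗ G → D ∈ₗ G → A ≢ B → B ≢ D → ∣ A ∪ B ∣ + k ≤ n → ∣ B ∪ D ∣ + k ≤ n →
                n < ∣ A ∪ D ∣ + k → n < k + k + ∣ A ∩ D ∣ → ⊥

module _ {n k : ℕ} (0<k : 0 < k) (2k≤n : k + k ≤ n) where

  private
    KG : Graph
    KG = Kneser n k

    V : Set
    V = Graph.V KG

  walk₁ : {a d : V} → Walk KG a d 1 → Empty (proj₁ a ∩ proj₁ d)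
  walk₁ (e ∷ []) = e

  walk₂ : {a d : V} → Walk KG a d 2 → ∣ proj₁ a ∪ proj₁ d ∣ + k ≤ n
  walk₂ {a , _} {d , _} (_∷_ {y = r , ∣r∣≡k} e (e′ ∷ [])) =
    subst (λ z → ∣ a ∪ d ∣ + z ≤ n) ∣r∣≡k (disjoint-≤n {p = a ∪ d} {r} (Empty-∪ e (Empty-sym e′)))

  -- The last inner vertex `f` is disjoint from `d`, so `a` has room for at most `k - ∣ a ∩ d ∣`
  -- points of `f`. On the other hand `a` and `f` have a common neighbour, so their union has at
  -- most `n - k` points.
  walk₃ : {a d : V} → Walk KG a d 3 → k + k + ∣ proj₁ a ∩ proj₁ d ∣ ≤ n
  walk₃ {a , ∣a∣≡k} {d , _} (_∷_ {y = r} e (_∷_ {y = f , ∣f∣≡k} e′ (e″ ∷ []))) = begin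
    k + k + ∣ a ∩ d ∣                  ≡⟨ cong₂ (λ x y → x + y + ∣ a ∩ d ∣) ∣a∣≡k ∣f∣≡k ⟨
    ∣ a ∣ + ∣ f ∣ + ∣ a ∩ d ∣          ≡⟨ cong (_+ ∣ a ∩ d ∣) (∣p∪q∣+∣p∩q∣ a f) ⟨
    ∣ a ∪ f ∣ + ∣ a ∩ f ∣ + ∣ a ∩ d ∣  ≡⟨ +-assoc ∣ a ∪ f ∣ _ _ ⟩
    ∣ a ∪ f ∣ + (∣ a ∩ f ∣ + ∣ a ∩ d ∣) ≤⟨ +-monoʳ-≤ ∣ a ∪ f ∣ (∣a∩f∣+∣a∩d∣≤∣a∣ {a = a} {f} {d} e″) ⟩
    ∣ a ∪ f ∣ + ∣ a ∣                  ≡⟨ cong (∣ a ∪ f ∣ +_) ∣a∣≡k ⟩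
    ∣ a ∪ f ∣ + k                      ≤⟨ walk₂ {a , ∣a∣≡k} {f , ∣f∣≡k} (_∷_ {y = r} e (e′ ∷ [])) ⟩
    n                                  ∎
    where open ≤-Reasoning

  disjoint⇒≢ : {s t : V} → Empty (proj₁ s ∩ proj₁ t) → s ≢ t
  disjoint⇒≢ {s , ∣s∣≡k} e refl = e (∣∣>0⇒Nonempty (subst (0 <_) (trans (sym ∣s∣≡k) (cong ∣_∣ (sym (Sub.∩-idem s)))) 0<k))

  -- A set has a common neighbour with itself because `2 k ≤ n`.
  far⇒≢ : {s t : V} → n < ∣ proj₁ s ∪ proj₁ t ∣ + k → s ≢ t
  far⇒≢ {s , ∣s∣≡k} n< refl = <⇒≱ n< (subst (λ z → z + k ≤ n) (trans (sym ∣s∣≡k) (cong ∣_∣ (sym (Sub.∪-idem s)))) 2k≤n)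

  -- Small unions supply the common neighbours that complete a walk through the middle set, and
  -- `walk₁`, `walk₂` and `walk₃` rule out shorter walks between its ends.
  generalPositionFamily : (S : List V) → GeneralPosition KG S → GeneralPositionFamily n k (map proj₁ S)
  generalPositionFamily S gp = record
    { size      = λ A∈ → case ∈ₗ.∈-map⁻ proj₁ A∈ of λ { ((_ , eq) , _ , refl) → eq }
    ; geodesic₂ = λ A∈ B∈ D∈ → lift A∈ B∈ D∈ g₂
    ; geodesic₃ = λ A∈ B∈ D∈ → lift A∈ B∈ D∈ g₃
    ; geodesic₄ = λ A∈ B∈ D∈ → lift A∈ B∈ D∈ g₄ }
    where
    lift : ∀ {A B D} {T : Subset n → Subset n → Subset n → Set} → A ∈ₗ map proj₁ S → B ∈ₗ map proj₁ S → D ∈ₗ map proj₁ S →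
           (∀ {a b d : V} → a ∈ₗ S → b ∈ₗ S → d ∈ₗ S → T (proj₁ a) (proj₁ b) (proj₁ d)) → T A B D
    lift A∈ B∈ D∈ f with ∈ₗ.∈-map⁻ proj₁ A∈ | ∈ₗ.∈-map⁻ proj₁ B∈ | ∈ₗ.∈-map⁻ proj₁ D∈
    ... | _ , a∈ , refl | _ , b∈ , refl | _ , d∈ , refl = f a∈ b∈ d∈
    g₂ : ∀ {a b d : V} → a ∈ₗ S → b ∈ₗ S → d ∈ₗ S → proj₁ a ≢ proj₁ d → Empty (proj₁ a ∩ proj₁ b) → Empty (proj₁ b ∩ proj₁ d) →
         Meet (proj₁ a) (proj₁ d) → ⊥
    g₂ {a} {b} {d} a∈ b∈ d∈ a≢d e e′ meet = gp a∈ d∈ b∈ (λ b≡a → disjoint⇒≢ {a} {b} e (sym b≡a)) (disjoint⇒≢ {b} {d} e′)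
      (2 , e ∷ e′ ∷ [] , shortest , there here)
      where
      shortest : ∀ m → Walk KG a d m → 2 ≤ m
      shortest 0 [] = contradiction refl a≢d
      shortest 1 w  = contradiction meet (walk₁ w)
      shortest (suc (suc m)) _ = s≤s (s≤s z≤n)
    g₃ : ∀ {a b d : V} → a ∈ₗ S → b ∈ₗ S → d ∈ₗ S → proj₁ a ≢ proj₁ b → ∣ proj₁ a ∪ proj₁ b ∣ + k ≤ n →
         Empty (proj₁ b ∩ proj₁ d) → Meet (proj₁ a) (proj₁ d) → n < ∣ proj₁ a ∪ proj₁ d ∣ + k → ⊥
    g₃ {a} {b} {d} a∈ b∈ d∈ a≢b near e meet far with commonNeighbour (proj₁ a) (proj₁ b) k near
    ... | r , ∣r∣≡k , ar , rb = gp a∈ d∈ b∈ (λ b≡a → a≢b (cong proj₁ (sym b≡a))) (disjoint⇒≢ {b} {d} e)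
      (3 , _∷_ {y = r , ∣r∣≡k} ar (rb ∷ e ∷ []) , shortest , there (there here))
      where
      shortest : ∀ m → Walk KG a d m → 3 ≤ m
      shortest 0 [] = contradiction refl (far⇒≢ {a} {a} far)
      shortest 1 w  = contradiction meet (walk₁ w)
      shortest 2 w  = contradiction (walk₂ w) (<⇒≱ far)
      shortest (suc (suc (suc m))) _ = s≤s (s≤s (s≤s z≤n))
    g₄ : ∀ {a b d : V} → a ∈ₗ S → b ∈ₗ S → d ∈ₗ S → proj₁ a ≢ proj₁ b → proj₁ b ≢ proj₁ d → ∣ proj₁ a ∪ proj₁ b ∣ + k ≤ n →
         ∣ proj₁ b ∪ proj₁ d ∣ + k ≤ n → n < ∣ proj₁ a ∪ proj₁ d ∣ + k → n < k + k + ∣ proj₁ a ∩ proj₁ d ∣ → ⊥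
    g₄ {a} {b} {d} a∈ b∈ d∈ a≢b b≢d near near′ far far₃
      with commonNeighbour (proj₁ a) (proj₁ b) k near | commonNeighbour (proj₁ b) (proj₁ d) k near′
    ... | r , ∣r∣≡k , ar , rb | r′ , ∣r′∣≡k , br′ , r′d = gp a∈ d∈ b∈ (λ b≡a → a≢b (cong proj₁ (sym b≡a))) (λ b≡d → b≢d (cong proj₁ b≡d))
      (4 , _∷_ {y = r , ∣r∣≡k} ar (rb ∷ _∷_ {y = r′ , ∣r′∣≡k} br′ (r′d ∷ [])) , shortest , there (there here))
      where
      meet : Meet (proj₁ a) (proj₁ d)
      meet = ∣∣>0⇒Nonempty (+-cancelˡ-< (k + k) 0 _ (≤-<-trans (≤-trans (≤-reflexive (+-identityʳ (k + k))) 2k≤n) far₃))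
      shortest : ∀ m → Walk KG a d m → 4 ≤ m
      shortest 0 [] = contradiction refl (far⇒≢ {a} {a} far)
      shortest 1 w  = contradiction meet (walk₁ w)
      shortest 2 w  = contradiction (walk₂ w) (<⇒≱ far)
      shortest 3 w  = contradiction (walk₃ w) (<⇒≱ far₃)
      shortest (suc (suc (suc (suc m)))) _ = s≤s (s≤s (s≤s (s≤s z≤n)))

-- Splitting a family into cliques

cliqueUnion : ∀ {n} k (L : List (Subset n)) → AllPairs (λ A B → Empty (A ∩ B)) L → (∀ {A} → A ∈ₗ L → ∣ A ∣ ≡ k) →
              ∃ λ p → ∣ p ∣ ≡ length L * k × (∀ A → (∀ {B} → B ∈ₗ L → Empty (A ∩ B)) → Empty (A ∩ p))
cliqueUnion {n} k []      _        _    = ∅ , Sub.∣⊥∣≡0 n , λ A _ (x , x∈) → Sub.∉⊥ (proj₂ (Sub.x∈p∩q⁻ A _ x∈))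
cliqueUnion     k (A ∷ L) (h ∷ hs) size with cliqueUnion k L hs (λ P∈ → size (there P∈))
... | p , ∣p∣≡ , disj = A ∪ p , trans (disjoint-∪ (disj A (All.lookup h))) (cong₂ _+_ (size (here refl)) ∣p∣≡) ,
  λ B hB → Empty-sym (Empty-∪ (Empty-sym (hB (here refl))) (Empty-sym (disj B (λ B∈ → hB (there B∈)))))

clique-≤ : ∀ {n} k {L : List (Subset n)} → AllPairs (λ A B → Empty (A ∩ B)) L → (∀ {A} → A ∈ₗ L → ∣ A ∣ ≡ k) → length L * k ≤ n
clique-≤ k h size with cliqueUnion k _ h size
... | p , ∣p∣≡ , _ = subst (_≤ _) ∣p∣≡ (Sub.∣p∣≤n p)

length-filter-¬ : ∀ {A : Set} {P : A → Set} (P? : ∀ x → Dec (P x)) xs →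
                  length xs ≡ length (filter P? xs) + length (filter (λ x → ¬? (P? x)) xs)
length-filter-¬ P? []       = refl
length-filter-¬ P? (x ∷ xs) with P? x
... | yes _ = cong suc (length-filter-¬ P? xs)
... | no  _ = trans (cong suc (length-filter-¬ P? xs)) (sym (+-suc _ _))

allPairs-∈ : ∀ {A : Set} {R : A → A → Set} {xs} → Unique xs → (∀ {x y} → x ∈ₗ xs → y ∈ₗ xs → x ≢ y → R x y) → AllPairs R xs
allPairs-∈ []      h = []
allPairs-∈ (p ∷ u) h = All.tabulate (λ y∈ → h (here refl) (there y∈) (All.lookup p y∈)) ∷ allPairs-∈ u (λ x∈ y∈ → h (there x∈) (there y∈))

unique-map : ∀ {A B : Set} {f : A → B} {xs} → Unique xs → (∀ {x y} → x ∈ₗ xs → y ∈ₗ xs → f x ≡ f y → x ≡ y) → Unique (map f xs)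
unique-map u inj = AllPairs.map⁺ (allPairs-∈ u (λ x∈ y∈ x≢y fx≡fy → x≢y (inj x∈ y∈ fx≡fy)))

disjoint? : ∀ {n} (A B : Subset n) → Dec (Empty (A ∩ B))
disjoint? A B = ¬? (Sub.nonempty? (A ∩ B))

Cross : ∀ {n} → Subset n × Subset n → Subset n × Subset n → Set
Cross (X , Y) (X′ , Y′) = Meet X X′ × Meet Y Y′ × Meet X Y′ × Meet Y X′

-- F collects the sets meeting all others, M one pair from every clique with at least two members.
record Decomposition {n : ℕ} (l : ℕ) (G : List (Subset n)) : Set where
  field
    F      : List (Subset n)
    M      : List (Subset n × Subset n)
    F⊆     : ∀ {P} → P ∈ₗ F → P ∈ₗ G
    M⊆     : ∀ {p} → p ∈ₗ M → proj₁ p ∈ₗ G × proj₂ p ∈ₗ G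
    uF     : Unique F
    uM     : Unique M
    disj   : ∀ {p} → p ∈ₗ M → Empty (proj₁ p ∩ proj₂ p)
    meetF  : ∀ {P Q} → P ∈ₗ F → Q ∈ₗ F → Meet P Q
    meetFM : ∀ {P p} → P ∈ₗ F → p ∈ₗ M → Meet P (proj₁ p) × Meet P (proj₂ p)
    meetM  : ∀ {p q} → p ∈ₗ M → q ∈ₗ M → p ≡ q ⊎ Cross p q
    len    : length G ≤ length F + l * length M

module _ {n k l : ℕ} (0<k : 0 < k) (l≥ : ∀ m → m * k ≤ n → m ≤ l) where

  -- The sets disjoint from `A` form a clique with it, and the remaining sets meet both `A` and its
  -- chosen partner. The recursion goes to a filtered list, hence the fuel.
  decompose′ : ∀ fuel (G : List (Subset n)) → length G ≤ fuel → Unique G → (∀ {A} → A ∈ₗ G → ∣ A ∣ ≡ k) →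
    (∀ {A B D} → A ∈ₗ G → B ∈ₗ G → D ∈ₗ G → A ≢ D → Empty (A ∩ B) → Empty (B ∩ D) → Meet A D → ⊥) → Decomposition l G
  decompose′ fuel [] _ _ _ _ = record
    { F = [] ; M = [] ; F⊆ = λ () ; M⊆ = λ () ; uF = [] ; uM = [] ; disj = λ () ; meetF = λ () ; meetFM = λ ()
    ; meetM = λ () ; len = z≤n }
  decompose′ (suc fuel) (A ∷ G) (s≤s |G|≤) (A∉ ∷ uG) size p₃ with filter (disjoint? A) G in eqAdj
  ... | [] = record
    { F = A ∷ F ; M = M
    ; F⊆ = λ { (here refl) → here refl ; (there P∈) → there (F⊆ P∈) }
    ; M⊆ = λ p∈ → there (proj₁ (M⊆ p∈)) , there (proj₂ (M⊆ p∈))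
    ; uF = All.tabulate (λ P∈ → All.lookup A∉ (F⊆ P∈)) ∷ uF ; uM = uM ; disj = disj
    ; meetF = λ { (here refl) (here refl) → self ; (here refl) (there Q∈) → meetA (F⊆ Q∈)
                ; (there P∈) (here refl) → Meet-sym (meetA (F⊆ P∈)) ; (there P∈) (there Q∈) → meetF P∈ Q∈ }
    ; meetFM = λ { (here refl) p∈ → meetA (proj₁ (M⊆ p∈)) , meetA (proj₂ (M⊆ p∈)) ; (there P∈) p∈ → meetFM P∈ p∈ }
    ; meetM = meetM ; len = s≤s len }
    where
    open Decomposition (decompose′ fuel G |G|≤ uG (λ P∈ → size (there P∈)) (λ a b c → p₃ (there a) (there b) (there c)))
    meetA : ∀ {B} → B ∈ₗ G → Meet A B
    meetA {B} B∈ with Sub.nonempty? (A ∩ B)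
    ... | yes m = m
    ... | no  e with () ← subst (B ∈ₗ_) eqAdj (∈ₗ.∈-filter⁺ (disjoint? A) B∈ e)
    self : Meet A A
    self = ∣∣>0⇒Nonempty (subst (0 <_) (trans (sym (size (here refl))) (cong ∣_∣ (sym (Sub.∩-idem A)))) 0<k)
  ... | B ∷ Bs = record
    { F = F ; M = (A , B) ∷ M
    ; F⊆ = λ P∈ → there (rest⊆ (F⊆ P∈))
    ; M⊆ = λ { (here refl) → here refl , there B∈ ; (there p∈) → there (rest⊆ (proj₁ (M⊆ p∈))) , there (rest⊆ (proj₂ (M⊆ p∈))) }
    ; uF = uF ; uM = All.tabulate (λ p∈ eq → All.lookup A∉ (rest⊆ (proj₁ (M⊆ p∈))) (cong proj₁ eq)) ∷ uM
    ; disj = λ { (here refl) → AB ; (there p∈) → disj p∈ }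
    ; meetF = meetF
    ; meetFM = λ { P∈ (here refl) → Meet-sym (meetA (F⊆ P∈)) , Meet-sym (meetB (F⊆ P∈)) ; P∈ (there p∈) → meetFM P∈ p∈ }
    ; meetM = λ { (here refl) (here refl) → inj₁ refl
                ; (here refl) (there q∈) → inj₂ (meetA (proj₁ (M⊆ q∈)) , meetB (proj₂ (M⊆ q∈)) , meetA (proj₂ (M⊆ q∈)) , meetB (proj₁ (M⊆ q∈)))
                ; (there p∈) (here refl) → inj₂ (Meet-sym (meetA (proj₁ (M⊆ p∈))) , Meet-sym (meetB (proj₂ (M⊆ p∈))) ,
                                                 Meet-sym (meetB (proj₁ (M⊆ p∈))) , Meet-sym (meetA (proj₂ (M⊆ p∈))))
                ; (there p∈) (there q∈) → meetM p∈ q∈ }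
    ; len = len′ }
    where
    adj rest : List (Subset n)
    adj  = filter (disjoint? A) G
    rest = filter (λ B → ¬? (disjoint? A B)) G
    rest⊆ : ∀ {P} → P ∈ₗ rest → P ∈ₗ G
    rest⊆ P∈ = proj₁ (∈ₗ.∈-filter⁻ (λ B → ¬? (disjoint? A B)) {xs = G} P∈)
    adj⊆ : ∀ {P} → P ∈ₗ adj → P ∈ₗ G × Empty (A ∩ P)
    adj⊆ P∈ = ∈ₗ.∈-filter⁻ (disjoint? A) {xs = G} P∈
    B∈adj : B ∈ₗ adj
    B∈adj = subst (B ∈ₗ_) (sym eqAdj) (here refl)
    B∈ : B ∈ₗ G
    B∈ = proj₁ (adj⊆ B∈adj)
    AB : Empty (A ∩ B)
    AB = proj₂ (adj⊆ B∈adj)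
    |rest|≤ : length rest ≤ fuel
    |rest|≤ = ≤-trans (List.length-filter (λ B → ¬? (disjoint? A B)) G) |G|≤
    open Decomposition (decompose′ fuel rest |rest|≤ (Unique.filter⁺ (λ B → ¬? (disjoint? A B)) uG) (λ P∈ → size (there (rest⊆ P∈)))
      (λ a b c → p₃ (there (rest⊆ a)) (there (rest⊆ b)) (there (rest⊆ c))))
    meetA : ∀ {P} → P ∈ₗ rest → Meet A P
    meetA {P} P∈ with Sub.nonempty? (A ∩ P)
    ... | yes m = m
    ... | no  e = contradiction e (proj₂ (∈ₗ.∈-filter⁻ (λ B → ¬? (disjoint? A B)) {xs = G} P∈))
    meetB : ∀ {P} → P ∈ₗ rest → Meet B P
    meetB {P} P∈ with Sub.nonempty? (B ∩ P)
    ... | yes m = m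
    ... | no  e = ⊥-elim (p₃ (here refl) (there B∈) (there (rest⊆ P∈)) (All.lookup A∉ (rest⊆ P∈)) AB e (meetA P∈))
    clique : AllPairs (λ P Q → Empty (P ∩ Q)) (A ∷ adj)
    clique = All.tabulate (λ P∈ → proj₂ (adj⊆ P∈)) ∷ allPairs-∈ (Unique.filter⁺ (disjoint? A) uG)
      (λ P∈ Q∈ P≢Q → p₃ (there (proj₁ (adj⊆ P∈))) (here refl) (there (proj₁ (adj⊆ Q∈))) P≢Q (Empty-sym (proj₂ (adj⊆ P∈))) (proj₂ (adj⊆ Q∈)))
    clique≤l : length (A ∷ adj) ≤ l
    clique≤l = l≥ _ (clique-≤ k clique (λ { (here refl) → size (here refl) ; (there P∈) → size (there (proj₁ (adj⊆ P∈))) }))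
    len′ : length (A ∷ G) ≤ length F + l * length ((A , B) ∷ M)
    len′ = begin
      suc (length G)                     ≡⟨ cong suc (length-filter-¬ (disjoint? A) G) ⟩
      length (A ∷ adj) + length rest     ≤⟨ +-mono-≤ clique≤l len ⟩
      l + (length F + l * length M)      ≡⟨ solve 3 (λ l f m → l :+ (f :+ l :* m) := f :+ l :* (con 1 :+ m)) refl l (length F) (length M) ⟩
      length F + l * (1 + length M)      ∎
      where
      open ≤-Reasoning
      open +-*-Solver

  decompose : ∀ {G} → Unique G → GeneralPositionFamily n k G → Decomposition l G
  decompose {G} uG gp = decompose′ (length G) G ≤-refl uG (GeneralPositionFamily.size gp) (GeneralPositionFamily.geodesic₂ gp)

module DecompositionProperties {n l : ℕ} {G : List (Subset n)} (dec : Decomposition l G) where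
  open Decomposition dec

  compatible : ∀ {o o′} → o ∈ₗ map inj₁ F ++ map inj₂ M → o′ ∈ₗ map inj₁ F ++ map inj₂ M →
               (∀ {p} → p ∈ₗ M → Meet (proj₁ p) (proj₁ p) × Meet (proj₂ p) (proj₂ p)) → Compatible o o′
  compatible o∈ o′∈ self with ∈ₗ.∈-++⁻ (map inj₁ F) o∈ | ∈ₗ.∈-++⁻ (map inj₁ F) o′∈
  ... | inj₁ o∈F | inj₁ o′∈F with ∈ₗ.∈-map⁻ inj₁ o∈F | ∈ₗ.∈-map⁻ inj₁ o′∈F
  ...   | _ , P∈ , refl | _ , Q∈ , refl = meetF P∈ Q∈
  compatible o∈ o′∈ self | inj₁ o∈F | inj₂ o′∈M with ∈ₗ.∈-map⁻ inj₁ o∈F | ∈ₗ.∈-map⁻ inj₂ o′∈M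
  ... | _ , P∈ , refl | _ , q∈ , refl = meetFM P∈ q∈
  compatible o∈ o′∈ self | inj₂ o∈M | inj₁ o′∈F with ∈ₗ.∈-map⁻ inj₂ o∈M | ∈ₗ.∈-map⁻ inj₁ o′∈F
  ... | _ , p∈ , refl | _ , Q∈ , refl = meetFM Q∈ p∈
  compatible o∈ o′∈ self | inj₂ o∈M | inj₂ o′∈M with ∈ₗ.∈-map⁻ inj₂ o∈M | ∈ₗ.∈-map⁻ inj₂ o′∈M
  ... | _ , p∈ , refl | _ , q∈ , refl with meetM p∈ q∈
  ...   | inj₁ refl = proj₁ (self p∈) , proj₂ (self p∈) , inj₁ refl
  ...   | inj₂ (XX , YY , XY , YX) = XX , YY , inj₂ (XY , YX)

  unique-fst : Unique (map proj₁ M)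
  unique-fst = unique-map uM λ { {p} {q} p∈ q∈ eq → case meetM p∈ q∈ of λ
    { (inj₁ p≡q) → p≡q ; (inj₂ (_ , _ , XY , _)) → contradiction (subst (λ z → Meet z (proj₂ q)) eq XY) (disj q∈) } }

  unique-snd : Unique (map proj₂ M)
  unique-snd = unique-map uM λ { {p} {q} p∈ q∈ eq → case meetM p∈ q∈ of λ
    { (inj₁ p≡q) → p≡q ; (inj₂ (_ , _ , XY , _)) → contradiction (subst (Meet (proj₁ p)) (sym eq) XY) (disj p∈) } }

  -- One member of every clique.
  H : List (Subset n)
  H = F ++ map proj₁ M

  ∈H : ∀ {P} → P ∈ₗ H → P ∈ₗ F ⊎ ∃ λ p → p ∈ₗ M × P ≡ proj₁ p
  ∈H P∈ with ∈ₗ.∈-++⁻ F P∈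
  ... | inj₁ P∈F = inj₁ P∈F
  ... | inj₂ P∈M = inj₂ (∈ₗ.∈-map⁻ proj₁ P∈M)

  H⊆ : ∀ {P} → P ∈ₗ H → P ∈ₗ G
  H⊆ P∈ with ∈H P∈
  ... | inj₁ P∈F            = F⊆ P∈F
  ... | inj₂ (p , p∈ , refl) = proj₁ (M⊆ p∈)

  unique-H : Unique H
  unique-H = Unique.++⁺ uF unique-fst λ { (P∈F , P∈M) → case ∈ₗ.∈-map⁻ proj₁ P∈M of λ
    { (p , p∈ , refl) → disj p∈ (proj₂ (meetFM P∈F p∈)) } }

  meet-H : (∀ {P} → P ∈ₗ G → Meet P P) → ∀ {P Q} → P ∈ₗ H → Q ∈ₗ H → Meet P Q
  meet-H self P∈ Q∈ with ∈H P∈ | ∈H Q∈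
  ... | inj₁ P∈F            | inj₁ Q∈F            = meetF P∈F Q∈F
  ... | inj₁ P∈F            | inj₂ (q , q∈ , refl) = proj₁ (meetFM P∈F q∈)
  ... | inj₂ (p , p∈ , refl) | inj₁ Q∈F            = Meet-sym (proj₁ (meetFM Q∈F p∈))
  ... | inj₂ (p , p∈ , refl) | inj₂ (q , q∈ , refl) with meetM p∈ q∈
  ...   | inj₁ refl     = self (proj₁ (M⊆ p∈))
  ...   | inj₂ (XX , _) = XX

  -- Both members of every pair. Unlike `H` this list need not be intersecting; it is made for the
  -- packing bound, which asks only that no two members share `k ∸ 1` points.
  T : List (Subset n)
  T = map proj₁ M ++ map proj₂ M

  unique-T : (∀ {P} → P ∈ₗ G → Meet P P) → Unique T
  unique-T self = Unique.++⁺ unique-fst unique-snd apart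
    where
    apart : ∀ {P} → ¬ (P ∈ₗ map proj₁ M × P ∈ₗ map proj₂ M)
    apart (P∈ , P∈′) with ∈ₗ.∈-map⁻ proj₁ P∈ | ∈ₗ.∈-map⁻ proj₂ P∈′
    ... | p , p∈ , refl | q , q∈ , eq with meetM p∈ q∈
    ...   | inj₁ refl     = disj p∈ (subst (Meet (proj₁ p)) eq (self (proj₁ (M⊆ p∈))))
    ...   | inj₂ (XX , _) = disj q∈ (Meet-sym (subst (λ z → Meet z (proj₁ q)) eq XX))

  partner : ∀ {P} → P ∈ₗ T → P ∈ₗ G × ∃ λ Q → Q ∈ₗ G × Empty (P ∩ Q)
  partner P∈ with ∈ₗ.∈-++⁻ (map proj₁ M) P∈
  ... | inj₁ P∈₁ with ∈ₗ.∈-map⁻ proj₁ P∈₁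
  ...   | p , p∈ , refl = proj₁ (M⊆ p∈) , proj₂ p , proj₂ (M⊆ p∈) , disj p∈
  partner P∈ | inj₂ P∈₂ with ∈ₗ.∈-map⁻ proj₂ P∈₂
  ... | p , p∈ , refl = proj₂ (M⊆ p∈) , proj₁ p , proj₁ (M⊆ p∈) , Empty-sym (disj p∈)

-- Binomial estimates

infixl 7 _⊹_

-- With `n ∸ 1 = j + d` no truncated subtraction occurs, and the ratios of neighbouring coefficients
-- are simple fractions in `j` and `d`.
_⊹_ : ℕ → ℕ → ℕ
j ⊹ d = (j + d) C j

⊹-! : ∀ j d → (j ⊹ d) * (j ! * d !) ≡ (j + d) !
⊹-! j d = trans (cong (λ z → (j ⊹ d) * (j ! * z !)) (sym (m+n∸m≡n j d))) (nCk*k!*[n∸k]!≡n! (m≤m+n j d))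

⊹-sucʳ : ∀ j d → (j ⊹ suc d) * suc d ≡ suc (j + d) * (j ⊹ d)
⊹-sucʳ j d = *-cancelʳ-≡ _ _ (j ! * d !) {{j !* d !≢0}} (begin
  (j ⊹ suc d) * suc d * (j ! * d !)   ≡⟨ solve 4 (λ c s a b → c :* s :* (a :* b) := c :* (a :* (s :* b))) refl (j ⊹ suc d) (suc d) (j !) (d !) ⟩
  (j ⊹ suc d) * (j ! * suc d !)       ≡⟨ ⊹-! j (suc d) ⟩
  (j + suc d) !                       ≡⟨ cong _! (+-suc j d) ⟩
  suc (j + d) * (j + d) !             ≡⟨ cong (suc (j + d) *_) (⊹-! j d) ⟨
  suc (j + d) * ((j ⊹ d) * (j ! * d !)) ≡⟨ *-assoc (suc (j + d)) (j ⊹ d) (j ! * d !) ⟨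
  suc (j + d) * (j ⊹ d) * (j ! * d !) ∎)
  where
  open ≡-Reasoning
  open +-*-Solver

⊹-sucˡ : ∀ j d → (suc j ⊹ d) * suc j ≡ suc (j + d) * (j ⊹ d)
⊹-sucˡ j d = *-cancelʳ-≡ _ _ (j ! * d !) {{j !* d !≢0}} (begin
  (suc j ⊹ d) * suc j * (j ! * d !)   ≡⟨ solve 4 (λ c s a b → c :* s :* (a :* b) := c :* (s :* a :* b)) refl (suc j ⊹ d) (suc j) (j !) (d !) ⟩
  (suc j ⊹ d) * (suc j ! * d !)       ≡⟨ ⊹-! (suc j) d ⟩
  suc (j + d) * (j + d) !             ≡⟨ cong (suc (j + d) *_) (⊹-! j d) ⟨
  suc (j + d) * ((j ⊹ d) * (j ! * d !)) ≡⟨ *-assoc (suc (j + d)) (j ⊹ d) (j ! * d !) ⟨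
  suc (j + d) * (j ⊹ d) * (j ! * d !) ∎)
  where
  open ≡-Reasoning
  open +-*-Solver

-- Raising `d` by one multiplies the binomial coefficient by `(j + d + 1) / (d + 1)`, so it is
-- enough that the factor on the left grows by no more than this.
⊹-mono-step : ∀ j d w c {f f′} → f * w ≤ c * (j ⊹ d) → f′ * suc d ≤ f * suc (j + d) → f′ * w ≤ c * (j ⊹ suc d)
⊹-mono-step j d w c {f} {f′} ih f-step = *-cancelʳ-≤ _ _ (suc d) (begin
  f′ * w * suc d                  ≡⟨ solve 3 (λ a b e → a :* b :* e := a :* e :* b) refl f′ w (suc d) ⟩
  f′ * suc d * w                  ≤⟨ *-monoˡ-≤ w f-step ⟩
  f * suc (j + d) * w             ≡⟨ solve 3 (λ a b e → a :* b :* e := b :* (a :* e)) refl f (suc (j + d)) w ⟩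
  suc (j + d) * (f * w)           ≤⟨ *-monoʳ-≤ (suc (j + d)) ih ⟩
  suc (j + d) * (c * (j ⊹ d))     ≡⟨ solve 3 (λ a b e → a :* (b :* e) := b :* (a :* e)) refl (suc (j + d)) c (j ⊹ d) ⟩
  c * (suc (j + d) * (j ⊹ d))     ≡⟨ cong (c *_) (⊹-sucʳ j d) ⟨
  c * ((j ⊹ suc d) * suc d)       ≡⟨ *-assoc c (j ⊹ suc d) (suc d) ⟨
  c * (j ⊹ suc d) * suc d         ∎)
  where
  open ≤-Reasoning
  open +-*-Solver

≤-by : ∀ {a b} e → b ≡ a + e → a ≤ b
≤-by e eq = subst (_ ≤_) (sym eq) (m≤m+n _ e)

-- Towards n * W ≤ 2 * k * B, for j = k - 1, d = n - k, B = j ⊹ d and W = suc j ⊹ suc j.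
linear-step : ∀ j d → 1 ≤ j → suc (j + d) * (suc j ⊹ suc j) ≤ 2 * suc j * (j ⊹ d) →
              suc (j + suc d) * (suc j ⊹ suc j) ≤ 2 * suc j * (j ⊹ suc d)
linear-step (suc i) d _ ih = ⊹-mono-step (suc i) d (suc (suc i) ⊹ suc (suc i)) (2 * suc (suc i)) {suc (suc i + d)} {suc (suc i + suc d)} ih
  -- With `n = j + d + 1` this is `(n + 1) (n - j) ≤ n * n`, which `j ≥ 1` ensures.
  (≤-by (i * i + i * d + (1 + 3 * i)) (solve 2 (λ i d → (con 2 :+ i :+ d) :* (con 2 :+ i :+ d)
    := (con 1 :+ (con 1 :+ i :+ (con 1 :+ d))) :* (con 1 :+ d) :+ (i :* i :+ i :* d :+ (con 1 :+ con 3 :* i))) refl i d))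
  where open +-*-Solver

-- This is `n = 2 k + 2`. Both sides are multiples of `x`, and
-- `(j + 2)² (j + 3) ≤ (j + 1)² (2 j + 3)` remains. It is false for `j = 3`, which is the exception
-- `k = 4`, `n = 10`.
linear-base : ∀ i → let j = 4 + i in suc (j + (3 + j)) * (suc j ⊹ suc j) ≤ 2 * suc j * (j ⊹ (3 + j))
linear-base i = *-cancelʳ-≤ _ _ ((2 + j) * (3 + j)) (begin
  suc (j + (3 + j)) * (suc j ⊹ suc j) * ((2 + j) * (3 + j)) ≡⟨ cong (λ z → suc (j + (3 + j)) * z * ((2 + j) * (3 + j))) W≡ ⟩
  suc (j + (3 + j)) * (2 * x) * ((2 + j) * (3 + j))         ≡⟨ solve 2 (λ j x → (con 1 :+ (j :+ (con 3 :+ j))) :* (con 2 :* x) :* ((con 2 :+ j) :* (con 3 :+ j)) := con 4 :* x :* ((con 2 :+ j) :* (con 2 :+ j) :* (con 3 :+ j))) refl j x ⟩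
  4 * x * ((2 + j) * (2 + j) * (3 + j))                     ≤⟨ *-monoʳ-≤ (4 * x) poly≤ ⟩
  4 * x * ((1 + j) * (1 + j) * (3 + (j + j)))               ≡⟨ solve 2 (λ j x → con 4 :* x :* ((con 1 :+ j) :* (con 1 :+ j) :* (con 3 :+ (j :+ j))) := con 2 :* (con 1 :+ j) :* ((con 3 :+ (j :+ j)) :* ((con 2 :+ (j :+ j)) :* x))) refl j x ⟩
  2 * suc j * ((3 + (j + j)) * ((2 + (j + j)) * x))         ≡⟨ cong (2 * suc j *_) B≡ ⟨
  2 * suc j * ((j ⊹ (3 + j)) * ((2 + j) * (3 + j)))         ≡⟨ *-assoc (2 * suc j) (j ⊹ (3 + j)) ((2 + j) * (3 + j)) ⟨
  2 * suc j * (j ⊹ (3 + j)) * ((2 + j) * (3 + j))           ∎)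
  where
  open ≤-Reasoning
  open +-*-Solver
  j x : ℕ
  j = 4 + i
  x = j ⊹ suc j
  W≡ : suc j ⊹ suc j ≡ 2 * x
  W≡ = *-cancelʳ-≡ _ _ (suc j) (trans (⊹-sucˡ j (suc j)) (solve 2 (λ j x → (con 1 :+ (j :+ (con 1 :+ j))) :* x := con 2 :* x :* (con 1 :+ j)) refl j x))
  B≡ : (j ⊹ (3 + j)) * ((2 + j) * (3 + j)) ≡ (3 + (j + j)) * ((2 + (j + j)) * x)
  B≡ = begin-equality
    (j ⊹ (3 + j)) * ((2 + j) * (3 + j))            ≡⟨ solve 3 (λ b p q → b :* (p :* q) := b :* q :* p) refl (j ⊹ (3 + j)) (2 + j) (3 + j) ⟩
    (j ⊹ (3 + j)) * (3 + j) * (2 + j)              ≡⟨ cong (_* (2 + j)) (⊹-sucʳ j (2 + j)) ⟩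
    suc (j + (2 + j)) * (j ⊹ (2 + j)) * (2 + j)    ≡⟨ *-assoc (suc (j + (2 + j))) (j ⊹ (2 + j)) (2 + j) ⟩
    suc (j + (2 + j)) * ((j ⊹ (2 + j)) * (2 + j))  ≡⟨ cong (suc (j + (2 + j)) *_) (⊹-sucʳ j (1 + j)) ⟩
    suc (j + (2 + j)) * (suc (j + (1 + j)) * x)    ≡⟨ cong₂ (λ a b → a * (b * x)) (cong suc (trans (+-suc j (1 + j)) (cong suc (+-suc j j)))) (cong suc (+-suc j j)) ⟩
    (3 + (j + j)) * ((2 + (j + j)) * x)            ∎
  poly≤ : (2 + j) * (2 + j) * (3 + j) ≤ (1 + j) * (1 + j) * (3 + (j + j))
  poly≤ = ≤-by (23 + 40 * i + 12 * (i * i) + i * i * i) (solve 1 (λ i →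
    (con 5 :+ i) :* (con 5 :+ i) :* (con 3 :+ (con 4 :+ i :+ (con 4 :+ i)))
    := (con 6 :+ i) :* (con 6 :+ i) :* (con 7 :+ i) :+ (con 23 :+ con 40 :* i :+ con 12 :* (i :* i) :+ i :* i :* i)) refl i)

linear-bound : ∀ j e → 4 ≤ j → let d = e + (3 + j) in suc (j + d) * (suc j ⊹ suc j) ≤ 2 * suc j * (j ⊹ d)
linear-bound j zero    4≤j = subst (λ j → suc (j + (3 + j)) * (suc j ⊹ suc j) ≤ 2 * suc j * (j ⊹ (3 + j))) (m+[n∸m]≡n 4≤j) (linear-base (j ∸ 4))
linear-bound j (suc e) 4≤j = linear-step j (e + (3 + j)) (≤-trans (s≤s z≤n) 4≤j) (linear-bound j e 4≤j)

-- For `k = 4` the induction can begin only at `n = 11`, with `770 ≤ 960`.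
linear-bound₄ : ∀ e → let d = e + 7 in suc (3 + d) * (4 ⊹ 4) ≤ 2 * 4 * (3 ⊹ d)
linear-bound₄ zero    = m≤m+n 770 190
linear-bound₄ (suc e) = linear-step 3 (e + 7) (s≤s z≤n) (linear-bound₄ e)

-- Towards n * n * W ≤ 4 * k * k * B, in the same notation.
quadratic-base : ∀ i → let k = 4 + i in 9 * (k ⊹ k) ≤ 4 * ((3 + i) ⊹ (k + k))
-- For `k = 4` and `n = 12` the two sides are `9 * 70` and `4 * 165`; for `k = 3` they would be 180
-- and 112.
quadratic-base zero    = m≤m+n 630 30
-- From `k` to `k + 1` the left side grows by `2 (2 k + 1) / (k + 1)` and the right side by `3 (3 k
-- + 1) (3 k + 2) / ((2 k + 1) (2 k + 2))`; `poly≤` compares these ratios.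
quadratic-base (suc i) = *-cancelʳ-≤ _ _ (suc k * (suc (k + k) * (2 + (k + k)))) (begin
  9 * (suc k ⊹ suc k) * (suc k * (suc (k + k) * (2 + (k + k))))  ≡⟨ solve 4 (λ w s p q → con 9 :* w :* (s :* (p :* q)) := con 9 :* (w :* s) :* (p :* q)) refl (suc k ⊹ suc k) (suc k) (suc (k + k)) (2 + (k + k)) ⟩
  9 * ((suc k ⊹ suc k) * suc k) * (suc (k + k) * (2 + (k + k)))  ≡⟨ cong (λ z → 9 * z * (suc (k + k) * (2 + (k + k)))) W≡ ⟩
  9 * (2 * suc (k + k) * (k ⊹ k)) * (suc (k + k) * (2 + (k + k))) ≡⟨ solve 3 (λ w p q → con 9 :* (con 2 :* p :* w) :* (p :* q) := con 2 :* (p :* p) :* q :* (con 9 :* w)) refl (k ⊹ k) (suc (k + k)) (2 + (k + k)) ⟩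
  2 * (suc (k + k) * suc (k + k)) * (2 + (k + k)) * (9 * (k ⊹ k)) ≤⟨ *-mono-≤ poly≤ (quadratic-base i) ⟩
  3 * (suc (k + (k + k)) * (2 + (k + (k + k)))) * suc k * (4 * b) ≡⟨ solve 4 (λ b p q s → con 3 :* (p :* q) :* s :* (con 4 :* b) := con 4 :* (con 3 :* (p :* q) :* b) :* s) refl b (suc (k + (k + k))) (2 + (k + (k + k))) (suc k) ⟩
  4 * (3 * (suc (k + (k + k)) * (2 + (k + (k + k)))) * b) * suc k ≡⟨ cong (λ z → 4 * z * suc k) b≡ ⟨
  4 * ((k ⊹ (suc k + suc k)) * (suc (k + k) * (2 + (k + k)))) * suc k ≡⟨ solve 4 (λ b s p q → con 4 :* (b :* (p :* q)) :* s := con 4 :* b :* (s :* (p :* q))) refl (k ⊹ (suc k + suc k)) (suc k) (suc (k + k)) (2 + (k + k)) ⟩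
  4 * (k ⊹ (suc k + suc k)) * (suc k * (suc (k + k) * (2 + (k + k)))) ∎)
  where
  open ≤-Reasoning
  open +-*-Solver
  k b : ℕ
  k = 4 + i
  b = (3 + i) ⊹ (k + k)
  W≡ : (suc k ⊹ suc k) * suc k ≡ 2 * suc (k + k) * (k ⊹ k)
  W≡ = *-cancelʳ-≡ _ _ (suc k) (begin-equality
    (suc k ⊹ suc k) * suc k * suc k                  ≡⟨ cong (_* suc k) (⊹-sucˡ k (suc k)) ⟩
    suc (k + suc k) * (k ⊹ suc k) * suc k            ≡⟨ *-assoc (suc (k + suc k)) (k ⊹ suc k) (suc k) ⟩
    suc (k + suc k) * ((k ⊹ suc k) * suc k)          ≡⟨ cong (suc (k + suc k) *_) (⊹-sucʳ k k) ⟩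
    suc (k + suc k) * (suc (k + k) * (k ⊹ k))        ≡⟨ solve 2 (λ k w → (con 1 :+ (k :+ (con 1 :+ k))) :* ((con 1 :+ (k :+ k)) :* w) := con 2 :* (con 1 :+ (k :+ k)) :* w :* (con 1 :+ k)) refl k (k ⊹ k) ⟩
    2 * suc (k + k) * (k ⊹ k) * suc k                ∎)
  c≡ : k ⊹ (k + k) ≡ 3 * b
  c≡ = *-cancelʳ-≡ _ _ k (trans (⊹-sucˡ (3 + i) (k + k)) (solve 2 (λ k b → (k :+ (k :+ k)) :* b := con 3 :* b :* k) refl k b))
  b≡ : (k ⊹ (suc k + suc k)) * (suc (k + k) * (2 + (k + k))) ≡ 3 * (suc (k + (k + k)) * (2 + (k + (k + k)))) * b
  b≡ = begin-equality
    (k ⊹ (suc k + suc k)) * (suc (k + k) * (2 + (k + k)))        ≡⟨ cong (λ z → (k ⊹ suc z) * (suc (k + k) * (2 + (k + k)))) (+-suc k k) ⟩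
    (k ⊹ (2 + (k + k))) * (suc (k + k) * (2 + (k + k)))          ≡⟨ solve 3 (λ b p q → b :* (p :* q) := b :* q :* p) refl (k ⊹ (2 + (k + k))) (suc (k + k)) (2 + (k + k)) ⟩
    (k ⊹ (2 + (k + k))) * (2 + (k + k)) * suc (k + k)            ≡⟨ cong (_* suc (k + k)) (⊹-sucʳ k (1 + (k + k))) ⟩
    suc (k + (1 + (k + k))) * (k ⊹ (1 + (k + k))) * suc (k + k)  ≡⟨ *-assoc (suc (k + (1 + (k + k)))) (k ⊹ (1 + (k + k))) (suc (k + k)) ⟩
    suc (k + (1 + (k + k))) * ((k ⊹ (1 + (k + k))) * suc (k + k)) ≡⟨ cong (suc (k + (1 + (k + k))) *_) (trans (⊹-sucʳ k (k + k)) (cong (suc (k + (k + k)) *_) c≡)) ⟩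
    suc (k + (1 + (k + k))) * (suc (k + (k + k)) * (3 * b))      ≡⟨ solve 2 (λ k b → (con 1 :+ (k :+ (con 1 :+ (k :+ k)))) :* ((con 1 :+ (k :+ (k :+ k))) :* (con 3 :* b)) := con 3 :* ((con 1 :+ (k :+ (k :+ k))) :* (con 2 :+ (k :+ (k :+ k)))) :* b) refl k b ⟩
    3 * (suc (k + (k + k)) * (2 + (k + (k + k)))) * b            ∎
  poly≤ : 2 * (suc (k + k) * suc (k + k)) * (2 + (k + k)) ≤ 3 * (suc (k + (k + k)) * (2 + (k + (k + k)))) * suc k
  poly≤ = ≤-by ((11 * (k * k) + 11 * k + 2) * suc k) (solve 1 (λ k →
    con 3 :* ((con 1 :+ (k :+ (k :+ k))) :* (con 2 :+ (k :+ (k :+ k)))) :* (con 1 :+ k)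
    := con 2 :* ((con 1 :+ (k :+ k)) :* (con 1 :+ (k :+ k))) :* (con 2 :+ (k :+ k)) :+ (con 11 :* (k :* k) :+ con 11 :* k :+ con 2) :* (con 1 :+ k)) refl k)

-- Induction on `n` from `3 k` upwards. With `n = j + d + 1` the step is `(n + 1)² (n - j) ≤ n³`,
-- which holds for `j ≥ 3`.
quadratic-bound : ∀ i e → let j = 3 + i ; k = 4 + i ; d = e + (k + k) in
                  suc (j + d) * suc (j + d) * (k ⊹ k) ≤ 4 * k * k * (j ⊹ d)
quadratic-bound i zero = begin
  (k + (k + k)) * (k + (k + k)) * (k ⊹ k)  ≡⟨ solve 2 (λ k w → (k :+ (k :+ k)) :* (k :+ (k :+ k)) :* w := k :* k :* (con 9 :* w)) refl k (k ⊹ k) ⟩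
  k * k * (9 * (k ⊹ k))                    ≤⟨ *-monoʳ-≤ (k * k) (quadratic-base i) ⟩
  k * k * (4 * ((3 + i) ⊹ (k + k)))        ≡⟨ solve 2 (λ k b → k :* k :* (con 4 :* b) := con 4 :* k :* k :* b) refl k ((3 + i) ⊹ (k + k)) ⟩
  4 * k * k * ((3 + i) ⊹ (k + k))          ∎
  where
  open ≤-Reasoning
  open +-*-Solver
  k : ℕ
  k = 4 + i
quadratic-bound i (suc e) = ⊹-mono-step (3 + i) d (k ⊹ k) (4 * k * k) {n * n} {suc (3 + i + suc d) * suc (3 + i + suc d)} (quadratic-bound i e)
  (≤-by (n * n + 5 * n + 3 + i * ((1 + n) * (1 + n))) (solve 2 (λ i d →
    (con 4 :+ i :+ d) :* (con 4 :+ i :+ d) :* (con 4 :+ i :+ d)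
    := (con 1 :+ (con 3 :+ i :+ (con 1 :+ d))) :* (con 1 :+ (con 3 :+ i :+ (con 1 :+ d))) :* (con 1 :+ d)
       :+ ((con 4 :+ i :+ d) :* (con 4 :+ i :+ d) :+ con 5 :* (con 4 :+ i :+ d) :+ con 3 :+ i :* ((con 5 :+ i :+ d) :* (con 5 :+ i :+ d)))) refl i d))
  where
  open +-*-Solver
  k d n : ℕ
  k = 4 + i
  d = e + (k + k)
  n = 4 + i + d

-- The star

Vertex : ℕ → ℕ → Set
Vertex n k = Graph.V (Kneser n k)

withIn : ∀ {n k} → Vertex n k → Vertex (suc n) (suc k)
withIn (s , eq) = true ∷ s , cong suc eq

withOut : ∀ {n k} → Vertex n k → Vertex (suc n) k
withOut (s , eq) = false ∷ s , eq

vertices : ∀ n k → List (Vertex n k)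
vertices zero    zero    = ([] , refl) ∷ []
vertices zero    (suc k) = []
vertices (suc n) zero    = map withOut (vertices n zero)
vertices (suc n) (suc k) = map withIn (vertices n k) ++ map withOut (vertices n (suc k))

length-vertices : ∀ n k → length (vertices n k) ≡ n C k
length-vertices zero    zero    = refl
length-vertices zero    (suc k) = refl
length-vertices (suc n) zero    = trans (List.length-map withOut (vertices n 0)) (length-vertices n 0)
length-vertices (suc n) (suc k) = begin
  length (map withIn (vertices n k) ++ map withOut (vertices n (suc k)))
    ≡⟨ List.length-++ (map withIn (vertices n k)) ⟩
  length (map withIn (vertices n k)) + length (map withOut (vertices n (suc k)))
    ≡⟨ cong₂ _+_ (List.length-map withIn (vertices n k)) (List.length-map withOut (vertices n (suc k))) ⟩
  length (vertices n k) + length (vertices n (suc k))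
    ≡⟨ cong₂ _+_ (length-vertices n k) (length-vertices n (suc k)) ⟩
  n C k + n C suc k ≡⟨ nCk+nC[k+1]≡[n+1]C[k+1] n k ⟩
  suc n C suc k     ∎
  where open ≡-Reasoning

vertex-≡ : ∀ {n k} {s t : Vertex n k} → proj₁ s ≡ proj₁ t → s ≡ t
vertex-≡ {s = s , p} {_ , q} refl = cong (s ,_) (≡-irrelevant p q)

withIn-injective : ∀ {n k} {s t : Vertex n k} → withIn s ≡ withIn t → s ≡ t
withIn-injective eq = vertex-≡ (Vec.∷-injectiveʳ (cong proj₁ eq))

withOut-injective : ∀ {n k} {s t : Vertex n k} → withOut s ≡ withOut t → s ≡ t
withOut-injective eq = vertex-≡ (Vec.∷-injectiveʳ (cong proj₁ eq))

unique-vertices : ∀ n k → Unique (vertices n k)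
unique-vertices zero    zero    = [] ∷ []
unique-vertices zero    (suc k) = []
unique-vertices (suc n) zero    = Unique.map⁺ withOut-injective (unique-vertices n 0)
unique-vertices (suc n) (suc k) = Unique.++⁺ (Unique.map⁺ withIn-injective (unique-vertices n k))
  (Unique.map⁺ withOut-injective (unique-vertices n (suc k))) λ { (s∈ , s∈′) → apart s∈ s∈′ }
  where
  apart : ∀ {s} → s ∈ₗ map withIn (vertices n k) → s ∈ₗ map withOut (vertices n (suc k)) → ⊥
  apart s∈ s∈′ with ∈ₗ.∈-map⁻ withIn s∈ | ∈ₗ.∈-map⁻ withOut s∈′
  ... | _ , _ , refl | _ , _ , eq with () ← cong proj₁ eq

star : ∀ n k → List (Vertex (suc n) (suc k))
star n k = map withIn (vertices n k)

∈-star : ∀ {n k s} → s ∈ₗ star n k → zero ∈ proj₁ s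
∈-star s∈ with ∈ₗ.∈-map⁻ withIn s∈
... | _ , _ , refl = Vec.here

∣p∩q∣+∣p∩∁q∣ : ∀ {n} (p q : Subset n) → ∣ p ∩ q ∣ + ∣ p ∩ ∁ q ∣ ≡ ∣ p ∣
∣p∩q∣+∣p∩∁q∣ []          []          = refl
∣p∩q∣+∣p∩∁q∣ (true ∷ p)  (true ∷ q)  = cong suc (∣p∩q∣+∣p∩∁q∣ p q)
∣p∩q∣+∣p∩∁q∣ (true ∷ p)  (false ∷ q) = trans (+-suc _ _) (cong suc (∣p∩q∣+∣p∩∁q∣ p q))
∣p∩q∣+∣p∩∁q∣ (false ∷ p) (true ∷ q)  = ∣p∩q∣+∣p∩∁q∣ p q
∣p∩q∣+∣p∩∁q∣ (false ∷ p) (false ∷ q) = ∣p∩q∣+∣p∩∁q∣ p q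

module _ {n k : ℕ} (2k≤n : k + k ≤ n) (5k≤2n+1 : 5 * k ≤ 2 * n + 1) where

  private
    KG : Graph
    KG = Kneser n k

  -- Without a common neighbour, `x` and `y` share at most `3 k - n - 1` points. The threshold
  -- `5 k ≤ 2 n + 1` is what makes this at most `n - 2 k`, the bound that walks of length 3 need.
  far⇒few-common : (x y : Vertex n k) → n < ∣ proj₁ x ∪ proj₁ y ∣ + k → k + k + ∣ proj₁ x ∩ proj₁ y ∣ ≤ n
  far⇒few-common (x , ∣x∣≡k) (y , ∣y∣≡k) far = +-cancelʳ-≤ (suc n) _ _ (begin
    k + k + i + suc n           ≤⟨ +-monoʳ-≤ (k + k + i) far ⟩
    k + k + i + (u + k)         ≡⟨ solve 3 (λ k i u → k :+ k :+ i :+ (u :+ k) := k :+ k :+ k :+ (u :+ i)) refl k i u ⟩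
    k + k + k + (u + i)         ≡⟨ cong (k + k + k +_) (trans (∣p∪q∣+∣p∩q∣ x y) (cong₂ _+_ ∣x∣≡k ∣y∣≡k)) ⟩
    k + k + k + (k + k)         ≡⟨ solve 1 (λ k → k :+ k :+ k :+ (k :+ k) := con 5 :* k) refl k ⟩
    5 * k                       ≤⟨ 5k≤2n+1 ⟩
    2 * n + 1                   ≡⟨ solve 1 (λ n → con 2 :* n :+ con 1 := n :+ (con 1 :+ n)) refl n ⟩
    n + suc n                   ∎)
    where
    open ≤-Reasoning
    open +-*-Solver
    i u : ℕ
    i = ∣ x ∩ y ∣
    u = ∣ x ∪ y ∣

  walk≤3 : (x y : Vertex n k) → ∃ λ m → m ≤ 3 × Walk KG x y m
  walk≤3 X@(x , ∣x∣≡k) Y@(y , ∣y∣≡k) with ∣ x ∪ y ∣ + k ≤? n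
  ... | yes near with commonNeighbour x y k near
  ...   | r , ∣r∣≡k , xr , ry = 2 , s≤s (s≤s z≤n) , _∷_ {y = r , ∣r∣≡k} xr (ry ∷ [])
  -- The neighbour `c` of `y` is chosen to contain all of `x` outside `y`. This makes its union with
  -- `x` as small as possible, and so leaves room for a common neighbour of `x` and `c`.
  walk≤3 X@(x , ∣x∣≡k) Y@(y , ∣y∣≡k) | no far
    with interpolate (x ∩ ∁ y) (∁ y) k (Sub.p∩q⊆q x (∁ y)) (≤-trans (Sub.∣p∩q∣≤∣p∣ x (∁ y)) (≤-reflexive ∣x∣≡k))
           (≤-trans (m+n≤o⇒n≤o∸m {k} 2k≤n) (≤-reflexive (sym (trans (Sub.∣∁p∣≡n∸∣p∣ y) (cong (n ∸_) ∣y∣≡k)))))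
  ... | c , ⊆c , c⊆ , ∣c∣≡k with commonNeighbour x c k near
    where
    near : ∣ x ∪ c ∣ + k ≤ n
    near = ≤-trans (+-cancelʳ-≤ ∣ x ∩ c ∣ _ _ (begin
      ∣ x ∪ c ∣ + k + ∣ x ∩ c ∣                 ≡⟨ solve 3 (λ u k i → u :+ k :+ i := u :+ i :+ k) refl (∣ x ∪ c ∣) k (∣ x ∩ c ∣) ⟩
      ∣ x ∪ c ∣ + ∣ x ∩ c ∣ + k                 ≡⟨ cong (_+ k) (trans (∣p∪q∣+∣p∩q∣ x c) (cong₂ _+_ ∣x∣≡k ∣c∣≡k)) ⟩
      k + k + k                                 ≡⟨ cong (k + k +_) (trans (∣p∩q∣+∣p∩∁q∣ x y) ∣x∣≡k) ⟨
      k + k + (∣ x ∩ y ∣ + ∣ x ∩ ∁ y ∣)         ≡⟨ +-assoc (k + k) _ _ ⟨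
      k + k + ∣ x ∩ y ∣ + ∣ x ∩ ∁ y ∣           ≤⟨ +-monoʳ-≤ (k + k + ∣ x ∩ y ∣) (Sub.p⊆q⇒∣p∣≤∣q∣ (λ e∈ → Sub.x∈p∩q⁺ (Sub.p∩q⊆p x (∁ y) e∈ , ⊆c e∈))) ⟩
      k + k + ∣ x ∩ y ∣ + ∣ x ∩ c ∣             ∎)) (far⇒few-common X Y (≰⇒> far))
      where
      open ≤-Reasoning
      open +-*-Solver
  ...   | r , ∣r∣≡k , xr , rc = 3 , ≤-refl , _∷_ {y = r , ∣r∣≡k} xr (_∷_ {y = c , ∣c∣≡k} rc (cy ∷ []))
    where
    cy : Empty (c ∩ y)
    cy (e , e∈) = Sub.x∈∁p⇒x∉p (c⊆ (proj₁ (Sub.x∈p∩q⁻ c y e∈))) (proj₂ (Sub.x∈p∩q⁻ c y e∈))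

split-walk : ∀ {G : Graph} {x y z m} {w : Walk G x y m} → OnWalk G z w →
             ∃ λ a → ∃ λ b → Walk G x z a × Walk G z y b × a + b ≡ m
split-walk {w = w} here = 0 , _ , [] , w , refl
split-walk {w = e ∷ _} (there on) with split-walk on
... | a , b , u , v , eq = suc a , b , e ∷ u , v , cong suc eq

-- A star is intersecting, so a member on a geodesic between two others forces length at least
-- 2 + 2, whereas the diameter is at most 3.
star-generalPosition : ∀ {n k} → suc k + suc k ≤ suc n → 5 * suc k ≤ 2 * suc n + 1 →
                       GeneralPosition (Kneser (suc n) (suc k)) (star n k)
star-generalPosition {n} {k} 2k≤n 5k≤2n+1 {x} {y} {z} x∈ y∈ z∈ z≢x z≢y (m , w , geodesic , on) with split-walk on | walk≤3 2k≤n 5k≤2n+1 x y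
... | a , b , u , v , refl | m′ , m′≤3 , w′ =
  <⇒≱ (+-mono-≤ (long x∈ z∈ (≢-sym z≢x) u) (long z∈ y∈ z≢y v)) (≤-trans (geodesic m′ w′) m′≤3)
  where
  long : ∀ {s t a} → s ∈ₗ star n k → t ∈ₗ star n k → s ≢ t → Walk (Kneser (suc n) (suc k)) s t a → 2 ≤ a
  long s∈ t∈ s≢t []          = contradiction refl s≢t
  long s∈ t∈ s≢t (e ∷ [])    = contradiction (zero , Sub.x∈p∩q⁺ (∈-star s∈ , ∈-star t∈)) e
  long s∈ t∈ s≢t (e ∷ _ ∷ _) = s≤s (s≤s z≤n)

-- Bounds for families in general position

elements : ∀ {n} → Subset n → List (Fin n)
elements []          = []
elements (true ∷ p)  = zero ∷ map suc (elements p)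
elements (false ∷ p) = map suc (elements p)

length-elements : ∀ {n} (p : Subset n) → length (elements p) ≡ ∣ p ∣
length-elements []          = refl
length-elements (true ∷ p)  = cong suc (trans (List.length-map suc (elements p)) (length-elements p))
length-elements (false ∷ p) = trans (List.length-map suc (elements p)) (length-elements p)

∈-elements : ∀ {n} {p : Subset n} {e} → e ∈ p → e ∈ₗ elements p
∈-elements {p = true ∷ p}  Vec.here       = here refl
∈-elements {p = true ∷ p}  (Vec.there e∈) = there (∈ₗ.∈-map⁺ suc (∈-elements e∈))
∈-elements {p = false ∷ p} (Vec.there e∈) = ∈ₗ.∈-map⁺ suc (∈-elements e∈)

∣p∣≤∣p∩q∣⇒⊆ : ∀ {n} {p q : Subset n} → ∣ p ∣ ≤ ∣ p ∩ q ∣ → p ⊆ q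
∣p∣≤∣p∩q∣⇒⊆ {p = p} {q} le {e} e∈p with e Sub.∈? q
... | yes e∈q = e∈q
... | no  e∉q = contradiction le (<⇒≱ (Sub.p⊂q⇒∣p∣<∣q∣ (Sub.p∩q⊆p p q , e , e∈p , λ e∈ → e∉q (proj₂ (Sub.x∈p∩q⁻ p q e∈)))))

∣p∩q∪r∣≤ : ∀ {n} (p q r : Subset n) → ∣ p ∩ (q ∪ r) ∣ ≤ ∣ p ∩ q ∣ + ∣ p ∩ r ∣
∣p∩q∪r∣≤ p q r = begin
  ∣ p ∩ (q ∪ r) ∣                                   ≡⟨ cong ∣_∣ (Sub.∩-distribˡ-∪ p q r) ⟩
  ∣ (p ∩ q) ∪ (p ∩ r) ∣                             ≤⟨ m≤m+n _ _ ⟩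
  ∣ (p ∩ q) ∪ (p ∩ r) ∣ + ∣ (p ∩ q) ∩ (p ∩ r) ∣     ≡⟨ ∣p∪q∣+∣p∩q∣ (p ∩ q) (p ∩ r) ⟩
  ∣ p ∩ q ∣ + ∣ p ∩ r ∣                             ∎
  where open ≤-Reasoning

∣p∩q∣+∣p∩r∣ : ∀ {n} {p q r : Subset n} → Empty (q ∩ r) → ∣ p ∩ q ∣ + ∣ p ∩ r ∣ ≤ ∣ p ∩ (q ∪ r) ∣
∣p∩q∣+∣p∩r∣ {p = p} {q} {r} e = disjoint-≤ (Empty-⊆ (Sub.p∩q⊆q p q) (Sub.p∩q⊆q p r) e)
  (λ x∈ → Sub.x∈p∩q⁺ (Sub.p∩q⊆p p q x∈ , Sub.p⊆p∪q r (Sub.p∩q⊆q p q x∈)))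
  (λ x∈ → Sub.x∈p∩q⁺ (Sub.p∩q⊆p p r x∈ , Sub.q⊆p∪q q r (Sub.p∩q⊆q p r x∈)))

∣A∪B∣≡ : ∀ {n k i d} (A B : Subset n) → ∣ A ∣ ≡ k → ∣ B ∣ ≡ k → ∣ A ∩ B ∣ ≡ i → i + d ≡ k → ∣ A ∪ B ∣ ≡ k + d
∣A∪B∣≡ {k = k} {i} {d} A B ∣A∣ ∣B∣ ∣A∩B∣ i+d≡k = +-cancelʳ-≡ i _ _ (begin
  ∣ A ∪ B ∣ + i         ≡⟨ cong (∣ A ∪ B ∣ +_) ∣A∩B∣ ⟨
  ∣ A ∪ B ∣ + ∣ A ∩ B ∣ ≡⟨ ∣p∪q∣+∣p∩q∣ A B ⟩
  ∣ A ∣ + ∣ B ∣         ≡⟨ cong₂ _+_ ∣A∣ ∣B∣ ⟩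
  k + k                 ≡⟨ cong (k +_) (trans (+-comm d i) i+d≡k) ⟨
  k + (d + i)           ≡⟨ +-assoc k d i ⟨
  k + d + i             ∎)
  where open ≡-Reasoning

module _ {n k : ℕ} .{{_ : NonZero n}} (4≤k : 4 ≤ k) (2k<n : k + k < n)
         {G : List (Subset n)} (uG : Unique G) (gp : GeneralPositionFamily n k G) where

  open GeneralPositionFamily gp

  private
    0<k : 0 < k
    0<k = ≤-trans (s≤s z≤n) 4≤k

    2k≤n : k + k ≤ n
    2k≤n = <⇒≤ 2k<n

    k<n : k < n
    k<n = ≤-<-trans (m≤m+n k k) 2k<n

  module Avg = Average n k 0<k 2k≤n k<n
  open Avg using (B; W; Q)

  instance
    B≢0 : NonZero B
    B≢0 = ≢-nonZero λ B≡0 → ≢-sym (<⇒≢ (1≤n! n)) (trans Avg.n!≡ (cong (_* Q) B≡0))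

    W≢0 : NonZero W
    W≢0 = ≢-nonZero λ W≡0 → ≢-sym (<⇒≢ (1≤n! (k + k))) (trans (sym (nCk*k!*[n∸k]!≡n! (m≤m+n k k))) (cong (_* (k ! * (k + k ∸ k) !)) W≡0))

  self : ∀ {P} → P ∈ₗ G → Meet P P
  self {P} P∈ = ∣∣>0⇒Nonempty (subst (0 <_) (trans (sym (size P∈)) (cong ∣_∣ (sym (Sub.∩-idem P)))) 0<k)

  ∣∩∣<k⇒≢ : ∀ {A B} → A ∈ₗ G → ∣ A ∩ B ∣ < k → A ≢ B
  ∣∩∣<k⇒≢ {A} A∈ lt refl = <⇒≢ lt (trans (cong ∣_∣ (Sub.∩-idem A)) (size A∈))

  module UpperBound {l : ℕ} (dec : Decomposition l G) where
    open Decomposition dec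
    open DecompositionProperties dec

    -- A clique stands for up to `l` sets but enters the averaged inequality as one pair. By the
    -- numerical hypothesis the weight `4 k B` of the pair pays for `l` sets of weight
    -- `length U * W`.
    bound : (U : List (Fin n)) → (∀ {p e} → p ∈ₗ M → e ∈ proj₁ p ⊎ e ∈ proj₂ p → e ∈ₗ U) → 2 * k ≤ length U →
            l * (length U * W) ≤ 4 * k * B → length G ≤ B
    bound U ⊆U 2k≤U numeric = ≤-trans len (*-cancelʳ-≤ _ _ (length U * W) {{m*n≢0 (length U) W {{>-nonZero (≤-trans (≤-trans 0<k (m≤m+n k _)) 2k≤U)}}}} (begin
      (length F + l * length M) * (length U * W)
        ≡⟨ solve 5 (λ f l m u w → (f :+ l :* m) :* (u :* w) := u :* (f :* w) :+ l :* (u :* w) :* m) refl (length F) l (length M) (length U) W ⟩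
      length U * (length F * W) + l * (length U * W) * length M
        ≤⟨ +-monoʳ-≤ (length U * (length F * W)) (*-monoˡ-≤ (length M) numeric) ⟩
      length U * (length F * W) + 4 * k * B * length M
        ≡⟨ cong (length U * (length F * W) +_) (trans (*-assoc (4 * k) B (length M)) (cong (4 * k *_) (*-comm B (length M)))) ⟩
      length U * (length F * W) + 4 * k * (length M * B)
        ≤⟨ Avg.weighted-average uF uM
             (λ _ o∈ o′∈ → compatible o∈ o′∈ (λ p∈ → self (proj₁ (M⊆ p∈)) , self (proj₂ (M⊆ p∈))))
             (λ P∈ → size (F⊆ P∈)) (λ p∈ → (size (proj₁ (M⊆ p∈)) , size (proj₂ (M⊆ p∈))) , disj p∈) U ⊆U 2k≤U ⟩
      length U * (B * W)
        ≡⟨ solve 3 (λ u b w → u :* (b :* w) := b :* (u :* w)) refl (length U) B W ⟩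
      B * (length U * W) ∎))
      where
      open ≤-Reasoning
      open +-*-Solver

    boundₙ : l * (n * W) ≤ 4 * k * B → length G ≤ B
    boundₙ numeric = bound (allFin n) (λ _ _ → ∈ₗ.∈-allFin _) (≤-trans (≤-reflexive (cong (k +_) (+-identityʳ k))) (≤-trans 2k≤n (≤-reflexive (sym (length-allFin n)))))
      (subst (λ z → l * (z * W) ≤ 4 * k * B) (sym (length-allFin n)) numeric)

  -- Cliques may have `n / k` members here; multiplying by `k` replaces the rounded quotient by `n`.
  bound-3k≤n : 3 * k ≤ n → n * n * W ≤ 4 * k * k * B → length G ≤ B
  bound-3k≤n 3k≤n numeric = UpperBound.boundₙ (decompose 0<k (λ m mk≤n → subst (_≤ n / k) (m*n/n≡m m k) (/-monoˡ-≤ k mk≤n)) uG gp)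
    (*-cancelʳ-≤ _ _ k (begin
      n / k * (n * W) * k   ≡⟨ solve 4 (λ l n w k → l :* (n :* w) :* k := l :* k :* (n :* w)) refl (n / k) n W k ⟩
      n / k * k * (n * W)   ≤⟨ *-monoˡ-≤ (n * W) (m/n*n≤m n k) ⟩
      n * (n * W)           ≡⟨ *-assoc n n W ⟨
      n * n * W             ≤⟨ numeric ⟩
      4 * k * k * B         ≡⟨ solve 2 (λ k b → con 4 :* k :* k :* b := con 4 :* k :* b :* k) refl k B ⟩
      4 * k * B * k         ∎))
    where
    open ≤-Reasoning
    open +-*-Solver
    instance _ = >-nonZero 0<k

  cliques≤2 : n < 3 * k → ∀ m → m * k ≤ n → m ≤ 2
  cliques≤2 n<3k m mk≤n = ≤-pred (*-cancelʳ-< k m 3 (≤-<-trans mk≤n n<3k))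

  bound-n<3k : n < 3 * k → n * W ≤ 2 * k * B → length G ≤ B
  bound-n<3k n<3k numeric = UpperBound.boundₙ (decompose 0<k (cliques≤2 n<3k) uG gp) (begin
    2 * (n * W)       ≤⟨ *-monoʳ-≤ 2 numeric ⟩
    2 * (2 * k * B)   ≡⟨ solve 2 (λ k b → con 2 :* (con 2 :* k :* b) := con 4 :* k :* b) refl k B ⟩
    4 * k * B         ∎)
    where
    open ≤-Reasoning
    open +-*-Solver

  -- For k = 4 and n = 10 the bound n * W ≤ 2 * k * B just fails; but then general position
  -- confines all pairs to the eight elements of the first one.
  module _ (k≡4 : k ≡ 4) (n≡10 : n ≡ 10) where

    ∣∪∣+∣∩∣≡8 : ∀ {A B} → A ∈ₗ G → B ∈ₗ G → ∣ A ∪ B ∣ + ∣ A ∩ B ∣ ≡ 8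
    ∣∪∣+∣∩∣≡8 {A} {B} A∈ B∈ = trans (∣p∪q∣+∣p∩q∣ A B) (cong₂ _+_ (trans (size A∈) k≡4) (trans (size B∈) k≡4))

    near₁₀ : ∀ {A B} → A ∈ₗ G → B ∈ₗ G → 2 ≤ ∣ A ∩ B ∣ → ∣ A ∪ B ∣ + k ≤ n
    near₁₀ {A} {B} A∈ B∈ 2≤ = subst₂ (λ k n → ∣ A ∪ B ∣ + k ≤ n) (sym k≡4) (sym n≡10)
      (+-monoˡ-≤ 4 (+-cancelʳ-≤ 2 (∣ A ∪ B ∣) 6 (≤-trans (+-monoʳ-≤ (∣ A ∪ B ∣) 2≤) (≤-reflexive (∣∪∣+∣∩∣≡8 A∈ B∈)))))

    far₁₀ : ∀ {A B} → A ∈ₗ G → B ∈ₗ G → ∣ A ∩ B ∣ ≤ 1 → n < ∣ A ∪ B ∣ + k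
    far₁₀ {A} {B} A∈ B∈ ≤1 = subst₂ (λ k n → n < ∣ A ∪ B ∣ + k) (sym k≡4) (sym n≡10)
      (+-monoˡ-≤ 4 (+-cancelʳ-≤ 1 7 (∣ A ∪ B ∣) (≤-trans (≤-reflexive (sym (∣∪∣+∣∩∣≡8 A∈ B∈))) (+-monoʳ-≤ (∣ A ∪ B ∣) ≤1))))

    -- For these parameters sets have a common neighbour exactly when they share at least two
    -- points. If `A` shared only one with `D`, then `B` would lie on a geodesic of length 3 from
    -- `A` to `D`.
    share : ∀ {A B D} → A ∈ₗ G → B ∈ₗ G → D ∈ₗ G → Empty (B ∩ D) → Meet A D → 2 ≤ ∣ A ∩ B ∣ → 2 ≤ ∣ A ∩ D ∣
    share {A} {B} {D} A∈ B∈ D∈ BD AD 2≤ = ≮⇒≥ λ <2 →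
      geodesic₃ A∈ B∈ D∈ (λ { refl → BD AD }) (near₁₀ A∈ B∈ 2≤) BD AD (far₁₀ A∈ D∈ (≤-pred <2))

    ∩-sym : ∀ {A B : Subset n} {i} → i ≤ ∣ A ∩ B ∣ → i ≤ ∣ B ∩ A ∣
    ∩-sym {A} {B} {i} = subst (λ z → i ≤ ∣ z ∣) (Sub.∩-comm A B)

    covered : ∀ {A X Y} → A ∈ₗ G → Empty (X ∩ Y) → 2 ≤ ∣ A ∩ X ∣ → 2 ≤ ∣ A ∩ Y ∣ → A ⊆ X ∪ Y
    covered {A} {X} {Y} A∈ XY 2≤X 2≤Y = ∣p∣≤∣p∩q∣⇒⊆ (≤-trans (≤-reflexive (trans (size A∈) k≡4))
      (≤-trans (+-mono-≤ 2≤X 2≤Y) (∣p∩q∣+∣p∩r∣ {p = A} XY)))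

    module _ {X Y X′ Y′} (X∈ : X ∈ₗ G) (Y∈ : Y ∈ₗ G) (X′∈ : X′ ∈ₗ G) (Y′∈ : Y′ ∈ₗ G)
             (XY : Empty (X ∩ Y)) (X′Y′ : Empty (X′ ∩ Y′)) (cr : Cross (X , Y) (X′ , Y′)) where

      private
        XX′ = proj₁ cr
        YY′ = proj₁ (proj₂ cr)
        XY′ = proj₁ (proj₂ (proj₂ cr))
        YX′ = proj₂ (proj₂ (proj₂ cr))

      XX′⇒XY′ : 2 ≤ ∣ X ∩ X′ ∣ → 2 ≤ ∣ X ∩ Y′ ∣
      XX′⇒XY′ = share X∈ X′∈ Y′∈ X′Y′ XY′

      XY′⇒XX′ : 2 ≤ ∣ X ∩ Y′ ∣ → 2 ≤ ∣ X ∩ X′ ∣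
      XY′⇒XX′ = share X∈ Y′∈ X′∈ (Empty-sym X′Y′) XX′

      X′X⇒X′Y : 2 ≤ ∣ X′ ∩ X ∣ → 2 ≤ ∣ X′ ∩ Y ∣
      X′X⇒X′Y = share X′∈ X∈ Y∈ XY (Meet-sym YX′)

      X′Y⇒X′X : 2 ≤ ∣ X′ ∩ Y ∣ → 2 ≤ ∣ X′ ∩ X ∣
      X′Y⇒X′X = share X′∈ Y∈ X∈ (Empty-sym XY) (Meet-sym XX′)

      Y′X⇒Y′Y : 2 ≤ ∣ Y′ ∩ X ∣ → 2 ≤ ∣ Y′ ∩ Y ∣
      Y′X⇒Y′Y = share Y′∈ X∈ Y∈ XY (Meet-sym YY′)

      Y′Y⇒Y′X : 2 ≤ ∣ Y′ ∩ Y ∣ → 2 ≤ ∣ Y′ ∩ X ∣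
      Y′Y⇒Y′X = share Y′∈ Y∈ X∈ (Empty-sym XY) (Meet-sym XY′)

      -- Both unions have 8 of the 10 points, so they share at least 6. By `share`, a small
      -- intersection of `X` and `X′` would make all four cross intersections small, at most 4
      -- points in total.
      many-shared : 2 ≤ ∣ X ∩ X′ ∣
      many-shared = ≮⇒≥ λ few → <⇒≱ (few-total few) total
        where
        Z Z′ : Subset n
        Z  = X ∪ Y
        Z′ = X′ ∪ Y′
        few-total : ∣ X ∩ X′ ∣ < 2 → ∣ Z′ ∩ Z ∣ < 6
        few-total few = begin-strict
          ∣ Z′ ∩ Z ∣                                            ≤⟨ ∣p∩q∪r∣≤ Z′ X Y ⟩
          ∣ Z′ ∩ X ∣ + ∣ Z′ ∩ Y ∣                               ≡⟨ cong₂ _+_ (cong ∣_∣ (Sub.∩-comm Z′ X)) (cong ∣_∣ (Sub.∩-comm Z′ Y)) ⟩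
          ∣ X ∩ Z′ ∣ + ∣ Y ∩ Z′ ∣                               ≤⟨ +-mono-≤ (∣p∩q∪r∣≤ X X′ Y′) (∣p∩q∪r∣≤ Y X′ Y′) ⟩
          ∣ X ∩ X′ ∣ + ∣ X ∩ Y′ ∣ + (∣ Y ∩ X′ ∣ + ∣ Y ∩ Y′ ∣)   ≤⟨ +-mono-≤ (+-mono-≤ (≤-pred few) (≤-pred (≰⇒> XY′≱))) (+-mono-≤ (≤-pred (≰⇒> YX′≱)) (≤-pred (≰⇒> YY′≱))) ⟩
          4                                                     <⟨ m≤m+n 5 1 ⟩
          6                                                     ∎
          where
          open ≤-Reasoning
          XX′≱ : ¬ (2 ≤ ∣ X ∩ X′ ∣)
          XX′≱ = <⇒≱ few
          XY′≱ : ¬ (2 ≤ ∣ X ∩ Y′ ∣)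
          XY′≱ = XX′≱ ∘ XY′⇒XX′
          YX′≱ : ¬ (2 ≤ ∣ Y ∩ X′ ∣)
          YX′≱ h = XX′≱ (∩-sym {X′} {X} (X′Y⇒X′X (∩-sym {Y} {X′} h)))
          YY′≱ : ¬ (2 ≤ ∣ Y ∩ Y′ ∣)
          YY′≱ h = XY′≱ (∩-sym {Y′} {X} (Y′Y⇒Y′X (∩-sym {Y} {Y′} h)))
        ∣∪∣≡8 : ∀ {A B} → A ∈ₗ G → B ∈ₗ G → Empty (A ∩ B) → ∣ A ∪ B ∣ ≡ 8
        ∣∪∣≡8 A∈ B∈ e = trans (disjoint-∪ e) (cong₂ _+_ (trans (size A∈) k≡4) (trans (size B∈) k≡4))
        total : 6 ≤ ∣ Z′ ∩ Z ∣
        total = +-cancelˡ-≤ 10 6 _ (begin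
          16                          ≡⟨ cong₂ _+_ (∣∪∣≡8 X′∈ Y′∈ X′Y′) (∣∪∣≡8 X∈ Y∈ XY) ⟨
          ∣ Z′ ∣ + ∣ Z ∣              ≡⟨ ∣p∪q∣+∣p∩q∣ Z′ Z ⟨
          ∣ Z′ ∪ Z ∣ + ∣ Z′ ∩ Z ∣     ≤⟨ +-monoˡ-≤ (∣ Z′ ∩ Z ∣) (≤-trans (Sub.∣p∣≤n (Z′ ∪ Z)) (≤-reflexive n≡10)) ⟩
          10 + ∣ Z′ ∩ Z ∣             ∎)
          where open ≤-Reasoning

      confined : ∀ {e} → e ∈ X′ ⊎ e ∈ Y′ → e ∈ X ∪ Y
      confined (inj₁ e∈) = covered X′∈ XY X′X (X′X⇒X′Y X′X) e∈
        where
        X′X : 2 ≤ ∣ X′ ∩ X ∣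
        X′X = ∩-sym {X} {X′} many-shared
      confined (inj₂ e∈) = covered Y′∈ XY Y′X (Y′X⇒Y′Y Y′X) e∈
        where
        Y′X : 2 ≤ ∣ Y′ ∩ X ∣
        Y′X = ∩-sym {X} {Y′} (XX′⇒XY′ many-shared)

    bound-4-10 : length G ≤ B
    bound-4-10 = go M refl
      where
      n<3k : n < 3 * k
      n<3k = subst₂ (λ k n → n < 3 * k) (sym k≡4) (sym n≡10) (m≤m+n 11 1)
      dec : Decomposition 2 G
      dec = decompose 0<k (cliques≤2 n<3k) uG gp
      open Decomposition dec
      numeric : ∀ {k n} → k ≡ 4 → n ≡ 10 → 2 * (8 * ((k + k) C k)) ≤ 4 * k * ((n ∸ 1) C (k ∸ 1))
      numeric refl refl = m≤m+n 1120 224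
      2k≡8 : 2 * k ≡ 8
      2k≡8 = cong (2 *_) k≡4
      bound₈ : (U : List (Fin n)) → length U ≡ 8 → (∀ {p e} → p ∈ₗ M → e ∈ proj₁ p ⊎ e ∈ proj₂ p → e ∈ₗ U) → length G ≤ B
      bound₈ U ∣U∣≡8 ⊆U = UpperBound.bound dec U ⊆U (≤-reflexive (trans 2k≡8 (sym ∣U∣≡8)))
        (subst (λ z → 2 * (z * W) ≤ 4 * k * B) (sym ∣U∣≡8) (numeric k≡4 n≡10))
      go : ∀ ps → M ≡ ps → length G ≤ B
      -- There is no pair to cover, so any list of eight entries will do.
      go [] M≡ = bound₈ (List.replicate 8 (0 mod n)) refl λ {p} p∈ → case subst (p ∈ₗ_) M≡ p∈ of λ ()
      go ((X , Y) ∷ ps) M≡ = bound₈ (elements (X ∪ Y))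
        (trans (length-elements (X ∪ Y)) (trans (disjoint-∪ (disj p∈)) (trans (cong₂ _+_ (size (proj₁ (M⊆ p∈))) (size (proj₂ (M⊆ p∈)))) (trans (cong (k +_) (sym (+-identityʳ k))) 2k≡8))))
        (λ q∈ e∈ → ∈-elements (inside-first q∈ e∈))
        where
        p∈ : (X , Y) ∈ₗ M
        p∈ = subst ((X , Y) ∈ₗ_) (sym M≡) (here refl)
        inside-first : ∀ {q e} → q ∈ₗ M → e ∈ proj₁ q ⊎ e ∈ proj₂ q → e ∈ X ∪ Y
        inside-first q∈ e∈ with meetM p∈ q∈
        ... | inj₁ refl = Sub.x∈p∪q⁺ e∈
        ... | inj₂ cr   = confined (proj₁ (M⊆ p∈)) (proj₂ (M⊆ p∈)) (proj₁ (M⊆ q∈)) (proj₂ (M⊆ q∈)) (disj p∈) (disj q∈) cr e∈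

  module _ (2n+1<5k : 2 * n + 1 < 5 * k) where

    private
      t : ℕ
      t = n ∸ (k + k)

      n≡ : n ≡ k + k + t
      n≡ = sym (m+[n∸m]≡n 2k≤n)

      0<t : 0 < t
      0<t = m<n⇒0<n∸m 2k<n

      2t+2≤k : t + t + 2 ≤ k
      2t+2≤k = +-cancelˡ-≤ (4 * k) _ _ (begin
        4 * k + (t + t + 2)        ≡⟨ solve 2 (λ k t → con 4 :* k :+ (t :+ t :+ con 2) := con 1 :+ (con 2 :* (k :+ k :+ t) :+ con 1)) refl k t ⟩
        suc (2 * (k + k + t) + 1)  ≡⟨ cong (λ z → suc (2 * z + 1)) n≡ ⟨
        suc (2 * n + 1)            ≤⟨ 2n+1<5k ⟩
        5 * k                      ≡⟨ solve 1 (λ k → con 5 :* k := con 4 :* k :+ k) refl k ⟩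
        4 * k + k                  ∎)
        where
        open ≤-Reasoning
        open +-*-Solver

      t+2≤k : t + 2 ≤ k
      t+2≤k = ≤-trans (+-monoˡ-≤ 2 (m≤m+n t t)) 2t+2≤k

      t+1≤k : t + 1 ≤ k
      t+1≤k = ≤-trans (+-monoʳ-≤ t (s≤s z≤n)) t+2≤k

      t≤k : t ≤ k
      t≤k = ≤-trans (m≤m+n t 1) t+1≤k

      n+2≤3k : n + 2 ≤ 3 * k
      n+2≤3k = begin
        n + 2              ≡⟨ cong (_+ 2) n≡ ⟩
        k + k + t + 2      ≡⟨ +-assoc (k + k) t 2 ⟩
        k + k + (t + 2)    ≤⟨ +-monoʳ-≤ (k + k) t+2≤k ⟩
        k + k + k          ≡⟨ solve 1 (λ k → k :+ k :+ k := con 3 :* k) refl k ⟩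
        3 * k              ∎
        where
        open ≤-Reasoning
        open +-*-Solver

      n<3k : n < 3 * k
      n<3k = ≤-trans (≤-trans (n≤1+n (suc n)) (≤-reflexive (+-comm 2 n))) n+2≤3k

    open Decomposition (decompose {l = 2} 0<k (cliques≤2 n<3k) uG gp)
    open DecompositionProperties (decompose {l = 2} 0<k (cliques≤2 n<3k) uG gp)

    -- `B` has common neighbours with `A` and with `D`, in the second case with no point to spare:
    -- `∣ B ∪ D ∣ + k` is `n`. For `A` and `D` the sum is `n + 1`, and `2 t + 2 ≤ k` makes them
    -- share too many points for a walk of length 3. So `B` is the midpoint of a geodesic.
    no-triple : ∀ {A B D} → A ∈ₗ G → B ∈ₗ G → D ∈ₗ G → ∣ A ∩ B ∣ ≡ k ∸ 1 → ∣ B ∩ D ∣ ≡ k ∸ t → ∣ A ∩ D ∣ ≡ k ∸ (t + 1) → ⊥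
    no-triple {A} {B} {D} A∈ B∈ D∈ AB BD AD = geodesic₄ A∈ B∈ D∈
      (∣∩∣<k⇒≢ A∈ (subst (_< k) (sym AB) (∸-monoʳ-< (s≤s z≤n) 0<k)))
      (∣∩∣<k⇒≢ B∈ (subst (_< k) (sym BD) (∸-monoʳ-< 0<t t≤k)))
      (begin
        ∣ A ∪ B ∣ + k    ≡⟨ cong (_+ k) (∣A∪B∣≡ A B (size A∈) (size B∈) AB (m∸n+n≡m 0<k)) ⟩
        k + 1 + k        ≡⟨ solve 1 (λ k → k :+ con 1 :+ k := con 1 :+ (k :+ k)) refl k ⟩
        suc (k + k)      ≤⟨ 2k<n ⟩
        n                ∎)
      (begin
        ∣ B ∪ D ∣ + k    ≡⟨ cong (_+ k) (∣A∪B∣≡ B D (size B∈) (size D∈) BD (m∸n+n≡m t≤k)) ⟩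
        k + t + k        ≡⟨ solve 2 (λ k t → k :+ t :+ k := k :+ k :+ t) refl k t ⟩
        k + k + t        ≡⟨ n≡ ⟨
        n                ∎)
      (begin
        suc n              ≡⟨ cong suc n≡ ⟩
        suc (k + k + t)    ≡⟨ solve 2 (λ k t → con 1 :+ (k :+ k :+ t) := k :+ (t :+ con 1) :+ k) refl k t ⟩
        k + (t + 1) + k    ≡⟨ cong (_+ k) (∣A∪B∣≡ A D (size A∈) (size D∈) AD (m∸n+n≡m t+1≤k)) ⟨
        ∣ A ∪ D ∣ + k      ∎)
      (begin
        suc n                ≡⟨ cong suc n≡ ⟩
        suc (k + k + t)      ≡⟨ solve 2 (λ k t → con 1 :+ (k :+ k :+ t) := k :+ k :+ (t :+ con 1)) refl k t ⟩
        k + k + (t + 1)      ≤⟨ +-monoʳ-≤ (k + k) (m+n≤o⇒n≤o∸m {t + 1} (≤-trans (≤-reflexive (solve 1 (λ t → t :+ con 1 :+ (t :+ con 1) := t :+ t :+ con 2) refl t)) 2t+2≤k)) ⟩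
        k + k + (k ∸ (t + 1)) ≡⟨ cong (k + k +_) AD ⟨
        k + k + ∣ A ∩ D ∣    ∎)
      where
      open ≤-Reasoning
      open +-*-Solver

    -- Let `R` be the partner of `P′`. If `P` differs from `P′`, it meets `R`, but in at most one
    -- point, as nearly all of `P` lies in `P′`. By `n + 2 ≤ 3 k` this puts `P` and `R` at distance
    -- 3, and `P′` lies on a geodesic between them.
    close⇒≡ : ∀ {P P′} → P ∈ₗ T → P′ ∈ₗ T → k ∸ 1 ≤ ∣ P ∩ P′ ∣ → P ≡ P′
    close⇒≡ {P} {P′} P∈T P′∈T close with Vec.≡-dec Bool._≟_ P P′ | partner P∈T | partner P′∈T
    ... | yes P≡P′ | _ | _ = P≡P′
    ... | no  P≢P′ | P∈ , _ | P′∈ , R , R∈ , P′R = ⊥-elim (geodesic₃ P∈ P′∈ R∈ P≢P′ near P′R meetPR far)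
      where
      open ≤-Reasoning
      open +-*-Solver
      close′ : k ≤ ∣ P ∩ P′ ∣ + 1
      close′ = ≤-trans (≤-reflexive (sym (m∸n+n≡m 0<k))) (+-monoˡ-≤ 1 close)
      meetPP′ : Meet P P′
      meetPP′ = ∣∣>0⇒Nonempty (≤-trans (∸-monoˡ-≤ 1 (≤-trans (s≤s (s≤s z≤n)) 4≤k)) close)
      meetPR : Meet P R
      meetPR with Sub.nonempty? (P ∩ R)
      ... | yes m = m
      ... | no  e = ⊥-elim (geodesic₂ P∈ R∈ P′∈ P≢P′ e (Empty-sym P′R) meetPP′)
      near : ∣ P ∪ P′ ∣ + k ≤ n
      near = ≤-trans (+-cancelʳ-≤ (∣ P ∩ P′ ∣) _ _ (begin
        ∣ P ∪ P′ ∣ + k + ∣ P ∩ P′ ∣     ≡⟨ solve 3 (λ u k i → u :+ k :+ i := u :+ i :+ k) refl (∣ P ∪ P′ ∣) k (∣ P ∩ P′ ∣) ⟩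
        ∣ P ∪ P′ ∣ + ∣ P ∩ P′ ∣ + k     ≡⟨ cong (_+ k) (trans (∣p∪q∣+∣p∩q∣ P P′) (cong₂ _+_ (size P∈) (size P′∈))) ⟩
        k + k + k                       ≤⟨ +-monoʳ-≤ (k + k) close′ ⟩
        k + k + (∣ P ∩ P′ ∣ + 1)        ≡⟨ solve 2 (λ k i → k :+ k :+ (i :+ con 1) := con 1 :+ (k :+ k) :+ i) refl k (∣ P ∩ P′ ∣) ⟩
        suc (k + k) + ∣ P ∩ P′ ∣        ∎)) 2k<n
      PR≤1 : ∣ P ∩ R ∣ ≤ 1
      PR≤1 = +-cancelˡ-≤ (∣ P ∩ P′ ∣) _ _ (≤-trans (∣a∩f∣+∣a∩d∣≤∣a∣ {a = P} P′R) (≤-trans (≤-reflexive (size P∈)) close′))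
      far : n < ∣ P ∪ R ∣ + k
      far = +-cancelʳ-≤ 1 _ _ (begin
        suc n + 1                       ≡⟨ solve 1 (λ n → con 1 :+ n :+ con 1 := n :+ con 2) refl n ⟩
        n + 2                           ≤⟨ n+2≤3k ⟩
        3 * k                           ≡⟨ solve 1 (λ k → con 3 :* k := k :+ k :+ k) refl k ⟩
        k + k + k                       ≡⟨ cong (_+ k) (trans (∣p∪q∣+∣p∩q∣ P R) (cong₂ _+_ (size P∈) (size R∈))) ⟨
        ∣ P ∪ R ∣ + ∣ P ∩ R ∣ + k       ≤⟨ +-monoˡ-≤ k (+-monoʳ-≤ (∣ P ∪ R ∣) PR≤1) ⟩
        ∣ P ∪ R ∣ + 1 + k               ≡⟨ solve 2 (λ u k → u :+ con 1 :+ k := u :+ k :+ con 1) refl (∣ P ∪ R ∣) k ⟩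
        ∣ P ∪ R ∣ + k + 1               ∎)

    -- The `2 ∣M∣` sets of `T` contain pairwise different `(k - 1)`-sets, so
    -- `2 ∣M∣ k (n - k + 1) ≤ n B`, while `n < 2 (n - k + 1)`.
    few-pairs : k * length M < B
    few-pairs = ≰⇒> λ B≤kM → <⇒≱ (*-monoˡ-< B n<) (begin
      2 * (1 + (n ∸ k)) * B                          ≤⟨ *-monoʳ-≤ (2 * (1 + (n ∸ k))) B≤kM ⟩
      2 * (1 + (n ∸ k)) * (k * length M)             ≡⟨ solve 3 (λ d k m → con 2 :* d :* (k :* m) := (m :+ m) :* d :* k) refl (1 + (n ∸ k)) k (length M) ⟩
      (length M + length M) * (1 + (n ∸ k)) * k      ≡⟨ cong (λ z → z * (1 + (n ∸ k)) * k) |T|≡ ⟨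
      length T * (1 + (n ∸ k)) * k                   ≤⟨ Avg.packing (unique-T self) (λ P∈ → size (proj₁ (partner P∈))) close⇒≡ ⟩
      n * B                                          ∎)
      where
      open ≤-Reasoning
      open +-*-Solver
      |T|≡ : length T ≡ length M + length M
      |T|≡ = trans (List.length-++ (map proj₁ M)) (cong₂ _+_ (List.length-map proj₁ M) (List.length-map proj₂ M))
      n< : n < 2 * (1 + (n ∸ k))
      n< = begin-strict
        n                            ≡⟨ m+[n∸m]≡n (<⇒≤ k<n) ⟨
        k + (n ∸ k)                  ≤⟨ +-monoˡ-≤ (n ∸ k) (m+n≤o⇒n≤o∸m {k} 2k≤n) ⟩
        (n ∸ k) + (n ∸ k)            <⟨ m<m+n _ {2} (s≤s z≤n) ⟩
        (n ∸ k) + (n ∸ k) + 2        ≡⟨ solve 1 (λ d → d :+ d :+ con 2 := con 2 :* (con 1 :+ d)) refl (n ∸ k) ⟩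
        2 * (1 + (n ∸ k))            ∎

    -- The family has at most `∣H∣ + ∣M∣` members, where `∣H∣ ≤ B - B / k` and `∣M∣ < B / k`.
    strict-bound : length G < B
    strict-bound = *-cancelˡ-< k _ _ (+-cancelʳ-< B _ _ (begin-strict
      k * length G + B                                 ≤⟨ +-monoˡ-≤ B (*-monoʳ-≤ k len) ⟩
      k * (length F + 2 * length M) + B                ≡⟨ solve 4 (λ k f m b → k :* (f :+ con 2 :* m) :+ b := k :* (f :+ m) :+ b :+ k :* m) refl k (length F) (length M) B ⟩
      k * (length F + length M) + B + k * length M     ≡⟨ cong (λ z → k * z + B + k * length M) |H|≡ ⟨
      k * length H + B + k * length M                  ≤⟨ +-monoˡ-≤ (k * length M) (Avg.strict-average t n≡ 0<t 2t+2≤k unique-H (λ P∈ → size (H⊆ P∈)) (meet-H self)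
                                                            (λ A∈ B∈ D∈ → no-triple (H⊆ A∈) (H⊆ B∈) (H⊆ D∈))) ⟩
      k * B + k * length M                             <⟨ +-monoʳ-< (k * B) few-pairs ⟩
      k * B + B                                        ∎))
      where
      open ≤-Reasoning
      open +-*-Solver
      |H|≡ : length H ≡ length F + length M
      |H|≡ = trans (List.length-++ F) (cong (length F +_) (List.length-map proj₁ M))

-- Combination of the cases

family-≤ : ∀ {n k} .{{_ : NonZero n}} → 4 ≤ k → k + k < n → 5 * k ≤ 2 * n + 1 → ∀ {G} → Unique G → GeneralPositionFamily n k G →
           length G ≤ (n ∸ 1) C (k ∸ 1)
family-≤ {n} {k} 4≤k 2k<n 5k≤ uG gp with 3 * k ≤? n
... | yes 3k≤n = bound-3k≤n 4≤k 2k<n uG gp 3k≤n (numeric 4≤k 3k≤n)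
  where
  open +-*-Solver
  numeric : ∀ {k n} → 4 ≤ k → 3 * k ≤ n → n * n * ((k + k) C k) ≤ 4 * k * k * ((n ∸ 1) C (k ∸ 1))
  numeric {k} {n} 4≤k 3k≤n with m≤n⇒∃[o]m+o≡n 4≤k | m≤n⇒∃[o]m+o≡n 3k≤n
  ... | i , refl | e , refl = subst (λ n → n * n * ((k + k) C k) ≤ 4 * k * k * ((n ∸ 1) C (k ∸ 1)))
    (solve 2 (λ k e → k :+ (e :+ (k :+ k)) := con 3 :* k :+ e) refl k e) (quadratic-bound i e)
... | no 3k≰n with k ≟ 4
...   | no k≢4 = bound-n<3k 4≤k 2k<n uG gp (≰⇒> 3k≰n) (numeric (≤∧≢⇒< 4≤k (≢-sym k≢4)) 2k+2≤n)
  where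
  open ≤-Reasoning
  open +-*-Solver
  -- As `k ≥ 5`, the hypothesis yields `2 n + 1 ≥ 5 k ≥ 4 k + 5`.
  2k+2≤n : k + k + 2 ≤ n
  2k+2≤n = *-cancelˡ-≤ 2 (+-cancelʳ-≤ 1 _ _ (begin
    2 * (k + k + 2) + 1    ≡⟨ solve 1 (λ k → con 2 :* (k :+ k :+ con 2) :+ con 1 := con 4 :* k :+ con 5) refl k ⟩
    4 * k + 5              ≤⟨ +-monoʳ-≤ (4 * k) (≤∧≢⇒< 4≤k (≢-sym k≢4)) ⟩
    4 * k + k              ≡⟨ solve 1 (λ k → con 4 :* k :+ k := con 5 :* k) refl k ⟩
    5 * k                  ≤⟨ 5k≤ ⟩
    2 * n + 1              ∎))
  numeric : ∀ {k n} → 5 ≤ k → k + k + 2 ≤ n → n * ((k + k) C k) ≤ 2 * k * ((n ∸ 1) C (k ∸ 1))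
  numeric {suc j} {n} (s≤s 4≤j) 2k+2≤n with m≤n⇒∃[o]m+o≡n 2k+2≤n
  ... | e , refl = subst (λ n → n * ((suc j + suc j) C suc j) ≤ 2 * suc j * ((n ∸ 1) C j))
    (solve 2 (λ j e → con 1 :+ (j :+ (e :+ (con 3 :+ j))) := con 1 :+ j :+ (con 1 :+ j) :+ con 2 :+ e) refl j e) (linear-bound j e 4≤j)
...   | yes refl with n ≟ 10
...     | yes n≡10 = bound-4-10 4≤k 2k<n uG gp refl n≡10
...     | no  n≢10 = bound-n<3k 4≤k 2k<n uG gp (≰⇒> 3k≰n) (numeric (≤∧≢⇒< 10≤n (≢-sym n≢10)))
  where
  -- For `k = 4` the hypothesis is `20 ≤ 2 n + 1`.
  10≤n : 10 ≤ n
  10≤n = ≮⇒≥ λ n<10 → <⇒≱ (s≤s (+-monoˡ-≤ 1 (*-monoʳ-≤ 2 (≤-pred n<10)))) 5k≤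
  numeric : ∀ {n} → 11 ≤ n → n * (8 C 4) ≤ 8 * ((n ∸ 1) C 3)
  numeric 11≤n with m≤n⇒∃[o]m+o≡n 11≤n
  ... | e , refl = subst (λ z → (4 + z) * (8 C 4) ≤ 8 * ((3 + z) C 3)) {e + 7} {7 + e} (+-comm e 7) (linear-bound₄ e)

kneser-family : ∀ {n k} → 4 ≤ k → k + k < n → (S : List (Vertex n k)) → Unique S → GeneralPosition (Kneser n k) S →
                Unique (map proj₁ S) × GeneralPositionFamily n k (map proj₁ S)
kneser-family 4≤k 2k<n S uS gp = Unique.map⁺ vertex-≡ uS , generalPositionFamily (≤-trans (s≤s z≤n) 4≤k) (<⇒≤ 2k<n) S gp

theorem2 : ∀ (n k : ℕ) → 4 ≤ n → 4 ≤ k → 2 * k + 1 ≤ n →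
    GpAtMost (Kneser n k) ((n ∸ 1) C (k ∸ 1))
    × (5 * k ≤ 2 * n + 1 → GpIs (Kneser n k) ((n ∸ 1) C (k ∸ 1)))
    × (2 * n + 1 < 5 * k → ∀ N → GpIs (Kneser n k) N → N < (n ∸ 1) C (k ∸ 1))
theorem2 n@(suc n′) k@(suc k′) _ 4≤k 2k+1≤n = upper , (λ 5k≤ → (star n′ k′ , Unique.map⁺ withIn-injective (unique-vertices n′ k′) ,
    star-generalPosition (<⇒≤ 2k<n) 5k≤ , trans (List.length-map withIn (vertices n′ k′)) (length-vertices n′ k′)) , upper) ,
    λ { 2n+1<5k N ((S , uS , gp , refl) , _) → strict 2n+1<5k S uS gp }
  where
  2k<n : k + k < n
  2k<n = ≤-trans (≤-reflexive (trans (cong (λ z → suc (k + z)) (sym (+-identityʳ k))) (+-comm 1 (2 * k)))) 2k+1≤n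
  strict : 2 * n + 1 < 5 * k → ∀ S → Unique S → GeneralPosition (Kneser n k) S → length S < n′ C k′
  strict 2n+1<5k S uS gp = let uG , gp′ = kneser-family 4≤k 2k<n S uS gp in
    subst (_< n′ C k′) (List.length-map proj₁ S) (strict-bound 4≤k 2k<n uG gp′ 2n+1<5k)
  upper : GpAtMost (Kneser n k) (n′ C k′)
  upper S uS gp with 5 * k ≤? 2 * n + 1
  -- This branch takes in `n = 2 k + 1` for every `k ≥ 4`, where the averaged inequality would be
  -- too weak.
  ... | no  5k≰ = <⇒≤ (strict (≰⇒> 5k≰) S uS gp)
  ... | yes 5k≤ = let uG , gp′ = kneser-family 4≤k 2k<n S uS gp in
    subst (_≤ n′ C k′) (List.length-map proj₁ S) (family-≤ 4≤k 2k<n 5k≤ uG gp′)
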